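{- Let $\gamma$ be any positive constant. Assume that the U-Process starts at any biased configuration with $|s|\ge\gamma\sqrt{n\log n}$. Then the process converges to the monochromatic configuration in which all $n$ nodes support the initial majority color (i.e. $a=n$ if the majority color is Alpha) within $O(\log n)$ rounds, w.h.p. Furthermore, the result is almost tight in a twofold sense: (i) an initial configuration exists, with $|s|=\Omega(\sqrt{n\log n})$, such that the process requires $\Omega(\log n)$ rounds to converge, w.h.p.; and (ii) there is an initial configuration with $|s|=\Theta(\sqrt{n})$ such that the process converges to the minority color with constant probability (i.e. with probability bounded below by a positive constant independent of $n$).
   Context: U-Dynamics (Undecided-State Dynamics) with two colors in the parallel uniform PULL model on the complete graph with $n$ nodes. Each node is in one of three states: color Alpha, color Beta, or undecided. In every synchronous round every node $u$, independently of the others, picks a node $v$ uniformly at random among the $n$ nodes and looks at the state of $v$ at the beginning of the round; then all nodes update simultaneously: if $u$ is colored and $v$ has the other color, $u$ becomes undecided; if $u$ is colored and $v$ is undecided or has the same color as $u$, $u$ keeps its color; if $u$ is undecided, $u$ takes the state of $v$ (a color, or undecided). (The choice of $v$ is over all $n$ nodes, as in the paper's formulas, e.g. $\mathbf{E}[a(\mathbf{X}_{t+1})\mid \mathbf{X}_t=\mathbf{x}]=a(a+2q)/n$.) A configuration $\mathbf{x}$ is determined by the number $a(\mathbf{x})$ of Alpha-colored nodes and the number $b(\mathbf{x})$ of Beta-colored nodes. $q(\mathbf{x})=n-a(\mathbf{x})-b(\mathbf{x})$ is the number of undecided nodes and $s(\mathbf{x})=a(\mathbf{x})-b(\mathbf{x})$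 is the bias. The majority (resp. minority) color is the one supported by more (resp. fewer) nodes in the initial configuration. The resulting Markov chain $\{\mathbf{X}_t\}_{t\ge 0}$ on the set $\mathcal{C}$ of configurations is called the U-Process; its absorbing states are $q=n$, $a=n$, $b=n$. An event $\mathcal{E}_n$ holds w.h.p. if $\mathbf{P}(\mathcal{E}_n)\ge 1-n^{ -\Theta(1)}$, i.e. there is a constant $c>0$ with $\mathbf{P}(\mathcal{E}_n)\ge 1-n^{ -c}$ for all sufficiently large $n$. Constants hidden in asymptotic notation and in "w.h.p." may depend on $\gamma$ but not on $n$ or on the initial configuration (subject to the stated hypothesis). -}

module Defs where

open import Algebra.Definitions.RawSemiring using (_^_)
open import Data.Fin using (Fin)
open import Data.Integer as ℤ using (ℤ; +_)
open import Data.List as List using (List; []; _∷_; length; filter; allFin; cartesianProductWith)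
open import Data.List.Properties using (length-++; length-map; length-tabulate)
open import Data.Nat as ℕ using (ℕ; zero; suc; NonZero)
open import Data.Nat.Logarithm using (⌊log₂_⌋)
open import Data.Nat.Properties using (m^n≢0)
open import Data.Product using (∃-syntax)
open import Data.Rational as ℚ using (ℚ; 1ℚ; 0ℚ; ↥_; ↧ₙ_; +-*-rawSemiring)
open import Data.Sum using (_⊎_)
open import Data.Vec as Vec using (Vec; []; _∷_; lookup; zipWith; count)
open import Data.Vec.Relation.Unary.Any using (Any; any?)
open import Function using (id)
open import Level using (0ℓ)
open import Relation.Binary using (DecidableEquality)
open import Relation.Binary.PropositionalEquality
open import Relation.Nullary using (yes; no; _⊎-dec_)
open import Relation.Unary using (Pred; Decidable)

private
  variable
    A B C : Set
    n T : ℕ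

data Color : Set where
  Alpha Beta : Color

other : Color → Color
other Alpha = Beta
other Beta  = Alpha

data State : Set where
  colored   : Color → State
  undecided : State

_≟_ : DecidableEquality State
colored Alpha ≟ colored Alpha = yes refl
colored Alpha ≟ colored Beta  = no λ ()
colored Alpha ≟ undecided     = no λ ()
colored Beta  ≟ colored Alpha = no λ ()
colored Beta  ≟ colored Beta  = yes refl
colored Beta  ≟ undecided     = no λ ()
undecided     ≟ colored _     = no λ ()
undecided     ≟ undecided     = yes refl

-- `update u v` is the new state of a node in state u that looks at a node
-- in state v.
update : State → State → State
update (colored Alpha) (colored Beta) = undecided
update (colored Beta) (colored Alpha) = undecided
update (colored c)     _              = colored c
update undecided       v              = v

-- The process is run on the individual nodes; up to renaming the nodes, a
-- configuration is the pair of numbers of Alpha- and Beta-colored nodes.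
Config : ℕ → Set
Config n = Vec State n

support : Color → Config n → ℕ
support c = count (_≟ colored c)

q : Config n → ℕ
q = count (_≟ undecided)

s : Config n → ℤ
s x = + support Alpha x ℤ.- + support Beta x

∣s∣ : Config n → ℕ
∣s∣ x = ℤ.∣ s x ∣

Majority Minority : Color → Pred (Config n) 0ℓ
Majority c x = support (other c) x ℕ.< support c x
Minority c x = support c x ℕ.< support (other c) x

Monochromatic : Color → Pred (Config n) 0ℓ
Monochromatic {n} c x = support c x ≡ n

monochromatic? : (c : Color) → Decidable (Monochromatic {n} c)
monochromatic? {n} c x = support c x ℕ.≟ n

Absorbing : Pred (Config n) 0ℓ
Absorbing {n} x = q x ≡ n ⊎ Monochromatic Alpha x ⊎ Monochromatic Beta x

absorbing? : Decidable (Absorbing {n})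
absorbing? {n} x =
  (q x ℕ.≟ n) ⊎-dec (monochromatic? Alpha x ⊎-dec monochromatic? Beta x)

-- The random choices of one round: entry u is the node that node u looks at
-- (possibly u itself).
Choices : ℕ → Set
Choices n = Vec (Fin n) n

step : Config n → Choices n → Config n
step x f = zipWith update x (Vec.map (lookup x) f)

-- The random choices of the first T rounds.
Outcome : ℕ → ℕ → Set
Outcome n T = Vec (Choices n) T

-- X₀ = x, X₁, …, X_T.
trajectory : Config n → Outcome n T → Vec (Config n) (suc T)
trajectory x []      = x ∷ []
trajectory x (f ∷ ω) = x ∷ trajectory (step x f) ω

ReachesWithin : Pred (Config n) 0ℓ → Config n → (T : ℕ) → Pred (Outcome n T) 0ℓ
ReachesWithin P x T ω = Any P (trajectory x ω)

reachesWithin? : {P : Pred (Config n) 0ℓ} → Decidable P →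
                 (x : Config n) (T : ℕ) → Decidable (ReachesWithin P x T)
reachesWithin? P? x T ω = any? P? (trajectory x ω)

-- Every vector over the entries of xs, once each if xs has no repetitions.
vectors : List A → (m : ℕ) → List (Vec A m)
vectors xs zero    = [] ∷ []
vectors xs (suc m) = cartesianProductWith _∷_ xs (vectors xs m)

outcomes : (n T : ℕ) → List (Outcome n T)
outcomes n T = vectors (vectors (allFin n) n) T

length-cartesianProductWith : (f : A → B → C) (xs : List A) (ys : List B) →
  length (cartesianProductWith f xs ys) ≡ length xs ℕ.* length ys
length-cartesianProductWith f []       ys = refl
length-cartesianProductWith f (x ∷ xs) ys =
  trans (length-++ (List.map (f x) ys))
        (cong₂ ℕ._+_ (length-map (f x) ys) (length-cartesianProductWith f xs ys))

length-vectors : (xs : List A) (m : ℕ) → length (vectors xs m) ≡ length xs ℕ.^ m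
length-vectors xs zero    = refl
length-vectors xs (suc m) =
  trans (length-cartesianProductWith _∷_ xs (vectors xs m))
        (cong (length xs ℕ.*_) (length-vectors xs m))

length-outcomes : (n T : ℕ) → length (outcomes n T) ≡ (n ℕ.^ n) ℕ.^ T
length-outcomes n T =
  trans (length-vectors (vectors (allFin n) n) T)
        (cong (ℕ._^ T) (trans (length-vectors (allFin n) n)
                              (cong (ℕ._^ n) (length-tabulate {n = n} id))))

-- Uniform probability on the (nⁿ)ᵀ outcomes (see length-outcomes): the
-- choices of all nodes in all rounds are independent and uniform on Fin n.
ℙ : .{{NonZero n}} → {E : Pred (Outcome n T) 0ℓ} → Decidable E → ℚ
ℙ {n} {T} E? = (+ length (filter E? (outcomes n T))) ℚ./ ((n ℕ.^ n) ℕ.^ T)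
  where instance
    nⁿ≢0 : NonZero (n ℕ.^ n)
    nⁿ≢0 = m^n≢0 n n
    nⁿᵀ≢0 : NonZero ((n ℕ.^ n) ℕ.^ T)
    nⁿᵀ≢0 = m^n≢0 (n ℕ.^ n) T

-- P(X_t ∈ P for some t ≥ 0) ≥ p.  By continuity from below this probability
-- is the supremum over T of the probabilities of P being reached within T rounds.
EventuallyWithProb≥ : .{{NonZero n}} → {P : Pred (Config n) 0ℓ} → Decidable P →
                      Config n → ℚ → Set
EventuallyWithProb≥ P? x p =
  ∀ η → 0ℚ ℚ.< η → ∃[ T ] p ℚ.- η ℚ.≤ ℙ (reachesWithin? P? x T)

fromℕ : ℕ → ℚ
fromℕ k = + k ℚ./ 1

-- γ √k ≤ m and m ≤ γ √k, for γ ≥ 0, compared through the squares.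
_√_≤_ : ℚ → ℕ → ℕ → Set
γ √ k ≤ m = γ ℚ.* γ ℚ.* fromℕ k ℚ.≤ fromℕ (m ℕ.* m)

_≤_√_ : ℕ → ℚ → ℕ → Set
m ≤ γ √ k = fromℕ (m ℕ.* m) ℚ.≤ γ ℚ.* γ ℚ.* fromℕ k

-- p ≥ 1 - n^(-c) for n ≥ 1, p ≤ 1 and c = u/v ≥ 0, rewritten as (1-p)^v · n^u ≤ 1.
_≥1-_^-_ : ℚ → ℕ → ℚ → Set
p ≥1- n ^- c =
  (1ℚ ℚ.- p) ^ᵠ (↧ₙ c) ℚ.* fromℕ (n ℕ.^ ℤ.∣ ↥ c ∣) ℚ.≤ 1ℚ
  where _^ᵠ_ = _^_ +-*-rawSemiring

-- All logarithms occur up to a constant factor absorbed by quantified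
-- constants, and ⌊log₂ n⌋ is of the order of log n for n ≥ 2.
log : ℕ → ℕ
log n = ⌊log₂ n ⌋

{-# OPTIONS --safe #-}

-- Let a, b and u count the nodes of the majority color, of the other color and the undecided
-- ones, and let s = a - b. One round changes the expectation of s into s (1 + u/n), and
-- u² + 2ab, the expectation of n times the new u, is of the order of n² unless 9u + 20b ≤ 3n.
-- So a bias s with s² ≥ const · nL grows geometrically until 9u + 20b ≤ 3n, and a Chernoff bound
-- (obtained from the arithmetic-geometric mean inequality, which keeps all of it inside ℕ) gives
-- a failure probability 2^(-L) that shrinks geometrically from round to round. In the region
-- 9u + 20b ≤ 3n, the statistic 9u + 20b contracts by 14/15 in expectation, hence vanishes after
-- O(log n) rounds by Markov's inequality.
-- For (i), start without the color Beta: the number of Alpha nodes at most doubles in expectation.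
-- For (ii), tilt the choices in favor of the minority by a relative 1/√n: under the tilted
-- choices the bias is reversed to D √n in one round, and since the likelihood ratio has a bounded
-- second moment, the same holds with constant probability under the uniform choices.

module Submission where

open import Algebra.Definitions.RawSemiring using () renaming (_^_ to _^ᴿ_)
open import Data.Bool using (if_then_else_; true; false)
open import Data.Fin using (Fin)
open import Data.Integer as ℤ using (+[1+_]; +≤+) renaming (+_ to pos)
import Data.Integer.Properties as ℤ
open import Data.List as List using (List; []; _∷_; _++_; length; map; replicate; allFin; filter; cartesianProductWith)
open import Data.List.Properties using (length-++; length-replicate; length-map; map-++; map-∘; map-tabulate; length-tabulate)
open import Data.Nat as ℕ hiding (_≟_)
open import Data.Nat.Coprimality using (1-coprimeTo)
open import Data.Nat.DivMod using (m≡m%n+[m/n]*n; m%n<n; m/n*n≤m; m/n≤m; m*n/n≡m; /-monoˡ-≤)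
open import Data.Nat.ListAction using (sum; product)
open import Data.Nat.ListAction.Properties using (sum-++; product-++)
open import Data.Nat.Logarithm using (⌊log₂⌋-mono-≤; ⌊log₂⌊n/2⌋⌋≡⌊log₂n⌋∸1; ⌊log₂[2^n]⌋≡n)
open import Data.Nat.Properties hiding (_≟_)
open import Data.Nat.Tactic.RingSolver using (solve-∀)
open import Algebra.Properties.CommutativeSemigroup *-commutativeSemigroup using (x∙yz≈y∙xz; x∙yz≈yx∙z; xy∙z≈xz∙y; xy∙z≈x∙zy; xy∙z≈z∙xy)
open import Data.Product using (_×_; _,_; ∃-syntax; proj₁; proj₂)
open import Data.Rational as ℚ using (ℚ; mkℚ; 0ℚ; 1ℚ; toℚᵘ; ↧ₙ_)
import Data.Rational.Properties as ℚ
open import Data.Rational.Solver using (module +-*-Solver)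
open import Data.Rational.Unnormalised as ℚᵘ using (mkℚᵘ; *≡*; *≤*)
import Data.Rational.Unnormalised.Properties as ℚᵘ
open import Data.Sum using (_⊎_; inj₁; inj₂)
open import Data.Unit using (tt)
open import Data.Vec as Vec using (Vec; []; _∷_; lookup; toList; zipWith)
open import Data.Vec.Properties using (length-toList)
open import Data.Vec.Relation.Unary.Any using (here; there)
open import Function using (id; it; _∘_)
open import Level using (0ℓ)
open import Relation.Binary.PropositionalEquality hiding (J)
open import Relation.Nullary using (Dec; yes; no; does; ¬_; ¬?; contradiction; _⊎-dec_)
open import Relation.Nullary.Decidable using (decidable-stable)
open import Relation.Unary using (Pred; Decidable)
open import Defs

-- Inequalities between natural numbers

-- Outcomes are counted, so every probability bound is an inequality between naturals with cleared
-- denominators. The exponential of the Chernoff method becomes a power of 1 + 1/M, bounded by its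
-- chord, and the target 2^(-L) enters the mean as L further factors equal to 2. The scale M is
-- free: a deviation of order σ from a mean of order n calls for M of order n/σ and then allows L of
-- order σ²/n. One bound thus serves deviations of order √n, √(n log n) and n. The obstacle to
-- growth is that 1 + u/n exceeds 1 by a constant only while u is a constant fraction of n, and
-- nothing is known about u at the start. But u² + 2ab is large even when u is small: outside the
-- final region each round leaves at least n/20 undecided nodes up to a small failure probability,
-- so only the first round has to be survived without growth. The final region needs a weighted
-- count because u alone may increase there: nodes of the other color become undecided and turn
-- colored nodes undecided.

-- Linear arithmetic by certificates: the equation is an identity for the ring solver.
≤-cert : ∀ {a b p q} → p ≤ q → b + p ≡ a + q → a ≤ b
≤-cert {a} {b} {p} {q} p≤q eq =
  +-cancelʳ-≤ q a b (≤-trans (≤-reflexive (sym eq)) (+-monoʳ-≤ b p≤q))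

≤-cert-slack : ∀ {a b p q} r → p ≤ q → b + p ≡ a + q + r → a ≤ b
≤-cert-slack {a} {b} {p} {q} r p≤q eq =
  ≤-trans (m≤m+n a r) (≤-cert p≤q (trans eq (lemma a q r)))
  where
  lemma : ∀ a q r → a + q + r ≡ a + r + q
  lemma = solve-∀

2xy≤x²+y² : ∀ x y → 2 * (x * y) ≤ x * x + y * y
2xy≤x²+y² x y with ≤-total x y
... | inj₁ x≤y = subst (λ z → 2 * (x * z) ≤ x * x + z * z) (m+[n∸m]≡n x≤y)
                       (≤-cert-slack ((y ∸ x) * (y ∸ x)) (z≤n {0}) (lemma x (y ∸ x)))
  where
  lemma : ∀ x d → x * x + (x + d) * (x + d) + 0 ≡ 2 * (x * (x + d)) + 0 + d * d
  lemma = solve-∀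
... | inj₂ y≤x = subst (λ z → 2 * (z * y) ≤ z * z + y * y) (m+[n∸m]≡n y≤x)
                       (≤-cert-slack ((x ∸ y) * (x ∸ y)) (z≤n {0}) (lemma y (x ∸ y)))
  where
  lemma : ∀ y d → (y + d) * (y + d) + y * y + 0 ≡ 2 * ((y + d) * y) + 0 + d * d
  lemma = solve-∀

[m*n]^o≡m^o*n^o : ∀ m n o → (m * n) ^ o ≡ m ^ o * n ^ o
[m*n]^o≡m^o*n^o m n zero    = refl
[m*n]^o≡m^o*n^o m n (suc o) =
  trans (cong (m * n *_) ([m*n]^o≡m^o*n^o m n o)) (lemma m n (m ^ o) (n ^ o))
  where
  lemma : ∀ m n p q → m * n * (p * q) ≡ m * p * (n * q)
  lemma = solve-∀

-- Young's inequality, the tangent to y ↦ y^(m+1) at z.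
tangent-^ : ∀ m y z → suc m * (z ^ m * y) ≤ y ^ suc m + m * z ^ suc m
tangent-^ zero    y z = ≤-reflexive (lemma y)
  where
  lemma : ∀ y → 1 * (1 * y) ≡ y * 1 + 0
  lemma = solve-∀
tangent-^ (suc m) y z = ≤-cert
  (+-mono-≤ (*-monoʳ-≤ y (tangent-^ m y z)) (*-monoʳ-≤ (suc m * z ^ m) (2xy≤x²+y² y z)))
  (lemma m y z (z ^ m) (y ^ suc m))
  where
  lemma : ∀ m y z Z Y →
    y * Y + (1 + m) * (z * (z * Z)) + (y * ((1 + m) * (Z * y)) + (1 + m) * Z * (2 * (y * z))) ≡
    (2 + m) * (z * Z * y) + (y * (Y + m * (z * Z)) + (1 + m) * Z * (y * y + z * z))
  lemma = solve-∀

-- Young's inequality at `y = (x + S) * n` and `z = S * suc n`, which are n (n + 1) times the means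
-- after and before `x` joins `n` numbers of sum `S`.
am-gm-step : ∀ n x S → .{{_ : NonZero n}} →
             x * S ^ n * suc n ^ suc n ≤ (x + S) ^ suc n * n ^ n
am-gm-step n x S = *-cancelˡ-≤ n (≤-cert tangent
  (lemma n x S (S ^ n) (suc n ^ n) ((x + S) ^ suc n) (n ^ n)))
  where
  tangent : suc n * (S ^ n * suc n ^ n * ((x + S) * n)) ≤
            (x + S) ^ suc n * (n * n ^ n) + n * (S * S ^ n * (suc n * suc n ^ n))
  tangent = subst₂ _≤_
    (cong (λ v → suc n * (v * ((x + S) * n))) ([m*n]^o≡m^o*n^o S (suc n) n))
    (cong₂ (λ v w → v + n * w) ([m*n]^o≡m^o*n^o (x + S) n (suc n)) ([m*n]^o≡m^o*n^o S (suc n) (suc n)))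
    (tangent-^ n ((x + S) * n) (S * suc n))
  lemma : ∀ n x S Sⁿ V Y N →
    n * (Y * N) + (1 + n) * (Sⁿ * V * ((x + S) * n)) ≡
    n * (x * Sⁿ * ((1 + n) * V)) + (Y * (n * N) + n * (S * Sⁿ * ((1 + n) * V)))
  lemma = solve-∀

am-gm : ∀ xs → product xs * length xs ^ length xs ≤ sum xs ^ length xs
am-gm []           = ≤-refl
am-gm (x ∷ [])     = ≤-reflexive (lemma x)
  where
  lemma : ∀ x → x * 1 * 1 ≡ (x + 0) * 1
  lemma = solve-∀
am-gm (x ∷ xs@(_ ∷ _)) = *-cancelʳ-≤ _ _ (n ^ n) {{m^n≢0 n n}} (begin
  x * product xs * V * n ^ n   ≡⟨ lemma x (product xs) V (n ^ n) ⟩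
  x * V * (product xs * n ^ n) ≤⟨ *-monoʳ-≤ (x * V) (am-gm xs) ⟩
  x * V * sum xs ^ n           ≡⟨ lemma′ x V (sum xs ^ n) ⟩
  x * sum xs ^ n * V           ≤⟨ am-gm-step n x (sum xs) ⟩
  (x + sum xs) ^ suc n * n ^ n ∎)
  where
  open ≤-Reasoning
  n = length xs
  V = suc n ^ suc n
  lemma : ∀ x p v m → x * p * v * m ≡ x * v * (p * m)
  lemma = solve-∀
  lemma′ : ∀ x v s → x * v * s ≡ x * s * v
  lemma′ = solve-∀

am-gm-≤ : ∀ xs Q → sum xs ≤ length xs * Q → product xs ≤ Q ^ length xs
am-gm-≤ []            Q _    = ≤-refl
am-gm-≤ xs@(_ ∷ _) Q sum≤ = *-cancelʳ-≤ _ _ (n ^ n) {{m^n≢0 n n}} (begin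
  product xs * n ^ n ≤⟨ am-gm xs ⟩
  sum xs ^ n         ≤⟨ ^-monoˡ-≤ n sum≤ ⟩
  (n * Q) ^ n        ≡⟨ [m*n]^o≡m^o*n^o n Q n ⟩
  n ^ n * Q ^ n      ≡⟨ *-comm (n ^ n) (Q ^ n) ⟩
  Q ^ n * n ^ n      ∎)
  where
  open ≤-Reasoning
  n = length xs

-- Sums and products over the random choices of a round

private
  variable
    A B : Set
    k n T : ℕ

∑ ∏ : List A → (A → ℕ) → ℕ
∑ xs f = sum (map f xs)
∏ xs f = product (map f xs)

∑-cong : {f g : A → ℕ} (xs : List A) → (∀ x → f x ≡ g x) → ∑ xs f ≡ ∑ xs g
∑-cong []       f≗g = refl
∑-cong (x ∷ xs) f≗g = cong₂ _+_ (f≗g x) (∑-cong xs f≗g)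

∏-cong : {f g : A → ℕ} (xs : List A) → (∀ x → f x ≡ g x) → ∏ xs f ≡ ∏ xs g
∏-cong []       f≗g = refl
∏-cong (x ∷ xs) f≗g = cong₂ _*_ (f≗g x) (∏-cong xs f≗g)

∑-mono : {f g : A → ℕ} (xs : List A) → (∀ x → f x ≤ g x) → ∑ xs f ≤ ∑ xs g
∑-mono []       f≤g = ≤-refl
∑-mono (x ∷ xs) f≤g = +-mono-≤ (f≤g x) (∑-mono xs f≤g)

∏-mono : {f g : A → ℕ} (xs : List A) → (∀ x → f x ≤ g x) → ∏ xs f ≤ ∏ xs g
∏-mono []       f≤g = ≤-refl
∏-mono (x ∷ xs) f≤g = *-mono-≤ (f≤g x) (∏-mono xs f≤g)

∑-+ : (f g : A → ℕ) (xs : List A) → ∑ xs (λ x → f x + g x) ≡ ∑ xs f + ∑ xs g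
∑-+ f g []       = refl
∑-+ f g (x ∷ xs) = trans (cong (f x + g x +_) (∑-+ f g xs)) (lemma (f x) (g x) (∑ xs f) (∑ xs g))
  where
  lemma : ∀ a b c d → a + b + (c + d) ≡ a + c + (b + d)
  lemma = solve-∀

∑-* : (m : ℕ) (f : A → ℕ) (xs : List A) → ∑ xs (λ x → m * f x) ≡ m * ∑ xs f
∑-* m f []       = sym (*-zeroʳ m)
∑-* m f (x ∷ xs) = trans (cong (m * f x +_) (∑-* m f xs)) (sym (*-distribˡ-+ m (f x) (∑ xs f)))

∑-*ʳ : (m : ℕ) (f : A → ℕ) (xs : List A) → ∑ xs (λ x → f x * m) ≡ ∑ xs f * m
∑-*ʳ m f xs = trans (∑-cong xs (λ x → *-comm (f x) m)) (trans (∑-* m f xs) (*-comm m (∑ xs f)))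

∏-* : (m : ℕ) (f : A → ℕ) (xs : List A) → ∏ xs (λ x → m * f x) ≡ m ^ length xs * ∏ xs f
∏-* m f []       = refl
∏-* m f (x ∷ xs) = trans (cong (m * f x *_) (∏-* m f xs)) (lemma m (f x) (m ^ length xs) (∏ xs f))
  where
  lemma : ∀ a b c d → a * b * (c * d) ≡ a * c * (b * d)
  lemma = solve-∀

∑-const : (m : ℕ) (xs : List A) → ∑ xs (λ _ → m) ≡ length xs * m
∑-const m []       = refl
∑-const m (x ∷ xs) = cong (m +_) (∑-const m xs)

∏-const : (m : ℕ) (xs : List A) → ∏ xs (λ _ → m) ≡ m ^ length xs
∏-const m []       = refl
∏-const m (x ∷ xs) = cong (m *_) (∏-const m xs)

∑-++ : (f : A → ℕ) (xs ys : List A) → ∑ (xs ++ ys) f ≡ ∑ xs f + ∑ ys f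
∑-++ f xs ys = trans (cong sum (map-++ f xs ys)) (sum-++ (map f xs) (map f ys))

∑-map : (h : A → B) (f : B → ℕ) (xs : List A) → ∑ (map h xs) f ≡ ∑ xs (f ∘ h)
∑-map h f xs = cong sum (sym (map-∘ xs))

∑-vectors : (xs : List A) (f : Vec A (suc k) → ℕ) →
  ∑ (vectors xs (suc k)) f ≡ ∑ xs (λ x → ∑ (vectors xs k) (λ v → f (x ∷ v)))
∑-vectors {k = k} xs f = go xs
  where
  vs = vectors xs k
  go : ∀ ys → ∑ (cartesianProductWith _∷_ ys vs) f ≡ ∑ ys (λ y → ∑ vs (λ v → f (y ∷ v)))
  go []       = refl
  go (y ∷ ys) = trans (∑-++ f (map (y ∷_) vs) (cartesianProductWith _∷_ ys vs))
                      (cong₂ _+_ (∑-map (y ∷_) f vs) (go ys))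

zipSum zipProduct : (B → A → ℕ) → Vec B k → Vec A k → ℕ
zipSum     g ys v = Vec.sum (zipWith g ys v)
zipProduct g []       []      = 1
zipProduct g (y ∷ ys) (x ∷ v) = g y x * zipProduct g ys v

∑-zipProduct : (g : B → A → ℕ) (xs : List A) (ys : Vec B k) →
  ∑ (vectors xs k) (zipProduct g ys) ≡ ∏ (toList ys) (λ y → ∑ xs (g y))
∑-zipProduct g xs []       = refl
∑-zipProduct g xs (y ∷ ys) = begin
  ∑ (vectors xs _) (zipProduct g (y ∷ ys))                        ≡⟨ ∑-vectors xs _ ⟩
  ∑ xs (λ x → ∑ (vectors xs _) (λ v → g y x * zipProduct g ys v)) ≡⟨ ∑-cong xs inner ⟩
  ∑ xs (λ x → P * g y x)                                          ≡⟨ ∑-* P (g y) xs ⟩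
  P * ∑ xs (g y)                                                  ≡⟨ *-comm P _ ⟩
  ∑ xs (g y) * P                                                  ∎
  where
  open ≡-Reasoning
  P = ∏ (toList ys) (λ y → ∑ xs (g y))
  inner : ∀ x → ∑ (vectors xs _) (λ v → g y x * zipProduct g ys v) ≡ P * g y x
  inner x = trans (∑-* (g y x) (zipProduct g ys) (vectors xs _))
                  (trans (cong (g y x *_) (∑-zipProduct g xs ys)) (*-comm (g y x) P))

-- By linearity each entry contributes its own sum times a power of `length xs` with exponent k - 1;
-- the factor `length xs` on the left avoids that exponent.
∑-zipSum : (g : B → A → ℕ) (xs : List A) (ys : Vec B k) →
  length xs * ∑ (vectors xs k) (zipSum g ys) ≡ length xs ^ k * ∑ (toList ys) (λ y → ∑ xs (g y))
∑-zipSum g xs []       = *-zeroʳ (length xs)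
∑-zipSum {k = suc k} g xs (y ∷ ys) = begin
  ℓ * ∑ (vectors xs (suc k)) (zipSum g (y ∷ ys))
    ≡⟨ cong (ℓ *_) (∑-vectors xs _) ⟩
  ℓ * ∑ xs (λ x → ∑ vs (λ v → g y x + zipSum g ys v))
    ≡⟨ cong (ℓ *_) (∑-cong xs λ x → trans (∑-+ (λ _ → g y x) (zipSum g ys) vs)
                                           (cong (_+ Z) (∑-const (g y x) vs))) ⟩
  ℓ * ∑ xs (λ x → length vs * g y x + Z)
    ≡⟨ cong (ℓ *_) (trans (∑-+ _ _ xs) (cong₂ _+_ (∑-* (length vs) (g y) xs) (∑-const Z xs))) ⟩
  ℓ * (length vs * S + ℓ * Z)
    ≡⟨ cong₂ (λ a b → ℓ * (a * S + b)) (length-vectors xs k) (∑-zipSum g xs ys) ⟩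
  ℓ * (ℓ ^ k * S + ℓ ^ k * R)
    ≡⟨ lemma ℓ (ℓ ^ k) S R ⟩
  ℓ * ℓ ^ k * (S + R) ∎
  where
  open ≡-Reasoning
  ℓ = length xs
  vs = vectors xs k
  Z = ∑ vs (zipSum g ys)
  S = ∑ xs (g y)
  R = ∑ (toList ys) (λ y → ∑ xs (g y))
  lemma : ∀ a b c d → a * (b * c + b * d) ≡ a * b * (c + d)
  lemma = solve-∀

𝟙 : {P : Set} → Dec P → ℕ
𝟙 P? = if does P? then 1 else 0

length-filter : {P : Pred A 0ℓ} (P? : Decidable P) (xs : List A) →
                length (filter P? xs) ≡ ∑ xs (λ x → 𝟙 (P? x))
length-filter P? []       = refl
length-filter P? (x ∷ xs) with does (P? x)
... | true  = cong suc (length-filter P? xs)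
... | false = length-filter P? xs

choices : (n : ℕ) → List (Choices n)
choices n = vectors (allFin n) n

length-choices : ∀ n → length (choices n) ≡ n ^ n
length-choices n = trans (length-vectors (allFin n) n) (cong (_^ n) (length-tabulate {n = n} id))

nodes : Config n → List State
nodes = toList

∑-lookup : (g : State → ℕ) (x : Config n) → ∑ (allFin n) (g ∘ lookup x) ≡ ∑ (nodes x) g
∑-lookup {n} g x = trans (cong sum (map-tabulate {n = n} id (g ∘ lookup x))) (go x)
  where
  go : ∀ {n} (x : Config n) → sum (List.tabulate (g ∘ lookup x)) ≡ ∑ (nodes x) g
  go []      = refl
  go (u ∷ x) = cong (g u +_) (go x)

-- The likelihood, not normalised, of the choices when every node looks at a node with probability
-- proportional to the weight of that node's state. Weight 1 is the uniform law; other weights serve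
-- the change of measure for the minority win.
weight : (State → ℕ) → Config n → Choices n → ℕ
weight w x f = ∏ (toList f) (w ∘ lookup x)

mass : (State → ℕ) → (x : Config n) → {E : Pred (Choices n) 0ℓ} → Decidable E → ℕ
mass w x E? = ∑ (choices _) (λ f → weight w x f * 𝟙 (E? f))

-- The choices of different nodes are independent, so the sum factors over the nodes. For `φ`
-- exponential in a statistic this evaluates its moment generating function; for `φ` constantly 1 it
-- gives the total weight of all choices.
∑-step-∏ : (w φ : State → ℕ) (x : Config n) →
  ∑ (choices n) (λ f → weight w x f * ∏ (nodes (step x f)) φ) ≡
  ∏ (nodes x) (λ u → ∑ (nodes x) (λ v → w v * φ (update u v)))
∑-step-∏ {n} w φ x = begin
  ∑ (choices n) (λ f → weight w x f * ∏ (nodes (step x f)) φ)   ≡⟨ ∑-cong (choices n) (λ f → go x f) ⟩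
  ∑ (choices n) (zipProduct g x)                                ≡⟨ ∑-zipProduct g (allFin n) x ⟩
  ∏ (nodes x) (λ u → ∑ (allFin n) (g u))                        ≡⟨ ∏-cong (nodes x) (λ u → ∑-lookup _ x) ⟩
  ∏ (nodes x) (λ u → ∑ (nodes x) (λ v → w v * φ (update u v)))  ∎
  where
  open ≡-Reasoning
  g : State → Fin n → ℕ
  g u i = w (lookup x i) * φ (update u (lookup x i))
  lemma : ∀ a b c d → a * b * (c * d) ≡ a * c * (b * d)
  lemma = solve-∀
  go : ∀ {k} (y : Vec State k) (f : Vec (Fin n) k) →
    ∏ (toList f) (w ∘ lookup x) * ∏ (toList (zipWith update y (Vec.map (lookup x) f))) φ ≡ zipProduct g y f
  go []      []      = refl
  go (u ∷ y) (i ∷ f) = trans (lemma (w (lookup x i)) _ (φ (update u (lookup x i))) _)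
                             (cong (g u i *_) (go y f))

∑-step-∑ : (h : State → ℕ) (x : Config n) →
  n * ∑ (choices n) (λ f → ∑ (nodes (step x f)) h) ≡
  n ^ n * ∑ (nodes x) (λ u → ∑ (nodes x) (λ v → h (update u v)))
∑-step-∑ {n} h x = begin
  n * ∑ (choices n) (λ f → ∑ (nodes (step x f)) h)
    ≡⟨ cong₂ _*_ (sym ℓ≡n) (∑-cong (choices n) (λ f → go x f)) ⟩
  ℓ * ∑ (choices n) (zipSum g x)
    ≡⟨ ∑-zipSum g (allFin n) x ⟩
  ℓ ^ n * ∑ (nodes x) (λ u → ∑ (allFin n) (g u))
    ≡⟨ cong₂ _*_ (cong (_^ n) ℓ≡n) (∑-cong (nodes x) (λ u → ∑-lookup _ x)) ⟩
  n ^ n * ∑ (nodes x) (λ u → ∑ (nodes x) (λ v → h (update u v))) ∎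
  where
  open ≡-Reasoning
  ℓ = length (allFin n)
  ℓ≡n : ℓ ≡ n
  ℓ≡n = length-tabulate {n = n} id
  g : State → Fin n → ℕ
  g u i = h (update u (lookup x i))
  go : ∀ {k} (y : Vec State k) (f : Vec (Fin n) k) →
    ∑ (toList (zipWith update y (Vec.map (lookup x) f))) h ≡ zipSum g y f
  go []      []      = refl
  go (u ∷ y) (i ∷ f) = cong (g u i +_) (go y f)

-- A Chernoff bound for one round

product-replicate : ∀ k m → product (replicate k m) ≡ m ^ k
product-replicate zero    m = refl
product-replicate (suc k) m = cong (m *_) (product-replicate k m)

sum-replicate : ∀ k m → sum (replicate k m) ≡ k * m
sum-replicate zero    m = refl
sum-replicate (suc k) m = cong (m +_) (sum-replicate k m)

am-gm-weighted : ∀ (xs : List ℕ) j a l b Q →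
  sum xs + j * a + l * b ≤ (length xs + j + l) * Q →
  product xs * a ^ j * b ^ l ≤ Q ^ length xs * Q ^ j * Q ^ l
am-gm-weighted xs j a l b Q sum≤ = subst₂ _≤_ product≡ power≡
  (am-gm-≤ all Q (subst₂ (λ s m → s ≤ m * Q) (sym sum≡) (sym length≡) sum≤))
  where
  as = replicate j a
  bs = replicate l b
  all = (xs ++ as) ++ bs
  sum≡ : sum all ≡ sum xs + j * a + l * b
  sum≡ = trans (sum-++ (xs ++ as) bs)
    (cong₂ _+_ (trans (sum-++ xs as) (cong (sum xs +_) (sum-replicate j a))) (sum-replicate l b))
  product≡ : product all ≡ product xs * a ^ j * b ^ l
  product≡ = trans (product-++ (xs ++ as) bs)
    (cong₂ _*_ (trans (product-++ xs as) (cong (product xs *_) (product-replicate j a))) (product-replicate l b))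
  length≡ : length all ≡ length xs + j + l
  length≡ = trans (length-++ (xs ++ as))
    (cong₂ _+_ (trans (length-++ xs) (cong (length xs +_) (length-replicate j))) (length-replicate l))
  power≡ : Q ^ length all ≡ Q ^ length xs * Q ^ j * Q ^ l
  power≡ = trans (cong (Q ^_) length≡)
    (trans (^-distribˡ-+-* Q (length xs + j) l) (cong (_* Q ^ l) (^-distribˡ-+-* Q (length xs) j)))

-- (1 + 1/M)^h ≤ 1 + h (M + B) / M² for h ≤ B ≤ √M.
chord : ∀ M B h → B * B ≤ M → h ≤ B → suc M ^ h * (M * M) ≤ M ^ h * (M * M + h * (M + B))
chord M B zero    B²≤M h≤B = ≤-reflexive (lemma M)
  where
  lemma : ∀ M → 1 * (M * M) ≡ 1 * (M * M + 0)
  lemma = solve-∀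
chord M B (suc h) B²≤M h<B = begin
  suc M * suc M ^ h * (M * M)                  ≡⟨ *-assoc (suc M) (suc M ^ h) (M * M) ⟩
  suc M * (suc M ^ h * (M * M))                ≤⟨ *-monoʳ-≤ (suc M) (chord M B h B²≤M (<⇒≤ h<B)) ⟩
  suc M * (M ^ h * (M * M + h * (M + B)))      ≡⟨ lemma₁ (suc M) (M ^ h) (M * M + h * (M + B)) ⟩
  M ^ h * (suc M * (M * M + h * (M + B)))      ≤⟨ *-monoʳ-≤ (M ^ h) slope ⟩
  M ^ h * (M * (M * M + suc h * (M + B)))      ≡⟨ lemma₂ (M ^ h) M _ ⟩
  M * M ^ h * (M * M + suc h * (M + B))        ∎
  where
  open ≤-Reasoning
  lemma₁ : ∀ a b c → a * (b * c) ≡ b * (a * c)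
  lemma₁ = solve-∀
  lemma₂ : ∀ a b c → a * (b * c) ≡ b * a * c
  lemma₂ = solve-∀
  hB≤M : suc h * B ≤ M
  hB≤M = ≤-trans (*-monoˡ-≤ B h<B) B²≤M
  slope : suc M * (M * M + h * (M + B)) ≤ M * (M * M + suc h * (M + B))
  slope = ≤-cert-slack B (+-mono-≤ hB≤M hM≤) (lemma₃ M B h)
    where
    hM≤ : suc h * M ≤ M * B
    hM≤ = ≤-trans (*-monoˡ-≤ M h<B) (≤-reflexive (*-comm B M))
    lemma₃ : ∀ M B h → M * (M * M + (1 + h) * (M + B)) + ((1 + h) * B + (1 + h) * M) ≡
                       (1 + M) * (M * M + h * (M + B)) + (M + M * B) + B
    lemma₃ = solve-∀

-- The padding `M ^ (B ∸ h x)` brings every factor to the common denominator `M ^ B`: up to it, the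
-- product is 1 + 1/M to the power `∑ xs h`.
∏-level : ∀ M B (h : A → ℕ) (xs : List A) → (∀ x → h x ≤ B) →
  ∏ xs (λ x → suc M ^ h x * M ^ (B ∸ h x)) * M ^ ∑ xs h ≡ suc M ^ ∑ xs h * (M ^ B) ^ length xs
∏-level M B h []       h≤B = refl
∏-level M B h (x ∷ xs) h≤B = begin
  σ * t * P * M ^ (h x + H)                 ≡⟨ cong (σ * t * P *_) (^-distribˡ-+-* M (h x) H) ⟩
  σ * t * P * (M ^ h x * M ^ H)             ≡⟨ lemma₁ σ t P (M ^ h x) (M ^ H) ⟩
  σ * (M ^ h x * t) * (P * M ^ H)           ≡⟨ cong₂ (λ a b → σ * a * b) M^B (∏-level M B h xs h≤B) ⟩
  σ * M ^ B * (suc M ^ H * (M ^ B) ^ ℓ)     ≡⟨ lemma₂ σ (M ^ B) (suc M ^ H) ((M ^ B) ^ ℓ) ⟩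
  σ * suc M ^ H * (M ^ B * (M ^ B) ^ ℓ)     ≡⟨ cong (_* (M ^ B * (M ^ B) ^ ℓ)) (^-distribˡ-+-* (suc M) (h x) H) ⟨
  suc M ^ (h x + H) * (M ^ B * (M ^ B) ^ ℓ) ∎
  where
  open ≡-Reasoning
  ℓ = length xs
  H = ∑ xs h
  σ = suc M ^ h x
  t = M ^ (B ∸ h x)
  P = ∏ xs (λ x → suc M ^ h x * M ^ (B ∸ h x))
  M^B : M ^ h x * t ≡ M ^ B
  M^B = trans (sym (^-distribˡ-+-* M (h x) (B ∸ h x))) (cong (M ^_) (m+[n∸m]≡n (h≤B x)))
  lemma₁ : ∀ s t P a b → s * t * P * (a * b) ≡ s * (a * t) * (P * b)
  lemma₁ = solve-∀
  lemma₂ : ∀ s a b c → s * a * (b * c) ≡ s * b * (a * c)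
  lemma₂ = solve-∀

∏-level-≥ : ∀ M B k (h : A → ℕ) (xs : List A) → .{{NonZero M}} → (∀ x → h x ≤ B) → k ≤ ∑ xs h →
  suc M ^ k * (M ^ B) ^ length xs ≤ M ^ k * ∏ xs (λ x → suc M ^ h x * M ^ (B ∸ h x))
∏-level-≥ M B k h xs h≤B k≤H with m≤n⇒∃[o]m+o≡n k≤H
... | j , k+j≡H = *-cancelʳ-≤ _ _ (M ^ j) {{m^n≢0 M j}} (begin
  suc M ^ k * N * M ^ j           ≤⟨ *-monoʳ-≤ (suc M ^ k * N) (^-monoˡ-≤ j (n≤1+n M)) ⟩
  suc M ^ k * N * suc M ^ j       ≡⟨ lemma₁ (suc M ^ k) N (suc M ^ j) ⟩
  suc M ^ k * suc M ^ j * N       ≡⟨ cong (_* N) (^-distribˡ-+-* (suc M) k j) ⟨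
  suc M ^ (k + j) * N             ≡⟨ cong (λ H → suc M ^ H * N) k+j≡H ⟩
  suc M ^ ∑ xs h * N              ≡⟨ ∏-level M B h xs h≤B ⟨
  P * M ^ ∑ xs h                  ≡⟨ cong (λ H → P * M ^ H) k+j≡H ⟨
  P * M ^ (k + j)                 ≡⟨ cong (P *_) (^-distribˡ-+-* M k j) ⟩
  P * (M ^ k * M ^ j)             ≡⟨ lemma₂ P (M ^ k) (M ^ j) ⟩
  M ^ k * P * M ^ j               ∎)
  where
  open ≤-Reasoning
  N = (M ^ B) ^ length xs
  P = ∏ xs (λ x → suc M ^ h x * M ^ (B ∸ h x))
  lemma₁ : ∀ a b c → a * b * c ≡ a * c * b
  lemma₁ = solve-∀
  lemma₂ : ∀ a b c → a * (b * c) ≡ b * a * c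
  lemma₂ = solve-∀

totalWeight : (State → ℕ) → Config n → ℕ
totalWeight w x = ∑ (nodes x) w

totalMean : (w h : State → ℕ) → Config n → ℕ
totalMean w h x = ∑ (nodes x) (λ u → ∑ (nodes x) (λ v → w v * h (update u v)))

module _ (x : Config n) (w h : State → ℕ) (B M k L : ℕ) .{{_ : NonZero M}}
         (h≤B : ∀ u → h u ≤ B) (B²≤M : B * B ≤ M) where

  private
    W S N Q MM : ℕ
    W = totalWeight w x
    S = totalMean w h x
    N = (M ^ B) ^ n
    MM = M * M
    Q = MM * W * suc M

    -- `φ` is (1 + 1/M)^h scaled by `M ^ B`. `P u`, divided by `MM * W`, is the chord bound for the
    -- moment generating function of the next state of a node now in state `u`.
    φ P : State → ℕ
    φ u = suc M ^ h u * M ^ (B ∸ h u)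
    P u = MM * W + (M + B) * ∑ (nodes x) (λ v → w v * h (update u v))

    ∏P ∏Φ : ℕ
    ∏P = ∏ (nodes x) P
    ∏Φ = ∏ (nodes x) (λ u → ∑ (nodes x) (λ v → w v * φ (update u v)))

    φ-chord : ∀ u → MM * φ u ≤ M ^ B * (MM + h u * (M + B))
    φ-chord u = begin
      MM * (suc M ^ h u * M ^ (B ∸ h u))                   ≡⟨ lemma₁ MM (suc M ^ h u) (M ^ (B ∸ h u)) ⟩
      suc M ^ h u * MM * M ^ (B ∸ h u)                     ≤⟨ *-monoˡ-≤ (M ^ (B ∸ h u)) (chord M B (h u) B²≤M (h≤B u)) ⟩
      M ^ h u * (MM + h u * (M + B)) * M ^ (B ∸ h u)       ≡⟨ lemma₂ (M ^ h u) (MM + h u * (M + B)) (M ^ (B ∸ h u)) ⟩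
      M ^ h u * M ^ (B ∸ h u) * (MM + h u * (M + B))       ≡⟨ cong (_* (MM + h u * (M + B))) (^-distribˡ-+-* M (h u) (B ∸ h u)) ⟨
      M ^ (h u + (B ∸ h u)) * (MM + h u * (M + B))         ≡⟨ cong (λ e → M ^ e * (MM + h u * (M + B))) (m+[n∸m]≡n (h≤B u)) ⟩
      M ^ B * (MM + h u * (M + B)) ∎
      where
      open ≤-Reasoning
      lemma₁ : ∀ a b c → a * (b * c) ≡ b * a * c
      lemma₁ = solve-∀
      lemma₂ : ∀ a b c → a * b * c ≡ a * c * b
      lemma₂ = solve-∀

    factor≤ : ∀ u → MM * ∑ (nodes x) (λ v → w v * φ (update u v)) ≤ M ^ B * P u
    factor≤ u = begin
      MM * ∑ (nodes x) (λ v → w v * φ (update u v))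
        ≡⟨ ∑-* MM _ (nodes x) ⟨
      ∑ (nodes x) (λ v → MM * (w v * φ (update u v)))
        ≤⟨ ∑-mono (nodes x) pointwise ⟩
      ∑ (nodes x) (λ v → M ^ B * (MM * w v + (M + B) * (w v * h (update u v))))
        ≡⟨ ∑-* (M ^ B) _ (nodes x) ⟩
      M ^ B * ∑ (nodes x) (λ v → MM * w v + (M + B) * (w v * h (update u v)))
        ≡⟨ cong (M ^ B *_) (trans (∑-+ _ _ (nodes x)) (cong₂ _+_ (∑-* MM w (nodes x)) (∑-* (M + B) _ (nodes x)))) ⟩
      M ^ B * P u ∎
      where
      open ≤-Reasoning
      lemma₁ : ∀ a b c → a * (b * c) ≡ b * (a * c)
      lemma₁ = solve-∀
      lemma₂ : ∀ w p m h c → w * (p * (m + h * c)) ≡ p * (m * w + c * (w * h))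
      lemma₂ = solve-∀
      pointwise : ∀ v → MM * (w v * φ (update u v)) ≤ M ^ B * (MM * w v + (M + B) * (w v * h (update u v)))
      pointwise v = begin
        MM * (w v * φ (update u v))                                 ≡⟨ lemma₁ MM (w v) (φ (update u v)) ⟩
        w v * (MM * φ (update u v))                                 ≤⟨ *-monoʳ-≤ (w v) (φ-chord (update u v)) ⟩
        w v * (M ^ B * (MM + h (update u v) * (M + B)))             ≡⟨ lemma₂ (w v) (M ^ B) MM (h (update u v)) (M + B) ⟩
        M ^ B * (MM * w v + (M + B) * (w v * h (update u v)))       ∎

    |x|≡n : length (nodes x) ≡ n
    |x|≡n = length-toList x

    ∏Φ≤ : MM ^ n * ∏Φ ≤ N * ∏P
    ∏Φ≤ = subst (λ m → MM ^ m * ∏Φ ≤ (M ^ B) ^ m * ∏P) |x|≡n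
      (subst₂ _≤_ (∏-* MM _ (nodes x)) (∏-* (M ^ B) P (nodes x)) (∏-mono (nodes x) factor≤))

    instance
      _ = m*n≢0 M M
      _ = m^n≢0 M B
      _ = m^n≢0 (M ^ B) n
      _ = m^n≢0 MM n
      _ = m^n≢0 (suc M) k
      _ = m^n≢0 (suc M) n

  module _ {E : Pred (Choices n) 0ℓ} (E? : Decidable E)
           (E⇒k≤h : ∀ f → E f → k ≤ ∑ (nodes (step x f)) h) where

    private
      -- Exponential Markov inequality: on `E` the product of `φ` over the new states is at least
      -- `N` times (1 + 1/M)^k.
      markov : suc M ^ k * N * mass w x E? ≤ M ^ k * ∏Φ
      markov = begin
        suc M ^ k * N * mass w x E?
          ≡⟨ ∑-* (suc M ^ k * N) _ (choices n) ⟨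
        ∑ (choices n) (λ f → suc M ^ k * N * (weight w x f * 𝟙 (E? f)))
          ≤⟨ ∑-mono (choices n) pointwise ⟩
        ∑ (choices n) (λ f → M ^ k * (weight w x f * ∏ (nodes (step x f)) φ))
          ≡⟨ ∑-* (M ^ k) _ (choices n) ⟩
        M ^ k * ∑ (choices n) (λ f → weight w x f * ∏ (nodes (step x f)) φ)
          ≡⟨ cong (M ^ k *_) (∑-step-∏ w φ x) ⟩
        M ^ k * ∏Φ ∎
        where
        open ≤-Reasoning
        lemma₁ : ∀ a b → a * (b * 1) ≡ b * a
        lemma₁ = solve-∀
        lemma₂ : ∀ a b c → a * (b * c) ≡ b * (a * c)
        lemma₂ = solve-∀
        lemma₃ : ∀ a b → a * (b * 0) ≡ 0
        lemma₃ = solve-∀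
        pointwise : ∀ f → suc M ^ k * N * (weight w x f * 𝟙 (E? f)) ≤
                          M ^ k * (weight w x f * ∏ (nodes (step x f)) φ)
        pointwise f with E? f
        ... | no  _ = ≤-trans (≤-reflexive (lemma₃ (suc M ^ k * N) (weight w x f))) z≤n
        ... | yes e = begin
          suc M ^ k * N * (weight w x f * 1)                  ≡⟨ lemma₁ (suc M ^ k * N) (weight w x f) ⟩
          weight w x f * (suc M ^ k * N)                      ≡⟨ cong (λ m → weight w x f * (suc M ^ k * (M ^ B) ^ m)) (length-toList (step x f)) ⟨
          weight w x f * (suc M ^ k * (M ^ B) ^ length (nodes (step x f)))
            ≤⟨ *-monoʳ-≤ (weight w x f) (∏-level-≥ M B k h (nodes (step x f)) h≤B (E⇒k≤h f e)) ⟩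
          weight w x f * (M ^ k * ∏ (nodes (step x f)) φ)     ≡⟨ lemma₂ (weight w x f) (M ^ k) (∏ (nodes (step x f)) φ) ⟩
          M ^ k * (weight w x f * ∏ (nodes (step x f)) φ)     ∎

      markov′ : mass w x E? * suc M ^ k * MM ^ n ≤ M ^ k * ∏P
      markov′ = *-cancelˡ-≤ N (begin
        N * (mass w x E? * suc M ^ k * MM ^ n)  ≡⟨ lemma₁ N (mass w x E?) (suc M ^ k) (MM ^ n) ⟩
        MM ^ n * (suc M ^ k * N * mass w x E?)  ≤⟨ *-monoʳ-≤ (MM ^ n) markov ⟩
        MM ^ n * (M ^ k * ∏Φ)                   ≡⟨ lemma₂ (MM ^ n) (M ^ k) ∏Φ ⟩
        M ^ k * (MM ^ n * ∏Φ)                   ≤⟨ *-monoʳ-≤ (M ^ k) ∏Φ≤ ⟩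
        M ^ k * (N * ∏P)                        ≡⟨ lemma₂ (M ^ k) N ∏P ⟩
        N * (M ^ k * ∏P)                        ∎)
        where
        open ≤-Reasoning
        lemma₁ : ∀ N m s d → N * (m * s * d) ≡ d * (s * N * m)
        lemma₁ = solve-∀
        lemma₂ : ∀ a b c → a * (b * c) ≡ b * (a * c)
        lemma₂ = solve-∀

      module _ .{{_ : NonZero W}}
               (gap : suc M * ((M + B) * S + L * MM * W) ≤ k * MM * W) where

        instance
          _ = m*n≢0 MM W
          _ = m*n≢0 (MM * W) (suc M)
          _ = m^n≢0 (MM * W) k
          _ = m^n≢0 Q L

        -- The arithmetic-geometric mean inequality is applied to these n factors, to k copies of
        -- M/(M + 1) and to L copies of 2, all scaled by Q; by gap, their mean is at most 1.
        factors : List ℕ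
        factors = map (λ u → suc M * P u) (nodes x)

        factors-sum : sum factors ≡ suc M * (n * (MM * W) + (M + B) * S)
        factors-sum = begin
          sum factors
            ≡⟨ ∑-* (suc M) P (nodes x) ⟩
          suc M * ∑ (nodes x) P
            ≡⟨ cong (suc M *_) (trans (∑-+ _ _ (nodes x)) (cong₂ _+_ (∑-const (MM * W) (nodes x)) (∑-* (M + B) _ (nodes x)))) ⟩
          suc M * (length (nodes x) * (MM * W) + (M + B) * S)
            ≡⟨ cong (λ m → suc M * (m * (MM * W) + (M + B) * S)) |x|≡n ⟩
          suc M * (n * (MM * W) + (M + B) * S) ∎
          where open ≡-Reasoning

        |factors|≡n : length factors ≡ n
        |factors|≡n = trans (length-map _ (nodes x)) |x|≡n

        mean≤Q : sum factors + k * (M * (MM * W)) + L * (2 * Q) ≤ (length factors + k + L) * Q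
        mean≤Q = subst₂ (λ s m → s + k * (M * (MM * W)) + L * (2 * Q) ≤ (m + k + L) * Q)
          (sym factors-sum) (sym |factors|≡n)
          (≤-cert gap (lemma n k L M B MM W S))
          where
          lemma : ∀ n k L M B MM W S →
            (n + k + L) * (MM * W * (1 + M)) + (1 + M) * ((M + B) * S + L * MM * W) ≡
            (1 + M) * (n * (MM * W) + (M + B) * S) + k * (M * (MM * W)) + L * (2 * (MM * W * (1 + M)))
            + k * MM * W
          lemma = solve-∀

        means : suc M ^ n * ∏P * (M * (MM * W)) ^ k * (2 * Q) ^ L ≤ Q ^ n * Q ^ k * Q ^ L
        means = subst₂ (λ p m → p * (M * (MM * W)) ^ k * (2 * Q) ^ L ≤ Q ^ m * Q ^ k * Q ^ L)
          (trans (∏-* (suc M) P (nodes x)) (cong (λ m → suc M ^ m * ∏P) |x|≡n)) |factors|≡n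
          (am-gm-weighted factors k (M * (MM * W)) L (2 * Q) Q mean≤Q)

        ∏P≤ : M ^ k * ∏P * 2 ^ L ≤ suc M ^ k * MM ^ n * W ^ n
        ∏P≤ = *-cancelʳ-≤ _ _ (Q ^ L) (*-cancelʳ-≤ _ _ ((MM * W) ^ k) (*-cancelʳ-≤ _ _ (suc M ^ n) (begin
          M ^ k * ∏P * 2 ^ L * Q ^ L * (MM * W) ^ k * suc M ^ n
            ≡⟨ lemma₁ (M ^ k) ∏P (2 ^ L) (Q ^ L) ((MM * W) ^ k) (suc M ^ n) ⟩
          suc M ^ n * ∏P * (M ^ k * (MM * W) ^ k) * (2 ^ L * Q ^ L)
            ≡⟨ cong₂ (λ a b → suc M ^ n * ∏P * a * b) ([m*n]^o≡m^o*n^o M (MM * W) k) ([m*n]^o≡m^o*n^o 2 Q L) ⟨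
          suc M ^ n * ∏P * (M * (MM * W)) ^ k * (2 * Q) ^ L
            ≤⟨ means ⟩
          Q ^ n * Q ^ k * Q ^ L
            ≡⟨ cong₂ (λ a b → a * b * Q ^ L)
                 (trans ([m*n]^o≡m^o*n^o (MM * W) (suc M) n) (cong (_* suc M ^ n) ([m*n]^o≡m^o*n^o MM W n)))
                 ([m*n]^o≡m^o*n^o (MM * W) (suc M) k) ⟩
          MM ^ n * W ^ n * suc M ^ n * ((MM * W) ^ k * suc M ^ k) * Q ^ L
            ≡⟨ lemma₂ (MM ^ n) (W ^ n) (suc M ^ n) ((MM * W) ^ k) (suc M ^ k) (Q ^ L) ⟩
          suc M ^ k * MM ^ n * W ^ n * Q ^ L * (MM * W) ^ k * suc M ^ n ∎)))
          where
          open ≤-Reasoning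
          lemma₁ : ∀ a b c d e f → a * b * c * d * e * f ≡ f * b * (a * e) * (c * d)
          lemma₁ = solve-∀
          lemma₂ : ∀ a b c d e f → a * b * c * (d * e) * f ≡ e * a * b * f * d * c
          lemma₂ = solve-∀

    -- `S` over `W` is the mean of the statistic under the weighted choices. Divided by M² W, the
    -- second hypothesis asks that `k` exceed (1 + 1/M)(1 + B/M) times this mean by (M + 1) L. A
    -- small `M` is paid for by a relative error of the mean, a large `M` by the term in `L`.
    chernoff : .{{NonZero W}} → suc M * ((M + B) * S + L * MM * W) ≤ k * MM * W →
               mass w x E? * 2 ^ L ≤ W ^ n
    chernoff gap = *-cancelˡ-≤ (suc M ^ k * MM ^ n) {{m*n≢0 (suc M ^ k) (MM ^ n)}} (begin
      suc M ^ k * MM ^ n * (mass w x E? * 2 ^ L)   ≡⟨ lemma (suc M ^ k) (MM ^ n) (mass w x E?) (2 ^ L) ⟩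
      mass w x E? * suc M ^ k * MM ^ n * 2 ^ L     ≤⟨ *-monoˡ-≤ (2 ^ L) markov′ ⟩
      M ^ k * ∏P * 2 ^ L                           ≤⟨ ∏P≤ gap ⟩
      suc M ^ k * MM ^ n * W ^ n                   ∎)
      where
      open ≤-Reasoning
      lemma : ∀ a b c d → a * b * (c * d) ≡ c * a * b * d
      lemma = solve-∀

-- Linear statistics of the counts and their means after one round

weigh : Color → ℕ → ℕ → ℕ → State → ℕ
weigh Alpha α β υ (colored Alpha) = α
weigh Alpha α β υ (colored Beta)  = β
weigh Beta  α β υ (colored Alpha) = β
weigh Beta  α β υ (colored Beta)  = α
weigh _     α β υ undecided       = υ

weigh-≤ : ∀ c {α β υ B} → α ≤ B → β ≤ B → υ ≤ B → ∀ u → weigh c α β υ u ≤ B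
weigh-≤ Alpha α≤B β≤B υ≤B (colored Alpha) = α≤B
weigh-≤ Alpha α≤B β≤B υ≤B (colored Beta)  = β≤B
weigh-≤ Alpha α≤B β≤B υ≤B undecided       = υ≤B
weigh-≤ Beta  α≤B β≤B υ≤B (colored Alpha) = β≤B
weigh-≤ Beta  α≤B β≤B υ≤B (colored Beta)  = α≤B
weigh-≤ Beta  α≤B β≤B υ≤B undecided       = υ≤B

∑-weigh : ∀ c α β υ (x : Config n) →
  ∑ (nodes x) (weigh c α β υ) ≡ α * support c x + β * support (other c) x + υ * q x
∑-weigh {n} c α β υ = go c
  where
  first : ∀ a b u → α + (α * a + β * b + υ * u) ≡ α * suc a + β * b + υ * u
  first = lemma α β υ
    where
    lemma : ∀ α β υ a b u → α + (α * a + β * b + υ * u) ≡ α * (1 + a) + β * b + υ * u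
    lemma = solve-∀
  second : ∀ a b u → β + (α * a + β * b + υ * u) ≡ α * a + β * suc b + υ * u
  second = lemma α β υ
    where
    lemma : ∀ α β υ a b u → β + (α * a + β * b + υ * u) ≡ α * a + β * (1 + b) + υ * u
    lemma = solve-∀
  third : ∀ a b u → υ + (α * a + β * b + υ * u) ≡ α * a + β * b + υ * suc u
  third = lemma α β υ
    where
    lemma : ∀ α β υ a b u → υ + (α * a + β * b + υ * u) ≡ α * a + β * b + υ * (1 + u)
    lemma = solve-∀
  none : 0 ≡ α * 0 + β * 0 + υ * 0
  none = lemma α β υ
    where
    lemma : ∀ α β υ → 0 ≡ α * 0 + β * 0 + υ * 0
    lemma = solve-∀
  go : ∀ c {k} (x : Config k) →
    ∑ (nodes x) (weigh c α β υ) ≡ α * support c x + β * support (other c) x + υ * q x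
  go c     []                  = none
  go Alpha (colored Alpha ∷ x) = trans (cong (α +_) (go Alpha x)) (first (support Alpha x) (support Beta x) (q x))
  go Alpha (colored Beta ∷ x)  = trans (cong (β +_) (go Alpha x)) (second (support Alpha x) (support Beta x) (q x))
  go Alpha (undecided ∷ x)     = trans (cong (υ +_) (go Alpha x)) (third (support Alpha x) (support Beta x) (q x))
  go Beta  (colored Beta ∷ x)  = trans (cong (α +_) (go Beta x)) (first (support Beta x) (support Alpha x) (q x))
  go Beta  (colored Alpha ∷ x) = trans (cong (β +_) (go Beta x)) (second (support Beta x) (support Alpha x) (q x))
  go Beta  (undecided ∷ x)     = trans (cong (υ +_) (go Beta x)) (third (support Beta x) (support Alpha x) (q x))

weigh-const : ∀ c m u → weigh c m m m u ≡ m
weigh-const Alpha m (colored Alpha) = refl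
weigh-const Alpha m (colored Beta)  = refl
weigh-const Alpha m undecided       = refl
weigh-const Beta  m (colored Alpha) = refl
weigh-const Beta  m (colored Beta)  = refl
weigh-const Beta  m undecided       = refl

support-total : ∀ c (x : Config n) → support c x + support (other c) x + q x ≡ n
support-total {n} c x = begin
  a + b + u                       ≡⟨ lemma a b u ⟩
  1 * a + 1 * b + 1 * u           ≡⟨ ∑-weigh c 1 1 1 x ⟨
  ∑ (nodes x) (weigh c 1 1 1)     ≡⟨ ∑-cong (nodes x) (weigh-const c 1) ⟩
  ∑ (nodes x) (λ _ → 1)           ≡⟨ ∑-const 1 (nodes x) ⟩
  length (nodes x) * 1            ≡⟨ trans (*-identityʳ _) (length-toList x) ⟩
  n                               ∎
  where
  open ≡-Reasoning
  a = support c x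
  b = support (other c) x
  u = q x
  lemma : ∀ a b u → a + b + u ≡ 1 * a + 1 * b + 1 * u
  lemma = solve-∀

-- Here the update rule becomes arithmetic: for a fixed looking node the dependence on `v` is again
-- a `weigh`, so two uses of `∑-weigh` evaluate the double sum in `totalMean`.
weigh-update : ∀ c w₁ w₂ w₃ α β υ u v →
  weigh c w₁ w₂ w₃ v * weigh c α β υ (update u v) ≡
  weigh c (weigh c (w₁ * α) (w₁ * υ) (w₁ * α) u)
          (weigh c (w₂ * υ) (w₂ * β) (w₂ * β) u)
          (weigh c (w₃ * α) (w₃ * β) (w₃ * υ) u) v
weigh-update Alpha w₁ w₂ w₃ α β υ (colored Alpha) (colored Alpha) = refl
weigh-update Alpha w₁ w₂ w₃ α β υ (colored Alpha) (colored Beta)  = refl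
weigh-update Alpha w₁ w₂ w₃ α β υ (colored Alpha) undecided       = refl
weigh-update Alpha w₁ w₂ w₃ α β υ (colored Beta)  (colored Alpha) = refl
weigh-update Alpha w₁ w₂ w₃ α β υ (colored Beta)  (colored Beta)  = refl
weigh-update Alpha w₁ w₂ w₃ α β υ (colored Beta)  undecided       = refl
weigh-update Alpha w₁ w₂ w₃ α β υ undecided       (colored Alpha) = refl
weigh-update Alpha w₁ w₂ w₃ α β υ undecided       (colored Beta)  = refl
weigh-update Alpha w₁ w₂ w₃ α β υ undecided       undecided       = refl
weigh-update Beta  w₁ w₂ w₃ α β υ (colored Alpha) (colored Alpha) = refl
weigh-update Beta  w₁ w₂ w₃ α β υ (colored Alpha) (colored Beta)  = refl
weigh-update Beta  w₁ w₂ w₃ α β υ (colored Alpha) undecided       = refl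
weigh-update Beta  w₁ w₂ w₃ α β υ (colored Beta)  (colored Alpha) = refl
weigh-update Beta  w₁ w₂ w₃ α β υ (colored Beta)  (colored Beta)  = refl
weigh-update Beta  w₁ w₂ w₃ α β υ (colored Beta)  undecided       = refl
weigh-update Beta  w₁ w₂ w₃ α β υ undecided       (colored Alpha) = refl
weigh-update Beta  w₁ w₂ w₃ α β υ undecided       (colored Beta)  = refl
weigh-update Beta  w₁ w₂ w₃ α β υ undecided       undecided       = refl

-- The lines are indexed by the state of the node looked at, the terms within a line by the state of
-- the looking node, always in the order: color `c`, other color, undecided. With weights 1 this is
-- n times the expectation of α a + β b + υ u after one round.
mean : (w₁ w₂ w₃ α β υ a b u : ℕ) → ℕ
mean w₁ w₂ w₃ α β υ a b u =
  (w₁ * α * a + w₁ * υ * b + w₁ * α * u) * a +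
  (w₂ * υ * a + w₂ * β * b + w₂ * β * u) * b +
  (w₃ * α * a + w₃ * β * b + w₃ * υ * u) * u

totalMean-weigh : ∀ c w₁ w₂ w₃ α β υ (x : Config n) →
  totalMean (weigh c w₁ w₂ w₃) (weigh c α β υ) x ≡
  mean w₁ w₂ w₃ α β υ (support c x) (support (other c) x) (q x)
totalMean-weigh c w₁ w₂ w₃ α β υ x = begin
  totalMean (weigh c w₁ w₂ w₃) (weigh c α β υ) x
    ≡⟨ ∑-cong (nodes x) (λ u → trans (∑-cong (nodes x) (weigh-update c w₁ w₂ w₃ α β υ u)) (∑-weigh c _ _ _ x)) ⟩
  ∑ (nodes x) (λ u → f₁ u * a + f₂ u * b + f₃ u * r)
    ≡⟨ trans (∑-+ _ _ (nodes x)) (cong (_+ ∑ (nodes x) (λ u → f₃ u * r)) (∑-+ _ _ (nodes x))) ⟩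
  ∑ (nodes x) (λ u → f₁ u * a) + ∑ (nodes x) (λ u → f₂ u * b) + ∑ (nodes x) (λ u → f₃ u * r)
    ≡⟨ cong₂ _+_ (cong₂ _+_ (column a _ _ _) (column b _ _ _)) (column r _ _ _) ⟩
  mean w₁ w₂ w₃ α β υ a b r ∎
  where
  open ≡-Reasoning
  a = support c x
  b = support (other c) x
  r = q x
  f₁ f₂ f₃ : State → ℕ
  f₁ = weigh c (w₁ * α) (w₁ * υ) (w₁ * α)
  f₂ = weigh c (w₂ * υ) (w₂ * β) (w₂ * β)
  f₃ = weigh c (w₃ * α) (w₃ * β) (w₃ * υ)
  column : ∀ m p₁ p₂ p₃ → ∑ (nodes x) (λ u → weigh c p₁ p₂ p₃ u * m) ≡ (p₁ * a + p₂ * b + p₃ * r) * m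
  column m p₁ p₂ p₃ = trans (∑-*ʳ m _ (nodes x)) (cong (_* m) (∑-weigh c p₁ p₂ p₃ x))

# : {E : Pred (Choices n) 0ℓ} → Decidable E → ℕ
# E? = ∑ (choices _) (λ f → 𝟙 (E? f))

chernoff-weigh : ∀ c w₁ w₂ w₃ α β υ (x : Config n) B M k L →
  let a = support c x; b = support (other c) x; W = w₁ * a + w₂ * b + w₃ * q x in
  .{{NonZero M}} → .{{NonZero W}} → α ≤ B → β ≤ B → υ ≤ B → B * B ≤ M →
  {E : Pred (Choices n) 0ℓ} (E? : Decidable E) →
  (∀ f → E f → k ≤ α * support c (step x f) + β * support (other c) (step x f) + υ * q (step x f)) →
  suc M * ((M + B) * mean w₁ w₂ w₃ α β υ a b (q x) + L * (M * M) * W) ≤ k * (M * M) * W →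
  mass (weigh c w₁ w₂ w₃) x E? * 2 ^ L ≤ W ^ n
chernoff-weigh {n} c w₁ w₂ w₃ α β υ x B M k L α≤B β≤B υ≤B B²≤M E? E⇒ gap =
  subst (λ W → mass w x E? * 2 ^ L ≤ W ^ n) W≡
    (chernoff x w (weigh c α β υ) B M k L (weigh-≤ c α≤B β≤B υ≤B) B²≤M E?
      (λ f e → subst (k ≤_) (sym (∑-weigh c α β υ (step x f))) (E⇒ f e))
      {{subst NonZero (sym W≡) it}}
      (subst₂ (λ S W → suc M * ((M + B) * S + L * (M * M) * W) ≤ k * (M * M) * W)
        (sym (totalMean-weigh c w₁ w₂ w₃ α β υ x)) (sym W≡) gap))
  where
  w = weigh c w₁ w₂ w₃
  W≡ : totalWeight w x ≡ w₁ * support c x + w₂ * support (other c) x + w₃ * q x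
  W≡ = ∑-weigh c w₁ w₂ w₃ x

weight-1 : ∀ c (x : Config n) f → weight (weigh c 1 1 1) x f ≡ 1
weight-1 c x f = trans (∏-cong (toList f) (λ i → weigh-const c 1 (Vec.lookup x i)))
                       (trans (∏-const 1 (toList f)) (^-zeroˡ (length (toList f))))

chernoff-uniform : ∀ c α β υ (x : Config n) B M k L →
  let a = support c x; b = support (other c) x in
  .{{NonZero M}} → .{{NonZero n}} → α ≤ B → β ≤ B → υ ≤ B → B * B ≤ M →
  {E : Pred (Choices n) 0ℓ} (E? : Decidable E) →
  (∀ f → E f → k ≤ α * support c (step x f) + β * support (other c) (step x f) + υ * q (step x f)) →
  suc M * ((M + B) * mean 1 1 1 α β υ a b (q x) + L * (M * M) * n) ≤ k * (M * M) * n →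
  # E? * 2 ^ L ≤ n ^ n
chernoff-uniform {n} c α β υ x B M k L α≤B β≤B υ≤B B²≤M E? E⇒ gap =
  subst₂ (λ m W → m * 2 ^ L ≤ W ^ n) mass≡# W≡n
    (chernoff-weigh c 1 1 1 α β υ x B M k L {{it}} {{subst NonZero (sym W≡n) it}} α≤B β≤B υ≤B B²≤M E? E⇒
      (subst (λ W → suc M * ((M + B) * S + L * (M * M) * W) ≤ k * (M * M) * W) (sym W≡n) gap))
  where
  a = support c x
  b = support (other c) x
  S = mean 1 1 1 α β υ a b (q x)
  lemma : ∀ a b u → 1 * a + 1 * b + 1 * u ≡ a + b + u
  lemma = solve-∀
  W≡n : 1 * a + 1 * b + 1 * q x ≡ n
  W≡n = trans (lemma a b (q x)) (support-total c x)
  mass≡# : mass (weigh c 1 1 1) x E? ≡ # E?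
  mass≡# = ∑-cong (choices n) (λ f → trans (cong (_* 𝟙 (E? f)) (weight-1 c x f)) (*-identityˡ _))

-- Outcomes of several rounds

𝟙-mono : {P Q : Set} (P? : Dec P) (Q? : Dec Q) → (P → Q) → 𝟙 P? ≤ 𝟙 Q?
𝟙-mono (no _)  _       P⇒Q = z≤n
𝟙-mono (yes _) (yes _) P⇒Q = ≤-refl
𝟙-mono (yes p) (no ¬q) P⇒Q = contradiction (P⇒Q p) ¬q

𝟙-no : {P : Set} (P? : Dec P) → ¬ P → 𝟙 P? ≡ 0
𝟙-no (no _)  ¬p = refl
𝟙-no (yes p) ¬p = contradiction p ¬p

𝟙-¬ : {P : Set} (P? : Dec P) → 𝟙 P? + 𝟙 (¬? P?) ≡ 1
𝟙-¬ (yes _) = refl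
𝟙-¬ (no _)  = refl

hits misses : {P : Pred (Config n) 0ℓ} → Decidable P → (T : ℕ) → Config n → ℕ
hits   P? T x = ∑ (outcomes _ T) (λ ω → 𝟙 (reachesWithin? P? x T ω))
misses P? T x = ∑ (outcomes _ T) (λ ω → 𝟙 (¬? (reachesWithin? P? x T ω)))

#Ω : ℕ → ℕ → ℕ
#Ω n T = (n ^ n) ^ T

∑-choices : ∀ n m → ∑ (choices n) (λ _ → m) ≡ n ^ n * m
∑-choices n m = trans (∑-const m (choices n)) (cong (_* m) (length-choices n))

module _ {P : Pred (Config n) 0ℓ} (P? : Decidable P) where

  hits+misses : ∀ T x → hits P? T x + misses P? T x ≡ #Ω n T
  hits+misses T x = begin
    hits P? T x + misses P? T x                                   ≡⟨ ∑-+ _ _ (outcomes n T) ⟨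
    ∑ (outcomes n T) (λ ω → 𝟙 (R? ω) + 𝟙 (¬? (R? ω)))             ≡⟨ ∑-cong (outcomes n T) (λ ω → 𝟙-¬ (R? ω)) ⟩
    ∑ (outcomes n T) (λ _ → 1)                                    ≡⟨ ∑-const 1 (outcomes n T) ⟩
    length (outcomes n T) * 1                                     ≡⟨ trans (*-identityʳ _) (length-outcomes n T) ⟩
    #Ω n T                                                        ∎
    where
    open ≡-Reasoning
    R? = reachesWithin? P? x T

  misses≤#Ω : ∀ T x → misses P? T x ≤ #Ω n T
  misses≤#Ω T x = ≤-trans (m≤n+m _ (hits P? T x)) (≤-reflexive (hits+misses T x))

  hits≤#Ω : ∀ T x → hits P? T x ≤ #Ω n T
  hits≤#Ω T x = ≤-trans (m≤m+n _ (misses P? T x)) (≤-reflexive (hits+misses T x))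

  misses-0-≤1 : ∀ x → misses P? 0 x ≤ 1
  misses-0-≤1 x = misses≤#Ω 0 x

  misses-0 : ∀ x → P x → misses P? 0 x ≡ 0
  misses-0 x p = trans (+-identityʳ _) (𝟙-no (¬? (reachesWithin? P? x 0 [])) (λ ¬r → ¬r (here p)))

  hits-0 : ∀ x → ¬ P x → hits P? 0 x ≡ 0
  hits-0 x ¬p = trans (+-identityʳ _) (𝟙-no (reachesWithin? P? x 0 []) λ { (here p) → ¬p p })

  misses-suc : ∀ T x → misses P? (suc T) x ≤ ∑ (choices n) (λ f → misses P? T (step x f))
  misses-suc T x = ≤-trans
    (≤-reflexive (∑-vectors {k = T} (choices n) (λ ω → 𝟙 (¬? (reachesWithin? P? x (suc T) ω)))))
    (∑-mono (choices n) λ f → ∑-mono (outcomes n T) λ ω →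
      𝟙-mono (¬? (reachesWithin? P? x (suc T) (f ∷ ω))) (¬? (reachesWithin? P? (step x f) T ω))
        (λ ¬r r → ¬r (there r)))

  hits-suc : ∀ T x → ¬ P x → hits P? (suc T) x ≤ ∑ (choices n) (λ f → hits P? T (step x f))
  hits-suc T x ¬p = ≤-trans
    (≤-reflexive (∑-vectors {k = T} (choices n) (λ ω → 𝟙 (reachesWithin? P? x (suc T) ω))))
    (∑-mono (choices n) λ f → ∑-mono (outcomes n T) λ ω →
      𝟙-mono (reachesWithin? P? x (suc T) (f ∷ ω)) (reachesWithin? P? (step x f) T ω)
        λ { (here p) → contradiction p ¬p ; (there r) → r })

  misses-union : ∀ T x D β γ {E : Pred (Choices n) 0ℓ} (E? : Decidable E) →
    # E? * D ≤ β * n ^ n →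
    (∀ f → ¬ E f → misses P? T (step x f) * D ≤ γ * #Ω n T) →
    misses P? (suc T) x * D ≤ (β + γ) * #Ω n (suc T)
  misses-union T x D β γ E? #E≤ rest = begin
    misses P? (suc T) x * D
      ≤⟨ *-monoˡ-≤ D (misses-suc T x) ⟩
    ∑ (choices n) (λ f → misses P? T (step x f)) * D
      ≡⟨ ∑-*ʳ D _ (choices n) ⟨
    ∑ (choices n) (λ f → misses P? T (step x f) * D)
      ≤⟨ ∑-mono (choices n) pointwise ⟩
    ∑ (choices n) (λ f → 𝟙 (E? f) * (D * Ω) + γ * Ω)
      ≡⟨ trans (∑-+ _ _ (choices n)) (cong₂ _+_ (∑-*ʳ (D * Ω) _ (choices n)) (∑-choices n (γ * Ω))) ⟩
    # E? * (D * Ω) + n ^ n * (γ * Ω)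
      ≤⟨ ≤-cert (*-monoˡ-≤ Ω #E≤) (lemma (# E?) D Ω (n ^ n) β γ) ⟩
    (β + γ) * #Ω n (suc T) ∎
    where
    open ≤-Reasoning
    Ω = #Ω n T
    lemma : ∀ e D Ω N β γ → (β + γ) * (N * Ω) + e * D * Ω ≡ e * (D * Ω) + N * (γ * Ω) + β * N * Ω
    lemma = solve-∀
    pointwise : ∀ f → misses P? T (step x f) * D ≤ 𝟙 (E? f) * (D * Ω) + γ * Ω
    pointwise f with E? f
    ... | no ¬e = rest f ¬e
    ... | yes _ = ≤-trans (*-monoˡ-≤ D (misses≤#Ω T (step x f)))
                          (≤-trans (≤-reflexive (lemma′ Ω D)) (m≤m+n _ (γ * Ω)))
      where
      lemma′ : ∀ Ω D → Ω * D ≡ 1 * (D * Ω)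
      lemma′ = solve-∀

#-⊎ : {E F : Pred (Choices n) 0ℓ} (E? : Decidable E) (F? : Decidable F) →
      # (λ f → E? f ⊎-dec F? f) ≤ # E? + # F?
#-⊎ {n} E? F? = ≤-trans (∑-mono (choices n) pointwise) (≤-reflexive (∑-+ _ _ (choices n)))
  where
  pointwise : ∀ f → 𝟙 (E? f ⊎-dec F? f) ≤ 𝟙 (E? f) + 𝟙 (F? f)
  pointwise f with E? f | F? f
  ... | yes _ | _     = s≤s z≤n
  ... | no _  | yes _ = s≤s z≤n
  ... | no _  | no _  = z≤n

-- The case M = 2000 and B = 20 of the Chernoff bound, where (1 + 1/M) (1 + B/M) ≤ 51/50.
chernoff-macroscopic : ∀ c α β υ (x : Config n) k L →
  let a = support c x; b = support (other c) x in
  .{{NonZero n}} → α ≤ 20 → β ≤ 20 → υ ≤ 20 →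
  {E : Pred (Choices n) 0ℓ} (E? : Decidable E) →
  (∀ f → E f → k ≤ α * support c (step x f) + β * support (other c) (step x f) + υ * q (step x f)) →
  51 * mean 1 1 1 α β υ a b (q x) + 50 * (L * 2001) * n ≤ 50 * k * n →
  # E? * 2 ^ L ≤ n ^ n
chernoff-macroscopic {n} c α β υ x k L α≤ β≤ υ≤ E? E⇒ gap =
  chernoff-uniform c α β υ x 20 2000 k L α≤ β≤ υ≤ (m≤m+n 400 1600) E? E⇒
    (≤-trans (≤-reflexive (distribute 2001 2020 S L 4000000 n))
      (*-cancelˡ-≤ 50 (≤-cert
        (+-mono-≤ (*-monoʳ-≤ 4000000 gap) (*-monoˡ-≤ S (m≤m+n (50 * (2001 * 2020)) 1899000)))
        (lemma S (L * 2001) n k 4000000 (2001 * 2020)))))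
  where
  S = mean 1 1 1 α β υ (support c x) (support (other c) x) (q x)
  distribute : ∀ a b S L m n → a * (b * S + L * m * n) ≡ a * b * S + m * (L * a) * n
  distribute = solve-∀
  lemma : ∀ S D n k m v →
    50 * (k * m * n) + (m * (51 * S + 50 * D * n) + 50 * v * S) ≡
    50 * (v * S + m * D * n) + (m * (50 * k * n) + m * 51 * S)
  lemma = solve-∀

-- The dominant region

∑-step-weigh : ∀ c α β υ (x : Config n) →
  n * ∑ (choices n) (λ f → α * support c (step x f) + β * support (other c) (step x f) + υ * q (step x f)) ≡
  n ^ n * mean 1 1 1 α β υ (support c x) (support (other c) x) (q x)
∑-step-weigh {n} c α β υ x = begin
  n * ∑ (choices n) (λ f → α * support c (step x f) + β * support (other c) (step x f) + υ * q (step x f))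
    ≡⟨ cong (n *_) (∑-cong (choices n) (λ f → ∑-weigh c α β υ (step x f))) ⟨
  n * ∑ (choices n) (λ f → ∑ (nodes (step x f)) h)
    ≡⟨ ∑-step-∑ h x ⟩
  n ^ n * ∑ (nodes x) (λ u → ∑ (nodes x) (λ v → h (update u v)))
    ≡⟨ cong (n ^ n *_) (∑-cong (nodes x) λ u → ∑-cong (nodes x) λ v →
         trans (cong (_* h (update u v)) (weigh-const c 1 v)) (*-identityˡ _)) ⟨
  n ^ n * totalMean (weigh c 1 1 1) h x
    ≡⟨ cong (n ^ n *_) (totalMean-weigh c 1 1 1 α β υ x) ⟩
  n ^ n * mean 1 1 1 α β υ (support c x) (support (other c) x) (q x) ∎
  where
  open ≡-Reasoning
  h : State → ℕ
  h = weigh c α β υ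

-- When `c` holds nearly all nodes, one round takes the expected pair (b, u) to about (0, 2b), since
-- u² + 2ab is about 2bn. Then 20b + 9u becomes about 18b. Any ratio of the coefficients above 2
-- contracts to first order; 20 to 9 leaves room for the quadratic terms.
deficit : Color → Config n → ℕ
deficit c x = 20 * support (other c) x + 9 * q x

-- Integrality is what lets Markov's inequality finish: a positive deficit is at least 1, so its
-- expectation bounds the probability of not being monochromatic.
monochromatic-or-deficit : ∀ c (x : Config n) → Monochromatic c x ⊎ 1 ≤ deficit c x
monochromatic-or-deficit {n} c x = go (support (other c) x) (q x) (support-total c x)
  where
  go : ∀ b u → support c x + b + u ≡ n → support c x ≡ n ⊎ 1 ≤ 20 * b + 9 * u
  go zero    zero    eq = inj₁ (trans (sym (trans (+-identityʳ _) (+-identityʳ _))) eq)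
  go (suc b) u       eq = inj₂ (s≤s z≤n)
  go zero    (suc u) eq = inj₂ (s≤s z≤n)

module Absorption (c : Color) (n : ℕ) .{{_ : NonZero n}} where

  Dominant : Pred (Config n) 0ℓ
  Dominant x = deficit c x ≤ 3 * n

  dominant? : Decidable Dominant
  dominant? x = deficit c x ≤? 3 * n

  meanDeficit : Config n → ℕ
  meanDeficit x = mean 1 1 1 0 20 9 (support c x) (support (other c) x) (q x)

  meanDeficit≤ : ∀ x → Dominant x → 15 * meanDeficit x ≤ 14 * (n * deficit c x)
  meanDeficit≤ x dom = subst (λ m → 15 * meanDeficit x ≤ 14 * (m * deficit c x)) (support-total c x)
    (≤-cert-slack (57 * (u * u) + 5 * (b * u) + 93 * (a * u) + 14 * (b * b) + 4 * (a * b))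
      -- The claim is quadratic in the counts and dominance is linear; this multiplier makes all
      -- coefficients of the remaining difference nonnegative.
      (*-monoʳ-≤ (11 * u + 2 * b) (subst (λ m → deficit c x ≤ 3 * m) (sym (support-total c x)) dom))
      (lemma a b u))
    where
    a = support c x
    b = support (other c) x
    u = q x
    lemma : ∀ a b u →
      14 * ((a + b + u) * (20 * b + 9 * u)) + (11 * u + 2 * b) * (20 * b + 9 * u) ≡
      15 * ((1 * 0 * a + 1 * 9 * b + 1 * 0 * u) * a + (1 * 9 * a + 1 * 20 * b + 1 * 20 * u) * b +
             (1 * 0 * a + 1 * 20 * b + 1 * 9 * u) * u)
      + (11 * u + 2 * b) * (3 * (a + b + u)) + (57 * (u * u) + 5 * (b * u) + 93 * (a * u) + 14 * (b * b) + 4 * (a * b))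
    lemma = solve-∀

  deficit-contracts : ∀ x → Dominant x →
    15 * ∑ (choices n) (λ f → deficit c (step x f)) ≤ 14 * (n ^ n * deficit c x)
  deficit-contracts x dom = *-cancelˡ-≤ n (begin
    n * (15 * D)                          ≡⟨ lemma₁ n 15 D ⟩
    15 * (n * D)                          ≡⟨ cong (15 *_) (∑-step-weigh c 0 20 9 x) ⟩
    15 * (n ^ n * meanDeficit x)          ≡⟨ lemma₁ 15 (n ^ n) (meanDeficit x) ⟩
    n ^ n * (15 * meanDeficit x)          ≤⟨ *-monoʳ-≤ (n ^ n) (meanDeficit≤ x dom) ⟩
    n ^ n * (14 * (n * deficit c x))      ≡⟨ lemma₂ (n ^ n) 14 n (deficit c x) ⟩
    n * (14 * (n ^ n * deficit c x))      ∎)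
    where
    open ≤-Reasoning
    D = ∑ (choices n) (λ f → deficit c (step x f))
    lemma₁ : ∀ a b c → a * (b * c) ≡ b * (a * c)
    lemma₁ = solve-∀
    lemma₂ : ∀ a b c d → a * (b * (c * d)) ≡ c * (b * (a * d))
    lemma₂ = solve-∀

  -- By contraction `meanDeficit x` is at most 2.8 n², so the macroscopic bound with threshold 3n
  -- has room for (150 - 51 · 2.8) n² = 7.2 n². As `20010` is 10 · 2001, the term in `L` takes at
  -- most 5 n² of it.
  dominant-persists : ∀ x L → Dominant x → 20010 * L ≤ n →
    # (λ f → ¬? (dominant? (step x f))) * 2 ^ L ≤ n ^ n
  dominant-persists x L dom L≤ = chernoff-macroscopic c 0 20 9 x (3 * n) L
    z≤n ≤-refl (m≤m+n 9 11) (λ f → ¬? (dominant? (step x f))) (λ f ¬dom → <⇒≤ (≰⇒> ¬dom))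
    (*-cancelˡ-≤ 5 (≤-cert-slack (11 * (n * n))
      (+-mono-≤ (*-monoʳ-≤ 17 (meanDeficit≤ x dom))
        (+-mono-≤ (*-monoʳ-≤ (238 * n) dom)
                  (*-monoʳ-≤ (25 * n) (≤-trans (≤-reflexive (lemma₁ L)) L≤))))
      (lemma₂ n (L * 2001) (meanDeficit x) (deficit c x))))
    where
    lemma₁ : ∀ L → 10 * (L * 2001) ≡ 20010 * L
    lemma₁ L = trans (cong (10 *_) (*-comm L 2001)) (sym (*-assoc 10 2001 L))
    lemma₂ : ∀ n D S Y →
      5 * (50 * (3 * n) * n) + (17 * (15 * S) + (238 * n * Y + 25 * n * (10 * D))) ≡
      5 * (51 * S + 50 * D * n) + (17 * (14 * (n * Y)) + (238 * n * (3 * n) + 25 * n * n)) + 11 * (n * n)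
    lemma₂ = solve-∀

  -- The two terms bound the probability that the deficit is still positive, by Markov's
  -- inequality, and the probability of ever leaving the dominant region.
  misses-dominant : ∀ L → 20010 * L ≤ n → ∀ T x → Dominant x →
    misses (monochromatic? c) T x * (15 ^ T * 2 ^ L) ≤
    #Ω n T * (deficit c x * (14 ^ T * 2 ^ L) + T * 15 ^ T)
  misses-dominant L L≤ zero x dom with monochromatic-or-deficit c x
  ... | inj₁ mono = ≤-trans (≤-reflexive (cong (_* (1 * 2 ^ L)) (misses-0 (monochromatic? c) x mono))) z≤n
  ... | inj₂ 1≤Y = begin
    misses (monochromatic? c) 0 x * (1 * 2 ^ L) ≤⟨ *-monoˡ-≤ (1 * 2 ^ L) (≤-trans (misses-0-≤1 (monochromatic? c) x) 1≤Y) ⟩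
    deficit c x * (1 * 2 ^ L)                   ≤⟨ m≤m+n _ 0 ⟩
    deficit c x * (1 * 2 ^ L) + 0               ≤⟨ m≤m+n _ 0 ⟩
    1 * (deficit c x * (1 * 2 ^ L) + 0)         ∎
    where open ≤-Reasoning
  misses-dominant L L≤ (suc T) x dom = begin
    misses P? (suc T) x * (15 * 15 ^ T * 2 ^ L)
      ≡⟨ lemma₁ (misses P? (suc T) x) 15 (15 ^ T) (2 ^ L) ⟩
    15 * (misses P? (suc T) x * (15 ^ T * 2 ^ L))
      ≤⟨ *-monoʳ-≤ 15 (*-monoˡ-≤ R (misses-suc P? T x)) ⟩
    15 * (∑ (choices n) (λ f → misses P? T (step x f)) * R)
      ≡⟨ cong (15 *_) (∑-*ʳ R (λ f → misses P? T (step x f)) (choices n)) ⟨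
    15 * ∑ (choices n) (λ f → misses P? T (step x f) * R)
      ≤⟨ *-monoʳ-≤ 15 (∑-mono (choices n) pointwise) ⟩
    15 * ∑ (choices n) (λ f → 𝟙 (E? f) * (Ω * R) + (deficit c (step x f) * V + U))
      ≡⟨ cong (15 *_) (trans (∑-+ (λ f → 𝟙 (E? f) * (Ω * R)) (λ f → D f * V + U) (choices n))
           (cong₂ _+_ (∑-*ʳ (Ω * R) (λ f → 𝟙 (E? f)) (choices n))
             (trans (∑-+ (λ f → D f * V) (λ _ → U) (choices n))
                    (cong₂ _+_ (∑-*ʳ V D (choices n)) (∑-choices n U))))) ⟩
    15 * (# E? * (Ω * R) + (∑D * V + N * U))
      ≤⟨ ≤-cert (+-mono-≤ (*-monoˡ-≤ V (deficit-contracts x dom))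
                          (*-monoʳ-≤ (15 * Ω * 15 ^ T) (dominant-persists x L dom L≤)))
                (lemma₂ (# E?) Ω (15 ^ T) (2 ^ L) ∑D (14 ^ T) N T (deficit c x)) ⟩
    N * Ω * (deficit c x * (14 * 14 ^ T * 2 ^ L) + suc T * (15 * 15 ^ T)) ∎
    where
    open ≤-Reasoning
    P? = monochromatic? c
    N = n ^ n
    Ω = #Ω n T
    R = 15 ^ T * 2 ^ L
    V = Ω * (14 ^ T * 2 ^ L)
    U = Ω * (T * 15 ^ T)
    D : Choices n → ℕ
    D f = deficit c (step x f)
    ∑D = ∑ (choices n) D
    E? = λ f → ¬? (dominant? (step x f))
    lemma₁ : ∀ m a b c → m * (a * b * c) ≡ a * (m * (b * c))
    lemma₁ = solve-∀
    lemma₂ : ∀ e Ω r t d v N T D →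
      N * Ω * (D * (14 * v * t) + (1 + T) * (15 * r)) +
        (15 * d * (Ω * (v * t)) + 15 * Ω * r * (e * t)) ≡
      15 * (e * (Ω * (r * t)) + (d * (Ω * (v * t)) + N * (Ω * (T * r)))) +
        (14 * (N * D) * (Ω * (v * t)) + 15 * Ω * r * N)
    lemma₂ = solve-∀
    lemma₃ : ∀ Ω D v t → Ω * (D * v + t) ≡ D * (Ω * v) + Ω * t
    lemma₃ = solve-∀
    split : ∀ y (dom? : Dec (Dominant y)) →
      misses P? T y * R ≤ 𝟙 (¬? dom?) * (Ω * R) + (deficit c y * V + U)
    split y (yes dom′) = ≤-trans (misses-dominant L L≤ T y dom′)
                                 (≤-reflexive (lemma₃ Ω (deficit c y) (14 ^ T * 2 ^ L) (T * 15 ^ T)))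
    split y (no  _)    = ≤-trans (*-monoˡ-≤ R (misses≤#Ω P? T y))
                                 (≤-trans (m≤m+n _ 0) (m≤m+n (1 * (Ω * R)) _))
    pointwise : ∀ f → misses P? T (step x f) * R ≤ 𝟙 (E? f) * (Ω * R) + (D f * V + U)
    pointwise f = split (step x f) (dominant? (step x f))

-- Growth of the bias

-- The statistic 80b + 40u is 40 (n - s), and `k` is its value at s = pσ/40. The expected new bias
-- is σ (n + u)/n, so by `drift` the mean lies at least σ below `k`. The hypothesis `noise` spends
-- this σ: 6440 = 161 · 40 comes from (M + 1)(M + 80) ≤ M² + 161 M and a mean of at most 40n; the
-- other term is the cost of `L`.
gap-bias : ∀ a b σ u n M L p k → a ≡ b + σ → a + b + u ≡ n → k + p * σ ≡ 40 * n → 1 ≤ M →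
  suc p * n ≤ 40 * (n + u) → 6440 * n + L * (suc M * M) ≤ σ * M →
  suc M * ((M + 80) * mean 1 1 1 0 80 40 a b u + L * (M * M) * n) ≤ k * (M * M) * n
gap-bias a b σ u n M L p k a≡ total k≡ 1≤M drift noise =
  ≤-cert-slack (6440 * M * (σ * (n + u)))
    (+-mono-≤ (*-monoʳ-≤ (M * n) noise)
      (+-mono-≤ (*-monoʳ-≤ (σ * (M * M)) drift)
        (+-mono-≤ (*-monoʳ-≤ (80 * S) 1≤M)
          (+-mono-≤ (*-monoʳ-≤ (M * M * n) (≤-reflexive (sym k≡)))
                    (*-monoʳ-≤ (M * M + 161 * M) (≤-reflexive (S≡ a n a≡ total)))))))
    (lemma σ u n M L p k S)
  where
  S = mean 1 1 1 0 80 40 a b u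
  S≡ : ∀ a n → a ≡ b + σ → a + b + u ≡ n → mean 1 1 1 0 80 40 a b u + 40 * (σ * (n + u)) ≡ 40 * (n * n)
  S≡ .(b + σ) .(b + σ + b + u) refl refl = identity b σ u
    where
    identity : ∀ b σ u →
      (1 * 0 * (b + σ) + 1 * 40 * b + 1 * 0 * u) * (b + σ) +
      (1 * 40 * (b + σ) + 1 * 80 * b + 1 * 80 * u) * b +
      (1 * 0 * (b + σ) + 1 * 80 * b + 1 * 40 * u) * u + 40 * (σ * (b + σ + b + u + u)) ≡
      40 * ((b + σ + b + u) * (b + σ + b + u))
    identity = solve-∀
  lemma : ∀ σ u n M L p k S →
    k * (M * M) * n +
      (M * n * (6440 * n + L * ((1 + M) * M)) +
       (σ * (M * M) * ((1 + p) * n) +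
        (80 * S * 1 + (M * M * n * (40 * n) + (M * M + 161 * M) * (S + 40 * (σ * (n + u))))))) ≡
    (1 + M) * ((M + 80) * S + L * (M * M) * n) +
      (M * n * (σ * M) +
       (σ * (M * M) * (40 * (n + u)) +
        (80 * S * M + (M * M * n * (k + p * σ) + (M * M + 161 * M) * (40 * (n * n)))))) +
      6440 * M * (σ * (n + u))
  lemma = solve-∀

bias≤ : ∀ a b σ u n → a ≡ b + σ → a + b + u ≡ n → 3 * n < 20 * b + 9 * u → 10 * σ ≤ 7 * n
bias≤ .(b + σ) b σ u .(b + σ + b + u) refl refl notDom =
  ≤-cert-slack u (<⇒≤ notDom) (lemma b σ u)
  where
  lemma : ∀ b σ u → 7 * (b + σ + b + u) + 3 * (b + σ + b + u) ≡ 10 * σ + (20 * b + 9 * u) + u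
  lemma = solve-∀

-- 6 (q² + 2ab) + 3 s² = 2 n² + (3q - n)², so q² + 2ab is of the order of n² as long as 10 s ≤ 7 n.
gap-undecided : ∀ a b σ u n D → a ≡ b + σ → a + b + u ≡ n → 10 * σ ≤ 7 * n → 10 * D ≤ n →
  51 * mean 1 1 1 20 20 0 a b u + 50 * D * n ≤ 50 * (19 * n) * n
gap-undecided a b σ u n D a≡ total σ≤ D≤ =
  ≤-cert-slack (10 * (n * n)) (+-mono-≤ (*-monoʳ-≤ 17 S≤) (*-monoʳ-≤ (5 * n) D≤)) (lemma₃ n D S)
  where
  S = mean 1 1 1 20 20 0 a b u
  S≡ : ∀ a n → a ≡ b + σ → a + b + u ≡ n →
       mean 1 1 1 20 20 0 a b u + 30 * (u * u) ≡ 10 * (n * n) + 10 * (σ * σ) + 20 * (u * n)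
  S≡ .(b + σ) .(b + σ + b + u) refl refl = identity b σ u
    where
    identity : ∀ b σ u →
      (1 * 20 * (b + σ) + 1 * 0 * b + 1 * 20 * u) * (b + σ) +
      (1 * 0 * (b + σ) + 1 * 20 * b + 1 * 20 * u) * b +
      (1 * 20 * (b + σ) + 1 * 20 * b + 1 * 0 * u) * u + 30 * (u * u) ≡
      10 * ((b + σ + b + u) * (b + σ + b + u)) + 10 * (σ * σ) + 20 * (u * (b + σ + b + u))
    identity = solve-∀
  σ²≤ : 2 * (σ * σ) ≤ n * n
  σ²≤ = *-cancelˡ-≤ 50 (≤-cert-slack (n * n) (*-mono-≤ σ≤ σ≤) (lemma₁ σ n))
    where
    lemma₁ : ∀ σ n → 50 * (n * n) + 10 * σ * (10 * σ) ≡ 50 * (2 * (σ * σ)) + 7 * n * (7 * n) + n * n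
    lemma₁ = solve-∀
  S≤ : 3 * S ≤ 55 * (n * n)
  S≤ = ≤-cert
    (+-mono-≤ (*-monoʳ-≤ 3 (≤-reflexive (S≡ a n a≡ total)))
      (+-mono-≤ (*-monoʳ-≤ 10 (2xy≤x²+y² (3 * u) n)) (*-monoʳ-≤ 15 σ²≤)))
    (lemma₂ σ u n S)
    where
    lemma₂ : ∀ σ u n S →
      55 * (n * n) + (3 * (S + 30 * (u * u)) + (10 * (2 * (3 * u * n)) + 15 * (2 * (σ * σ)))) ≡
      3 * S + (3 * (10 * (n * n) + 10 * (σ * σ) + 20 * (u * n)) +
               (10 * (3 * u * (3 * u) + n * n) + 15 * (n * n)))
    lemma₂ = solve-∀
  lemma₃ : ∀ n D S →
    50 * (19 * n) * n + (17 * (3 * S) + 5 * n * (10 * D)) ≡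
    51 * S + 50 * D * n + (17 * (55 * (n * n)) + 5 * n * n) + 10 * (n * n)
  lemma₃ = solve-∀

-- From σ² ≥ level n L on, fluctuations of order σ have probability at most 2^(-L).
level : ℕ → ℕ → ℕ
level n L = 4 * (L * (2 * (6440 * n) + n))

-- For a scale of about 2D/σ the term `D` takes half of the right side, and the condition on σ²
-- makes four times `L` times the scale at most σ, so the term in `L` fits into the other half. The
-- bound 6400 is 80², as `chord` requires for a statistic with coefficients up to 80.
exists-scale : ∀ D σ n L → .{{NonZero σ}} → σ ≤ n → 6440 * σ ≤ D → 4 * (L * (2 * D + n)) ≤ σ * σ →
  ∃[ M ] 6400 ≤ suc M × D + L * (suc (suc M) * suc M) ≤ σ * suc M
exists-scale D σ n L σ≤n σ≤D σ²≥ = M ∸ 1 , M≥ , noise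
  where
  M = suc (2 * D / σ)
  Mσ≥ : 2 * D ≤ M * σ
  Mσ≥ = begin
    2 * D                           ≡⟨ m≡m%n+[m/n]*n (2 * D) σ ⟩
    2 * D % σ + 2 * D / σ * σ       ≤⟨ +-monoˡ-≤ _ (<⇒≤ (m%n<n (2 * D) σ)) ⟩
    M * σ                           ∎
    where open ≤-Reasoning
  Mσ≤ : M * σ ≤ 2 * D + n
  Mσ≤ = ≤-trans (+-mono-≤ σ≤n (m/n*n≤m (2 * D) σ)) (≤-reflexive (+-comm n (2 * D)))
  M≥ : 6400 ≤ M
  M≥ = ≤-trans (m≤m+n 6400 40) (*-cancelʳ-≤ 6440 M σ (≤-trans σ≤D (≤-trans (m≤m+n D (1 * D)) Mσ≥)))
  4LM≤σ : 4 * (L * M) ≤ σ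
  4LM≤σ = *-cancelʳ-≤ (4 * (L * M)) σ σ
    (≤-trans (≤-cert (*-monoʳ-≤ (4 * L) Mσ≤) (lemma L M σ (2 * D + n))) σ²≥)
    where
    lemma : ∀ L M σ v → 4 * (L * v) + 4 * L * (M * σ) ≡ 4 * (L * M) * σ + 4 * L * v
    lemma = solve-∀
  noise : D + L * (suc M * M) ≤ σ * M
  noise = *-cancelˡ-≤ 4 (≤-cert
    (+-mono-≤ (*-monoʳ-≤ 2 Mσ≥) (+-mono-≤ (*-monoʳ-≤ M 4LM≤σ) (*-mono-≤ (s≤s (z≤n {M ∸ 1})) 4LM≤σ)))
    (lemma D L M σ))
    where
    lemma : ∀ D L M σ →
      4 * (σ * M) + (2 * (2 * D) + (M * (4 * (L * M)) + 1 * (4 * (L * M)))) ≡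
      4 * (D + L * ((1 + M) * M)) + (2 * (M * σ) + (M * σ + M * σ))
    lemma = solve-∀

module Growth (c : Color) (n : ℕ) .{{_ : NonZero n}} where
  open Absorption c n

  Undecided≥ : Pred (Config n) 0ℓ
  Undecided≥ x = n ≤ 20 * q x

  undecided≥? : Decidable Undecided≥
  undecided≥? x = n ≤? 20 * q x

  undecided-abundant : ∀ x σ L → support c x ≡ support (other c) x + σ → ¬ Dominant x → 20010 * L ≤ n →
    # (λ f → ¬? (undecided≥? (step x f))) * 2 ^ L ≤ n ^ n
  undecided-abundant x σ L a≡ ¬dom L≤ = chernoff-macroscopic c 20 20 0 x (19 * n) L
    ≤-refl ≤-refl z≤n (λ f → ¬? (undecided≥? (step x f)))
    (λ f few → scarce (support c (step x f)) (support (other c) (step x f)) (q (step x f))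
                      (support-total c (step x f)) (≰⇒> few))
    (gap-undecided (support c x) (support (other c) x) σ (q x) n (L * 2001) a≡ (support-total c x)
      (bias≤ (support c x) (support (other c) x) σ (q x) n a≡ (support-total c x) (≰⇒> ¬dom))
      (≤-trans (≤-reflexive (trans (cong (10 *_) (*-comm L 2001)) (sym (*-assoc 10 2001 L)))) L≤))
    where
    scarce : ∀ a b u → a + b + u ≡ n → 20 * u < n → 19 * n ≤ 20 * a + 20 * b + 0 * u
    scarce a b u total few = ≤-cert (<⇒≤ few)
      (subst (λ m → 20 * a + 20 * b + 0 * u + 20 * u ≡ 19 * m + m) total (lemma a b u))
      where
      lemma : ∀ a b u → 20 * a + 20 * b + 0 * u + 20 * u ≡ 19 * (a + b + u) + (a + b + u)
      lemma = solve-∀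

  Bias> : ℕ → ℕ → Pred (Config n) 0ℓ
  Bias> p σ y = 40 * support (other c) y + p * σ < 40 * support c y

  bias>? : ∀ p σ → Decidable (Bias> p σ)
  bias>? p σ y = 40 * support (other c) y + p * σ <? 40 * support c y

  -- Used with `p = 41` when at least n/20 nodes are undecided: the mean gain is then at least
  -- 42/40, and one fortieth is left to the fluctuations. Used with `p = 39` in the first round,
  -- where the mean gain is only known to be at least 1.
  bias-step : ∀ x σ L p → .{{NonZero σ}} → support c x ≡ support (other c) x + σ →
    p * σ ≤ 40 * n → suc p * n ≤ 40 * (n + q x) → level n L ≤ σ * σ →
    # (λ f → ¬? (bias>? p σ (step x f))) * 2 ^ L ≤ n ^ n
  bias-step x σ L p a≡ pσ≤ drift σ²≥ =
    let M , M≥ , noise = exists-scale (6440 * n) σ n L σ≤n (*-monoʳ-≤ 6440 σ≤n) σ²≥ in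
    chernoff-uniform c 0 80 40 x 80 (suc M) (40 * n ∸ p * σ) L
      z≤n ≤-refl (m≤m+n 40 40) M≥ (λ f → ¬? (bias>? p σ (step x f)))
      (λ f small → deficient (support c (step x f)) (support (other c) (step x f)) (q (step x f))
                             (support-total c (step x f)) (≮⇒≥ small))
      (gap-bias (support c x) b σ (q x) n (suc M) L p (40 * n ∸ p * σ) a≡ total (m∸n+n≡m pσ≤) (s≤s z≤n) drift noise)
    where
    b = support (other c) x
    total = support-total c x
    σ≤n : σ ≤ n
    σ≤n = begin
      σ                      ≤⟨ m≤n+m σ b ⟩
      b + σ                  ≡⟨ a≡ ⟨
      support c x            ≤⟨ ≤-trans (m≤m+n _ b) (m≤m+n _ (q x)) ⟩
      support c x + b + q x  ≡⟨ total ⟩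
      n                      ∎
      where open ≤-Reasoning
    deficient : ∀ a b u → a + b + u ≡ n → 40 * a ≤ 40 * b + p * σ →
                40 * n ∸ p * σ ≤ 0 * a + 80 * b + 40 * u
    deficient a b u total small = m≤n+o⇒m∸n≤o (40 * n) (p * σ)
      (subst (λ m → 40 * m ≤ p * σ + (0 * a + 80 * b + 40 * u)) total
        (≤-cert small (lemma a b u (p * σ))))
      where
      lemma : ∀ a b u r → r + (0 * a + 80 * b + 40 * u) + 40 * a ≡ 40 * (a + b + u) + (40 * b + r)
      lemma = solve-∀

-- Growth of the bias over successive rounds

module Amplification (c : Color) (n : ℕ) .{{_ : NonZero n}} where
  open Absorption c n
  open Growth c n

  bias-gained : ∀ p σ y → Bias> p σ y →
    ∃[ σ′ ] support c y ≡ support (other c) y + σ′ × p * σ < 40 * σ′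
  bias-gained p σ y gain = support c y ∸ b , sym (m+[n∸m]≡n b≤a) ,
    +-cancelˡ-< (40 * b) _ _ (≤-trans gain (≤-reflexive (begin
      40 * support c y                      ≡⟨ cong (40 *_) (m+[n∸m]≡n b≤a) ⟨
      40 * (b + (support c y ∸ b))          ≡⟨ *-distribˡ-+ 40 b _ ⟩
      40 * b + 40 * (support c y ∸ b)       ∎)))
    where
    open ≡-Reasoning
    b = support (other c) y
    b≤a : b ≤ support c y
    b≤a = *-cancelˡ-≤ 40 (<⇒≤ (≤-trans (s≤s (m≤m+n (40 * b) (p * σ))) gain))

  level-pos : ∀ σ L → 20 ≤ L → level n L ≤ σ * σ → NonZero σ
  level-pos zero    L 20≤L lv = contradiction (≤-trans (m≤m*n 1 n) (≤-trans small lv)) λ ()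
    where
    small : 1 * n ≤ level n L
    small = ≤-trans (*-mono-≤ (≤-trans (s≤s z≤n) 20≤L) (m≤n+m n (2 * (6440 * n)))) (m≤n*m (L * (2 * (6440 * n) + n)) 4)
  level-pos (suc _) L 20≤L lv = _

  -- A gain by a factor 41/40 raises the exponent L by one, which makes the failure
  -- probabilities of the successive rounds summable.
  level-gain : ∀ σ σ′ L → 20 ≤ L → 41 * σ < 40 * σ′ → level n L ≤ σ * σ → level n (suc L) ≤ σ′ * σ′
  level-gain σ σ′ L 20≤L gain lv = *-cancelˡ-≤ 1600 (≤-cert
    (+-mono-≤ (*-mono-≤ (<⇒≤ gain) (<⇒≤ gain)) (+-mono-≤ (*-monoʳ-≤ 1681 lv) (*-monoˡ-≤ (4 * v) (m≤n⇒m≤n+o L (*-monoʳ-≤ 80 20≤L)))))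
    (lemma σ σ′ L v))
    where
    v = 2 * (6440 * n) + n
    lemma : ∀ σ σ′ L v →
      1600 * (σ′ * σ′) + (41 * σ * (41 * σ) + (1681 * (4 * (L * v)) + 1600 * (4 * v))) ≡
      1600 * (4 * ((1 + L) * v)) + (40 * σ′ * (40 * σ′) + (1681 * (σ * σ) + (80 * L + L) * (4 * v)))
    lemma = solve-∀

  module _ (T Λ : ℕ) (20010Λ≤n : 20010 * Λ ≤ n)
           (settle : ∀ x → Dominant x → misses (monochromatic? c) T x * 2 ^ Λ ≤ 4 * #Ω n T) where

    -- `J` is a budget of rounds: by the last inequality, `J` gains by 41/40 carry σ to `n`, a bias
    -- that is impossible outside the dominant region. `L` is the exponent of the failure
    -- probability that the present bias affords.
    Biased : ℕ → ℕ → Pred (Config n) 0ℓ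
    Biased J L x = ∃[ σ ] support c x ≡ support (other c) x + σ × Undecided≥ x ×
                          level n L ≤ σ * σ × n * 40 ^ J ≤ σ * 41 ^ J

    private
      P? : Decidable (Monochromatic {n} c)
      P? = monochromatic? c

      double : ∀ T L x → misses P? T x * 2 ^ suc L ≤ 4 * #Ω n T → misses P? T x * 2 ^ L ≤ 2 * #Ω n T
      double T L x m≤ = *-cancelˡ-≤ 2 (subst₂ _≤_ (lemma₁ (misses P? T x) (2 ^ L)) (*-assoc 2 2 (#Ω n T)) m≤)
        where
        lemma₁ : ∀ m t → m * (2 * t) ≡ 2 * (m * t)
        lemma₁ = solve-∀

      10σ≤7n : ∀ x σ → support c x ≡ support (other c) x + σ → ¬ Dominant x → 10 * σ ≤ 7 * n
      10σ≤7n x σ a≡ ¬dom = bias≤ (support c x) (support (other c) x) σ (q x) n a≡ (support-total c x) (≰⇒> ¬dom)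

      pσ≤40n : ∀ p σ → p ≤ 41 → 10 * σ ≤ 7 * n → p * σ ≤ 40 * n
      pσ≤40n p σ p≤41 σ≤ = *-cancelˡ-≤ 10 (begin
        10 * (p * σ)   ≡⟨ x∙yz≈y∙xz 10 p σ ⟩
        p * (10 * σ)   ≤⟨ *-mono-≤ p≤41 σ≤ ⟩
        41 * (7 * n)   ≡⟨ *-assoc 41 7 n ⟨
        287 * n        ≤⟨ *-monoˡ-≤ n (m≤m+n 287 113) ⟩
        400 * n        ≡⟨ *-assoc 10 40 n ⟩
        10 * (40 * n)  ∎)
        where
        open ≤-Reasoning

      2^-union : ∀ L {E F : Pred (Choices n) 0ℓ} (E? : Decidable E) (F? : Decidable F) →
        # E? * 2 ^ L ≤ n ^ n → # F? * 2 ^ L ≤ n ^ n → # (λ f → E? f ⊎-dec F? f) * 2 ^ L ≤ 2 * n ^ n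
      2^-union L E? F? E≤ F≤ = begin
        # (λ f → E? f ⊎-dec F? f) * 2 ^ L   ≤⟨ *-monoˡ-≤ (2 ^ L) (#-⊎ E? F?) ⟩
        (# E? + # F?) * 2 ^ L               ≡⟨ *-distribʳ-+ (2 ^ L) (# E?) (# F?) ⟩
        # E? * 2 ^ L + # F? * 2 ^ L         ≤⟨ +-mono-≤ E≤ (≤-trans F≤ (m≤m+n _ 0)) ⟩
        2 * n ^ n                           ∎
        where open ≤-Reasoning

    dominant-round : ∀ T L γ x → L ≤ Λ → Dominant x →
      (∀ y → Dominant y → misses P? T y * 2 ^ L ≤ γ * #Ω n T) →
      misses P? (suc T) x * 2 ^ L ≤ suc γ * #Ω n (suc T)
    dominant-round T L γ x L≤Λ dom rest =
      misses-union P? T x (2 ^ L) 1 γ (λ f → ¬? (dominant? (step x f)))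
        (≤-trans (dominant-persists x L dom (≤-trans (*-monoʳ-≤ 20010 L≤Λ) 20010Λ≤n)) (m≤m+n _ 0))
        (λ f ¬¬dom → rest (step x f) (decidable-stable (dominant? (step x f)) ¬¬dom))

    biased-round : ∀ T L γ x p σ → L ≤ Λ → ¬ Dominant x → .{{NonZero σ}} →
      support c x ≡ support (other c) x + σ → level n L ≤ σ * σ →
      p ≤ 41 → suc p * n ≤ 40 * (n + q x) →
      (∀ y σ′ → support c y ≡ support (other c) y + σ′ → p * σ < 40 * σ′ → Undecided≥ y →
        misses P? T y * 2 ^ L ≤ γ * #Ω n T) →
      misses P? (suc T) x * 2 ^ L ≤ (2 + γ) * #Ω n (suc T)
    biased-round T L γ x p σ L≤Λ ¬dom a≡ lv p≤41 drift rest =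
      misses-union P? T x (2 ^ L) 2 γ (λ f → lost? f ⊎-dec few? f)
        (2^-union L lost? few? (bias-step x σ L p a≡ (pσ≤40n p σ p≤41 (10σ≤7n x σ a≡ ¬dom)) drift lv)
                               (undecided-abundant x σ L a≡ ¬dom (≤-trans (*-monoʳ-≤ 20010 L≤Λ) 20010Λ≤n)))
        next
      where
      lost? : Decidable (λ f → ¬ Bias> p σ (step x f))
      lost? f = ¬? (bias>? p σ (step x f))
      few? : Decidable (λ f → ¬ Undecided≥ (step x f))
      few? f = ¬? (undecided≥? (step x f))
      next : ∀ f → ¬ (¬ Bias> p σ (step x f) ⊎ ¬ Undecided≥ (step x f)) →
             misses P? T (step x f) * 2 ^ L ≤ γ * #Ω n T
      next f good =
        let σ′ , a′≡ , gain = bias-gained p σ (step x f) (decidable-stable (bias>? p σ (step x f)) (good ∘ inj₁)) in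
        rest (step x f) σ′ a′≡ gain (decidable-stable (undecided≥? (step x f)) (good ∘ inj₂))

    -- Every round lowers `J` and raises `L`, so `L + J` is preserved. A round of growth fails in
    -- two ways, each of probability at most 2^(-L), and the later rounds add 4 · 2^(-L-1); the
    -- constant 4 is the fixed point of γ ↦ 2 + γ/2.
    growth : ∀ J L x → 20 ≤ L → L + J ≤ Λ → Dominant x ⊎ Biased J L x →
             misses P? (J + T) x * 2 ^ L ≤ 4 * #Ω n (J + T)
    growth zero L x 20≤L L+J≤Λ start = ≤-trans
      (*-monoʳ-≤ (misses P? T x) (^-monoʳ-≤ 2 (≤-trans (m≤m+n L 0) L+J≤Λ))) (settle x (dominant start))
      where
      dominant : Dominant x ⊎ Biased 0 L x → Dominant x
      dominant (inj₁ dom) = dom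
      dominant (inj₂ (σ , a≡ , _ , _ , n≤σ)) = decidable-stable (dominant? x) λ ¬dom →
        contradiction (10σ≤7n x σ a≡ ¬dom) (<⇒≱ (begin-strict
          7 * n   <⟨ *-monoˡ-< n (s≤s (m≤m+n 7 2)) ⟩
          10 * n  ≤⟨ *-monoʳ-≤ 10 (subst₂ _≤_ (*-identityʳ n) (*-identityʳ σ) n≤σ) ⟩
          10 * σ  ∎))
        where open ≤-Reasoning
    growth (suc J) L x 20≤L L+J≤Λ start = split (dominant? x) start
      where
      L≤Λ : L ≤ Λ
      L≤Λ = m+n≤o⇒m≤o L L+J≤Λ
      later : ∀ y → Dominant y ⊎ Biased J (suc L) y → misses P? (J + T) y * 2 ^ L ≤ 2 * #Ω n (J + T)
      later y start′ = double (J + T) L y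
        (growth J (suc L) y (m≤n⇒m≤1+n 20≤L) (subst (_≤ Λ) (+-suc L J) L+J≤Λ) start′)
      split : Dec (Dominant x) → Dominant x ⊎ Biased (suc J) L x →
              misses P? (suc J + T) x * 2 ^ L ≤ 4 * #Ω n (suc J + T)
      split (yes dom) _          = ≤-trans
        (dominant-round (J + T) L 2 x L≤Λ dom (λ y dom′ → later y (inj₁ dom′)))
        (*-monoˡ-≤ (#Ω n (suc J + T)) (n≤1+n 3))
      split (no ¬dom) (inj₁ dom) = contradiction dom ¬dom
      split (no ¬dom) (inj₂ (σ , a≡ , n≤20q , lv , n≤σ)) =
        biased-round (J + T) L 2 x 41 σ L≤Λ ¬dom {{level-pos σ L 20≤L lv}} a≡ lv ≤-refl drift
          (λ y σ′ a′≡ gain n≤20q′ → later y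
            (inj₂ (σ′ , a′≡ , n≤20q′ , level-gain σ σ′ L 20≤L gain lv , progress σ′ gain)))
        where
        drift : 42 * n ≤ 40 * (n + q x)
        drift = ≤-cert (*-monoʳ-≤ 2 n≤20q) (lemma n (q x))
          where
          lemma : ∀ n u → 40 * (n + u) + 2 * n ≡ 42 * n + 2 * (20 * u)
          lemma = solve-∀
        progress : ∀ σ′ → 41 * σ < 40 * σ′ → n * 40 ^ J ≤ σ′ * 41 ^ J
        progress σ′ gain = *-cancelˡ-≤ 40 (begin
          40 * (n * 40 ^ J)   ≡⟨ x∙yz≈y∙xz 40 n (40 ^ J) ⟩
          n * 40 ^ suc J      ≤⟨ n≤σ ⟩
          σ * 41 ^ suc J      ≡⟨ x∙yz≈yx∙z σ 41 (41 ^ J) ⟩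
          41 * σ * 41 ^ J     ≤⟨ *-monoˡ-≤ (41 ^ J) (<⇒≤ gain) ⟩
          40 * σ′ * 41 ^ J    ≡⟨ *-assoc 40 σ′ (41 ^ J) ⟩
          40 * (σ′ * 41 ^ J)  ∎)
          where open ≤-Reasoning

    -- In the first round, nothing is assumed about the number of undecided nodes and the bias
    -- may drop by a factor 39/40.
    growth-from-any : ∀ J L x σ → 20 ≤ L → L + J ≤ Λ → support c x ≡ support (other c) x + σ →
      2 * level n L ≤ σ * σ → n * 40 ^ J ≤ 41 ^ J →
      misses P? (suc J + T) x * 2 ^ L ≤ 6 * #Ω n (suc J + T)
    growth-from-any J L x σ 20≤L L+J≤Λ a≡ lv n≤ = split (dominant? x)
      where
      L≤Λ : L ≤ Λ
      L≤Λ = m+n≤o⇒m≤o L L+J≤Λ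
      lv′ : level n L ≤ σ * σ
      lv′ = ≤-trans (m≤m+n (level n L) _) lv
      level-kept : ∀ σ′ → 39 * σ < 40 * σ′ → level n L ≤ σ′ * σ′
      level-kept σ′ gain = *-cancelˡ-≤ 1600 (≤-cert-slack (721 * (σ * σ))
        (+-mono-≤ (*-mono-≤ (<⇒≤ gain) (<⇒≤ gain)) (*-monoʳ-≤ 800 lv)) (lemma σ σ′ (level n L)))
        where
        lemma : ∀ σ σ′ v → 1600 * (σ′ * σ′) + (39 * σ * (39 * σ) + 800 * (2 * v)) ≡
          1600 * v + (40 * σ′ * (40 * σ′) + 800 * (σ * σ)) + 721 * (σ * σ)
        lemma = solve-∀
      split : Dec (Dominant x) → misses P? (suc J + T) x * 2 ^ L ≤ 6 * #Ω n (suc J + T)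
      split (yes dom) = ≤-trans
        (dominant-round (J + T) L 4 x L≤Λ dom (λ y dom′ → growth J L y 20≤L L+J≤Λ (inj₁ dom′)))
        (*-monoˡ-≤ (#Ω n (suc J + T)) (n≤1+n 5))
      split (no ¬dom) =
        -- Without a gain `L` is not raised for the remaining rounds, whence 2 + 4 = 6 as the
        -- constant.
        biased-round (J + T) L 4 x 39 σ L≤Λ ¬dom {{level-pos σ L 20≤L lv′}} a≡ lv′ (m≤m+n 39 2)
          (*-monoʳ-≤ 40 (m≤m+n n (q x)))
          (λ y σ′ a′≡ gain n≤20q → growth J L y 20≤L L+J≤Λ
            (inj₂ (σ′ , a′≡ , n≤20q , level-kept σ′ gain ,
              ≤-trans n≤ (m≤n*m (41 ^ J) σ′ {{>-nonZero (*-cancelˡ-< 40 0 σ′ (≤-trans (s≤s z≤n) gain))}}))))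

-- Convergence within O(log n) rounds

n<2^n : ∀ n → n < 2 ^ n
n<2^n zero    = s≤s z≤n
n<2^n (suc n) = ≤-trans (s≤s (n<2^n n)) (≤-trans (+-monoˡ-≤ (2 ^ n) (m^n>0 2 n)) (≤-reflexive (cong (2 ^ n +_) (sym (+-identityʳ (2 ^ n))))))

n<2^[1+log] : ∀ n → n < 2 ^ suc (log n)
n<2^[1+log] n = ≰⇒> λ 2^≤n → <-irrefl refl (≤-trans (≤-reflexive (sym (⌊log₂[2^n]⌋≡n (suc (log n))))) (⌊log₂⌋-mono-≤ 2^≤n))

2^log≤n : ∀ n → .{{NonZero n}} → 2 ^ log n ≤ n
2^log≤n n@(suc _) = go (log n) n refl (s≤s z≤n)
  where
  go : ∀ ℓ n → log n ≡ ℓ → 1 ≤ n → 2 ^ ℓ ≤ n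
  go zero    n               _   1≤n = 1≤n
  go (suc ℓ) (suc zero)      ()
  go (suc ℓ) n@(suc (suc m)) eq _   = begin
    2 * 2 ^ ℓ                  ≤⟨ *-monoʳ-≤ 2 (go ℓ ⌊ n /2⌋ (trans (⌊log₂⌊n/2⌋⌋≡⌊log₂n⌋∸1 n) (cong (_∸ 1) eq)) (s≤s z≤n)) ⟩
    2 * ⌊ n /2⌋                ≡⟨ cong (⌊ n /2⌋ +_) (+-identityʳ ⌊ n /2⌋) ⟩
    ⌊ n /2⌋ + ⌊ n /2⌋          ≤⟨ +-monoʳ-≤ ⌊ n /2⌋ (⌊n/2⌋≤⌈n/2⌉ n) ⟩
    ⌊ n /2⌋ + ⌈ n /2⌉          ≡⟨ ⌊n/2⌋+⌈n/2⌉≡n n ⟩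
    n                          ∎
    where open ≤-Reasoning

log≥ : ∀ k n → 2 ^ k ≤ n → k ≤ log n
log≥ k n 2^k≤n = ≤-trans (≤-reflexive (sym (⌊log₂[2^n]⌋≡n k))) (⌊log₂⌋-mono-≤ 2^k≤n)

[4+n]²≤2^[4+n] : ∀ n → (4 + n) * (4 + n) ≤ 2 ^ (4 + n)
[4+n]²≤2^[4+n] zero    = ≤-refl
[4+n]²≤2^[4+n] (suc n) = ≤-trans (≤-cert-slack (7 + 6 * n + n * n) (z≤n {0}) (lemma n)) (*-monoʳ-≤ 2 ([4+n]²≤2^[4+n] n))
  where
  lemma : ∀ n → 2 * ((4 + n) * (4 + n)) + 0 ≡ (5 + n) * (5 + n) + 0 + (7 + 6 * n + n * n)
  lemma = solve-∀

linear≤2^ : ∀ K ℓ → 4 ≤ ℓ → K ≤ ℓ → K * ℓ ≤ 2 ^ ℓ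
linear≤2^ K ℓ 4≤ℓ K≤ℓ = ≤-trans (*-monoˡ-≤ ℓ K≤ℓ)
  (subst (λ m → m * m ≤ 2 ^ m) (m+[n∸m]≡n 4≤ℓ) ([4+n]²≤2^[4+n] (ℓ ∸ 4)))

2^*p^≤r^ : ∀ p r e → 2 * p ^ e ≤ r ^ e → ∀ k → 2 ^ k * p ^ (e * k) ≤ r ^ (e * k)
2^*p^≤r^ p r e ≤^ k = subst₂ _≤_
  (trans ([m*n]^o≡m^o*n^o 2 (p ^ e) k) (cong (2 ^ k *_) (^-*-assoc p e k))) (^-*-assoc r e k)
  (^-monoˡ-≤ k ≤^)

module _ (c : Color) (n : ℕ) .{{_ : NonZero n}} where
  open Absorption c n

  -- Eleven contractions by 14/15 more than halve the expected deficit, so `11 * k` rounds bring the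
  -- initial 3n down to 3 · 2^(-Λ).
  settles : ∀ Λ k → 20010 * (Λ + 11 * k) ≤ n → n * 2 ^ Λ ≤ 2 ^ k → ∀ x → Dominant x →
            misses (monochromatic? c) (11 * k) x * 2 ^ Λ ≤ 4 * #Ω n (11 * k)
  settles Λ k small n2^Λ≤ x dom = go (11 * k) small (begin
    n * 14 ^ (11 * k) * 2 ^ Λ     ≡⟨ xy∙z≈xz∙y n (14 ^ (11 * k)) (2 ^ Λ) ⟩
    n * 2 ^ Λ * 14 ^ (11 * k)     ≤⟨ *-monoˡ-≤ (14 ^ (11 * k)) n2^Λ≤ ⟩
    2 ^ k * 14 ^ (11 * k)         ≤⟨ 2^*p^≤r^ 14 15 11 (≤ᵇ⇒≤ (2 * 14 ^ 11) (15 ^ 11) tt) k ⟩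
    15 ^ (11 * k)                 ∎)
    where
    open ≤-Reasoning
    go : ∀ T → 20010 * (Λ + T) ≤ n → n * 14 ^ T * 2 ^ Λ ≤ 15 ^ T →
         misses (monochromatic? c) T x * 2 ^ Λ ≤ 4 * #Ω n T
    go T small decay = *-cancelʳ-≤ _ _ (15 ^ T * 2 ^ T) {{m*n≢0 (15 ^ T) (2 ^ T) {{m^n≢0 15 T}} {{m^n≢0 2 T}}}} (begin
      m * 2 ^ Λ * (15 ^ T * 2 ^ T)
        ≡⟨ lemma₁ m (2 ^ Λ) (15 ^ T) (2 ^ T) ⟩
      m * (15 ^ T * (2 ^ Λ * 2 ^ T))
        ≡⟨ cong (λ p → m * (15 ^ T * p)) (^-distribˡ-+-* 2 Λ T) ⟨
      m * (15 ^ T * 2 ^ (Λ + T))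
        -- The exponent is `Λ + T` so that the additional 2^(-T) absorbs the factor `T` of the union
        -- over the rounds; this leaves 3 + 1 = 4 times 2^(-Λ).
        ≤⟨ misses-dominant (Λ + T) small T x dom ⟩
      #Ω n T * (Y * (14 ^ T * 2 ^ (Λ + T)) + T * 15 ^ T)
        ≤⟨ *-monoʳ-≤ (#Ω n T) (+-mono-≤ (*-monoˡ-≤ _ dom) (*-monoˡ-≤ (15 ^ T) (<⇒≤ (n<2^n T)))) ⟩
      #Ω n T * (3 * n * (14 ^ T * 2 ^ (Λ + T)) + 2 ^ T * 15 ^ T)
        ≡⟨ cong (λ p → #Ω n T * (3 * n * (14 ^ T * p) + 2 ^ T * 15 ^ T)) (^-distribˡ-+-* 2 Λ T) ⟩
      #Ω n T * (3 * n * (14 ^ T * (2 ^ Λ * 2 ^ T)) + 2 ^ T * 15 ^ T)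
        ≤⟨ ≤-cert (*-monoʳ-≤ (#Ω n T * (3 * 2 ^ T)) decay) (lemma₂ (#Ω n T) n (14 ^ T) (2 ^ Λ) (2 ^ T) (15 ^ T)) ⟩
      4 * #Ω n T * (15 ^ T * 2 ^ T) ∎)
      where
      m = misses (monochromatic? c) T x
      Y = deficit c x
      lemma₁ : ∀ m a b d → m * a * (b * d) ≡ m * (b * (a * d))
      lemma₁ = solve-∀
      lemma₂ : ∀ Ω n f l t g → 4 * Ω * (g * t) + Ω * (3 * t) * (n * f * l) ≡
                               Ω * (3 * n * (f * (l * t)) + t * g) + Ω * (3 * t) * g
      lemma₂ = solve-∀

-- `L` is left free because two scales are needed: a constant multiple of log n for the result with
-- high probability, and the constant 20 for the minority win, where a lead of order √n affords no
-- more and a failure probability of 6/2^20 is enough.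
Convergence : ℕ → ℕ → Set
Convergence C K = ∀ c n .{{_ : NonZero n}} (x : Config n) σ L → K ≤ log n → 20 ≤ L → L ≤ log n →
  support c x ≡ support (other c) x + σ → 2 * level n L ≤ σ * σ →
  misses (monochromatic? c) (C * log n) x * 2 ^ L ≤ 6 * #Ω n (C * log n)

convergence : ∃[ C ] ∃[ K ] Convergence C K
-- Twenty-nine gains by 41/40 double the bias, so 58 log n - 1 ≥ 29 (log n + 1) gains carry it from
-- 1 beyond n. Then `L + J` is at most 59 log n, the `Λ` below, and n 2^Λ ≤ 2^(61 log n) asks for 61
-- log n halvings of 11 rounds each. `K` makes 20010 times the sum of `Λ` and these last rounds at
-- most n, through ℓ² ≤ 2^ℓ ≤ n for ℓ = log n.
convergence = 58 + 11 * 61 , 20010 * (59 + 11 * 61) , λ c n x σ L K≤ 20≤L L≤ℓ a≡ lv →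
  go (20010 * (59 + 11 * 61)) (58 + 11 * 61) c n x σ L (log n) K≤ refl refl 20≤L L≤ℓ a≡ lv refl
  where
  go : ∀ K C c n .{{_ : NonZero n}} (x : Config n) σ L ℓ → K ≤ ℓ →
    K ≡ 20010 * (59 + 11 * 61) → C ≡ 58 + 11 * 61 → 20 ≤ L → L ≤ ℓ →
    support c x ≡ support (other c) x + σ → 2 * level n L ≤ σ * σ → ℓ ≡ log n →
    misses (monochromatic? c) (C * ℓ) x * 2 ^ L ≤ 6 * #Ω n (C * ℓ)
  go K C c n x σ L ℓ K≤ℓ K≡ C≡ 20≤L L≤ℓ a≡ lv refl =
    subst (λ R → misses (monochromatic? c) R x * 2 ^ L ≤ 6 * #Ω n R) rounds
      (growth-from-any R Λ 20010Λ≤n (settles c n Λ (61 * ℓ) 20010T≤n n2^Λ≤)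
        J L x σ 20≤L L+J≤Λ a≡ lv n≤)
    where
    open Amplification c n
    open ≤-Reasoning
    Λ R J : ℕ
    Λ = 59 * ℓ
    R = 11 * (61 * ℓ)
    J = 58 * ℓ ∸ 1
    1≤ℓ : 1 ≤ ℓ
    1≤ℓ = ≤-trans (s≤s z≤n) (≤-trans 20≤L L≤ℓ)
    1+J : suc J ≡ 58 * ℓ
    1+J = m+[n∸m]≡n (≤-trans 1≤ℓ (m≤n*m ℓ 58))
    rounds : suc J + R ≡ C * ℓ
    rounds = trans (cong₂ _+_ 1+J (sym (*-assoc 11 61 ℓ)))
      (trans (sym (*-distribʳ-+ ℓ 58 (11 * 61))) (cong (_* ℓ) {58 + 11 * 61} {C} (sym C≡)))
    20010T≤n : 20010 * (Λ + R) ≤ n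
    20010T≤n = begin
      20010 * (59 * ℓ + 11 * (61 * ℓ))    ≡⟨ cong (λ t → 20010 * (59 * ℓ + t)) (*-assoc 11 61 ℓ) ⟨
      20010 * (59 * ℓ + 11 * 61 * ℓ)      ≡⟨ cong (20010 *_) (*-distribʳ-+ ℓ 59 (11 * 61)) ⟨
      20010 * ((59 + 11 * 61) * ℓ)        ≡⟨ *-assoc 20010 (59 + 11 * 61) ℓ ⟨
      20010 * (59 + 11 * 61) * ℓ          ≡⟨ cong (_* ℓ) {K} {20010 * (59 + 11 * 61)} K≡ ⟨
      K * ℓ                               ≤⟨ linear≤2^ K ℓ (≤-trans (m≤m+n 4 16) (≤-trans 20≤L L≤ℓ)) K≤ℓ ⟩
      2 ^ ℓ                               ≤⟨ 2^log≤n n ⟩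
      n                                   ∎
    20010Λ≤n : 20010 * Λ ≤ n
    20010Λ≤n = ≤-trans (*-monoʳ-≤ 20010 (m≤m+n Λ R)) 20010T≤n
    n2^Λ≤ : n * 2 ^ Λ ≤ 2 ^ (61 * ℓ)
    n2^Λ≤ = begin
      n * 2 ^ Λ              ≤⟨ *-monoˡ-≤ (2 ^ Λ) (<⇒≤ (n<2^[1+log] n)) ⟩
      2 ^ suc ℓ * 2 ^ Λ      ≡⟨ ^-distribˡ-+-* 2 (suc ℓ) Λ ⟨
      2 ^ (suc ℓ + Λ)        ≤⟨ ^-monoʳ-≤ 2 (+-monoˡ-≤ (ℓ + Λ) 1≤ℓ) ⟩
      2 ^ (61 * ℓ)           ∎
    L+J≤Λ : L + J ≤ Λ
    L+J≤Λ = +-mono-≤ L≤ℓ (m∸n≤m (58 * ℓ) 1)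
    J≥ : 29 * suc ℓ ≤ J
    J≥ = +-cancelˡ-≤ 1 _ _ (begin
      1 + 29 * suc ℓ         ≡⟨ cong suc (*-suc 29 ℓ) ⟩
      30 + 29 * ℓ            ≡⟨ +-comm 30 (29 * ℓ) ⟩
      29 * ℓ + 30            ≤⟨ +-monoʳ-≤ (29 * ℓ) (≤-trans (m≤m+n 30 28) (*-monoʳ-≤ 29 (≤-trans (m≤m+n 2 18) (≤-trans 20≤L L≤ℓ)))) ⟩
      29 * ℓ + 29 * ℓ        ≡⟨ *-distribʳ-+ ℓ 29 29 ⟨
      58 * ℓ                 ≡⟨ 1+J ⟨
      suc J                  ∎)
    n≤ : n * 40 ^ J ≤ 41 ^ J
    n≤ = let r , J≡ = m≤n⇒∃[o]m+o≡n J≥ in subst (λ J → n * 40 ^ J ≤ 41 ^ J) J≡ (begin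
      n * 40 ^ (29 * suc ℓ + r)               ≡⟨ cong (n *_) (^-distribˡ-+-* 40 (29 * suc ℓ) r) ⟩
      n * (40 ^ (29 * suc ℓ) * 40 ^ r)        ≡⟨ *-assoc n _ _ ⟨
      n * 40 ^ (29 * suc ℓ) * 40 ^ r          ≤⟨ *-mono-≤ (*-monoˡ-≤ _ (<⇒≤ (n<2^[1+log] n))) (^-monoˡ-≤ r (n≤1+n 40)) ⟩
      2 ^ suc ℓ * 40 ^ (29 * suc ℓ) * 41 ^ r  ≤⟨ *-monoˡ-≤ (41 ^ r) (2^*p^≤r^ 40 41 29 (≤ᵇ⇒≤ (2 * 40 ^ 29) (41 ^ 29) tt) (suc ℓ)) ⟩
      41 ^ (29 * suc ℓ) * 41 ^ r              ≡⟨ ^-distribˡ-+-* 41 (29 * suc ℓ) r ⟨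
      41 ^ (29 * suc ℓ + r)                   ∎)

-- Rational probabilities

toℚᵘ-/ : ∀ k D .{{_ : NonZero D}} → toℚᵘ (pos k ℚ./ D) ℚᵘ.≃ (pos k ℚᵘ./ D)
toℚᵘ-/ k (suc D) = ℚ.toℚᵘ-fromℚᵘ (mkℚᵘ (pos k) D)

toℚᵘ-fromℕ : ∀ k → toℚᵘ (fromℕ k) ℚᵘ.≃ mkℚᵘ (pos k) 0
toℚᵘ-fromℕ k = toℚᵘ-/ k 1

fromℕ-* : ∀ a b → fromℕ (a * b) ≡ fromℕ a ℚ.* fromℕ b
fromℕ-* a b = ℚ.toℚᵘ-injective (begin
  toℚᵘ (fromℕ (a * b))                 ≈⟨ toℚᵘ-fromℕ (a * b) ⟩
  mkℚᵘ (pos (a * b)) 0                   ≈⟨ *≡* (cong (ℤ._* pos 1) (ℤ.pos-* a b)) ⟩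
  mkℚᵘ (pos a) 0 ℚᵘ.* mkℚᵘ (pos b) 0         ≈⟨ ℚᵘ.*-cong (toℚᵘ-fromℕ a) (toℚᵘ-fromℕ b) ⟨
  toℚᵘ (fromℕ a) ℚᵘ.* toℚᵘ (fromℕ b)     ≈⟨ ℚ.toℚᵘ-homo-* (fromℕ a) (fromℕ b) ⟨
  toℚᵘ (fromℕ a ℚ.* fromℕ b)             ∎)
  where open ℚᵘ.≃-Reasoning

fromℕ-+ : ∀ a b → fromℕ (a + b) ≡ fromℕ a ℚ.+ fromℕ b
fromℕ-+ a b = ℚ.toℚᵘ-injective (begin
  toℚᵘ (fromℕ (a + b))                 ≈⟨ toℚᵘ-fromℕ (a + b) ⟩
  mkℚᵘ (pos (a + b)) 0                   ≈⟨ *≡* (cong (ℤ._* pos 1) (cong₂ ℤ._+_ (sym (ℤ.*-identityʳ (pos a))) (sym (ℤ.*-identityʳ (pos b))))) ⟩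
  mkℚᵘ (pos a) 0 ℚᵘ.+ mkℚᵘ (pos b) 0         ≈⟨ ℚᵘ.+-cong (toℚᵘ-fromℕ a) (toℚᵘ-fromℕ b) ⟨
  toℚᵘ (fromℕ a) ℚᵘ.+ toℚᵘ (fromℕ b)     ≈⟨ ℚ.toℚᵘ-homo-+ (fromℕ a) (fromℕ b) ⟨
  toℚᵘ (fromℕ a ℚ.+ fromℕ b)             ∎)
  where open ℚᵘ.≃-Reasoning

fromℕ-mono-≤ : ∀ {a b} → a ≤ b → fromℕ a ℚ.≤ fromℕ b
fromℕ-mono-≤ {a} {b} a≤b = ℚ.toℚᵘ-cancel-≤ (begin
  toℚᵘ (fromℕ a)    ≃⟨ toℚᵘ-fromℕ a ⟩
  mkℚᵘ (pos a) 0      ≤⟨ *≤* (ℤ.*-monoʳ-≤-nonNeg (pos 1) (+≤+ a≤b)) ⟩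
  mkℚᵘ (pos b) 0      ≃⟨ toℚᵘ-fromℕ b ⟨
  toℚᵘ (fromℕ b)    ∎)
  where open ℚᵘ.≤-Reasoning

fromℕ-cancel-≤ : ∀ {a b} → fromℕ a ℚ.≤ fromℕ b → a ≤ b
fromℕ-cancel-≤ {a} {b} a≤b = ℤ.drop‿+≤+ (ℤ.*-cancelʳ-≤-pos (pos a) (pos b) (pos 1) (ℚᵘ.drop-*≤* (begin
  mkℚᵘ (pos a) 0      ≃⟨ toℚᵘ-fromℕ a ⟨
  toℚᵘ (fromℕ a)    ≤⟨ ℚ.toℚᵘ-mono-≤ a≤b ⟩
  toℚᵘ (fromℕ b)    ≃⟨ toℚᵘ-fromℕ b ⟩
  mkℚᵘ (pos b) 0      ∎)))
  where open ℚᵘ.≤-Reasoning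

fromℕ-cancel-< : ∀ {a b} → fromℕ a ℚ.< fromℕ b → a < b
fromℕ-cancel-< a<b = ≰⇒> λ b≤a → ℚ.<-irrefl refl (ℚ.<-≤-trans a<b (fromℕ-mono-≤ b≤a))

fromℕ-positive : ∀ k .{{_ : NonZero k}} → ℚ.Positive (fromℕ k)
fromℕ-positive k@(suc _) = ℚ.positive (ℚ.<-≤-trans (ℚ.positive⁻¹ 1ℚ) (fromℕ-mono-≤ {1} {k} (s≤s z≤n)))

/-* : ∀ k D .{{_ : NonZero D}} → (pos k ℚ./ D) ℚ.* fromℕ D ≡ fromℕ k
/-* k D@(suc d) = ℚ.toℚᵘ-injective (begin
  toℚᵘ ((pos k ℚ./ D) ℚ.* fromℕ D)            ≈⟨ ℚ.toℚᵘ-homo-* (pos k ℚ./ D) (fromℕ D) ⟩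
  toℚᵘ (pos k ℚ./ D) ℚᵘ.* toℚᵘ (fromℕ D)      ≈⟨ ℚᵘ.*-cong (toℚᵘ-/ k D) (toℚᵘ-fromℕ D) ⟩
  mkℚᵘ (pos k) d ℚᵘ.* mkℚᵘ (pos D) 0          ≈⟨ *≡* (trans (ℤ.*-identityʳ _) (cong (λ e → pos k ℤ.* pos (suc e)) (sym (*-identityʳ d)))) ⟩
  mkℚᵘ (pos k) 0                            ≈⟨ toℚᵘ-fromℕ k ⟨
  toℚᵘ (fromℕ k)                          ∎)
  where open ℚᵘ.≃-Reasoning

_^ᵠ_ : ℚ → ℕ → ℚ
_^ᵠ_ = _^ᴿ_ ℚ.+-*-rawSemiring

^ᵠ-scale : ∀ p a b v → p ℚ.* fromℕ a ≡ fromℕ b → (p ^ᵠ v) ℚ.* fromℕ (a ^ v) ≡ fromℕ (b ^ v)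
^ᵠ-scale p a b zero    eq = ℚ.*-identityˡ (fromℕ 1)
^ᵠ-scale p a b (suc v) eq = begin
  p ℚ.* (p ^ᵠ v) ℚ.* fromℕ (a * a ^ v)               ≡⟨ cong (p ℚ.* (p ^ᵠ v) ℚ.*_) (fromℕ-* a (a ^ v)) ⟩
  p ℚ.* (p ^ᵠ v) ℚ.* (fromℕ a ℚ.* fromℕ (a ^ v))     ≡⟨ interchange p (p ^ᵠ v) (fromℕ a) (fromℕ (a ^ v)) ⟩
  p ℚ.* fromℕ a ℚ.* ((p ^ᵠ v) ℚ.* fromℕ (a ^ v))     ≡⟨ cong₂ ℚ._*_ eq (^ᵠ-scale p a b v eq) ⟩
  fromℕ b ℚ.* fromℕ (b ^ v)                          ≡⟨ fromℕ-* b (b ^ v) ⟨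
  fromℕ (b * b ^ v)                                  ∎
  where
  open ≡-Reasoning
  interchange : ∀ p q a b → p ℚ.* q ℚ.* (a ℚ.* b) ≡ p ℚ.* a ℚ.* (q ℚ.* b)
  interchange = +-*-Solver.solve 4 (λ p q a b → p :* q :* (a :* b) := p :* a :* (q :* b)) refl
    where open +-*-Solver

-- Built in lowest terms, so that the numerator 1 and the denominator `v`, which `_≥1-_^-_` reads
-- off, are available by computation.
1/ⁿ_ : (v : ℕ) → .{{NonZero v}} → ℚ
1/ⁿ (suc v) = mkℚ (pos 1) v (1-coprimeTo (suc v))

1/ⁿ-positive : ∀ v .{{_ : NonZero v}} → 0ℚ ℚ.< (1/ⁿ v)
1/ⁿ-positive (suc v) = ℚ.positive⁻¹ (1/ⁿ (suc v))

complement-≥1-^- : ∀ h m D n v .{{_ : NonZero D}} .{{_ : NonZero v}} → h + m ≡ D → m ^ v * n ≤ D ^ v →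
                   (pos h ℚ./ D) ≥1- n ^- (1/ⁿ v)
complement-≥1-^- h m D n v@(suc _) h+m≡D m^v≤ = ℚ.*-cancelʳ-≤-pos (fromℕ (D ^ v)) (begin
  (r ^ᵠ v) ℚ.* fromℕ (n ^ 1) ℚ.* fromℕ (D ^ v)      ≡⟨ swap (r ^ᵠ v) (fromℕ (n ^ 1)) (fromℕ (D ^ v)) ⟩
  (r ^ᵠ v) ℚ.* fromℕ (D ^ v) ℚ.* fromℕ (n ^ 1)      ≡⟨ cong₂ (λ a b → a ℚ.* fromℕ b) (^ᵠ-scale r D m v r*D) (^-identityʳ n) ⟩
  fromℕ (m ^ v) ℚ.* fromℕ n                         ≡⟨ fromℕ-* (m ^ v) n ⟨
  fromℕ (m ^ v * n)                                 ≤⟨ fromℕ-mono-≤ m^v≤ ⟩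
  fromℕ (D ^ v)                                     ≡⟨ ℚ.*-identityˡ (fromℕ (D ^ v)) ⟨
  1ℚ ℚ.* fromℕ (D ^ v)                              ∎)
  where
  open ℚ.≤-Reasoning
  instance _ = fromℕ-positive (D ^ v) {{m^n≢0 D v}}
  r = 1ℚ ℚ.- (pos h ℚ./ D)
  swap : ∀ p q r → p ℚ.* q ℚ.* r ≡ p ℚ.* r ℚ.* q
  swap = +-*-Solver.solve 3 (λ p q r → p :* q :* r := p :* r :* q) refl
    where open +-*-Solver
  r*D : r ℚ.* fromℕ D ≡ fromℕ m
  r*D = begin-equality
    (1ℚ ℚ.- (pos h ℚ./ D)) ℚ.* fromℕ D             ≡⟨ expand (pos h ℚ./ D) (fromℕ D) ⟩
    fromℕ D ℚ.- (pos h ℚ./ D) ℚ.* fromℕ D          ≡⟨ cong₂ ℚ._-_ (trans (cong fromℕ (sym h+m≡D)) (fromℕ-+ h m)) (/-* h D) ⟩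
    fromℕ h ℚ.+ fromℕ m ℚ.- fromℕ h              ≡⟨ cancel (fromℕ h) (fromℕ m) ⟩
    fromℕ m                                      ∎
    where
    expand : ∀ p d → (1ℚ ℚ.- p) ℚ.* d ≡ d ℚ.- p ℚ.* d
    expand = +-*-Solver.solve 2 (λ p d → (con 1ℚ :- p) :* d := d :- p :* d) refl
      where open +-*-Solver
    cancel : ∀ p d → p ℚ.+ d ℚ.- p ≡ d
    cancel = +-*-Solver.solve 2 (λ p d → p :+ d :- p := d) refl
      where open +-*-Solver

-- In the `v`-th power of the first hypothesis, the factor 2^(Lv) pays for 8^v = 2^(3v) and for n ≤
-- 2^l. The 8 is a power of two above the constant 6 of the convergence bound.
scaled-≤ : ∀ m L l v n Ω → m * 2 ^ L ≤ 8 * Ω → n ≤ 2 ^ l → 3 * v + l ≤ L * v → m ^ v * n ≤ Ω ^ v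
scaled-≤ m L l v n Ω m≤ n≤ exps = *-cancelʳ-≤ _ _ (8 ^ v) {{m^n≢0 8 v}} (begin
  m ^ v * n * 8 ^ v              ≤⟨ *-monoˡ-≤ (8 ^ v) (*-monoʳ-≤ (m ^ v) n≤) ⟩
  m ^ v * 2 ^ l * 8 ^ v          ≡⟨ cong (m ^ v * 2 ^ l *_) (^-*-assoc 2 3 v) ⟩
  m ^ v * 2 ^ l * 2 ^ (3 * v)    ≡⟨ xy∙z≈x∙zy (m ^ v) (2 ^ l) (2 ^ (3 * v)) ⟩
  m ^ v * (2 ^ (3 * v) * 2 ^ l)  ≡⟨ cong (m ^ v *_) (^-distribˡ-+-* 2 (3 * v) l) ⟨
  m ^ v * 2 ^ (3 * v + l)        ≤⟨ *-monoʳ-≤ (m ^ v) (^-monoʳ-≤ 2 exps) ⟩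
  m ^ v * 2 ^ (L * v)            ≡⟨ cong (m ^ v *_) (^-*-assoc 2 L v) ⟨
  m ^ v * (2 ^ L) ^ v            ≡⟨ [m*n]^o≡m^o*n^o m (2 ^ L) v ⟨
  (m * 2 ^ L) ^ v                ≤⟨ ^-monoˡ-≤ v m≤ ⟩
  (8 * Ω) ^ v                    ≡⟨ [m*n]^o≡m^o*n^o 8 Ω v ⟩
  8 ^ v * Ω ^ v                  ≡⟨ *-comm (8 ^ v) (Ω ^ v) ⟩
  Ω ^ v * 8 ^ v                  ∎)
  where open ≤-Reasoning

-- A positive rational is at least one over its denominator, so only the denominator of γ has to be
-- kept.
√-≤⇒ : ∀ γ k m → 0ℚ ℚ.< γ → γ √ k ≤ m → k ≤ ↧ₙ γ * ↧ₙ γ * (m * m)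
√-≤⇒ γ k m 0<γ γ√k≤m = numerator γ (ℚ.positive 0<γ) refl
  where
  d = ↧ₙ γ
  numerator : ∀ γ′ → ℚ.Positive γ′ → γ′ ≡ γ → k ≤ d * d * (m * m)
  numerator (mkℚ +[1+ u ] _ _) _ refl = ≤-trans (m≤n*m k (suc u * suc u)) (fromℕ-cancel-≤ (begin
    fromℕ (suc u * suc u * k)
      ≡⟨ trans (fromℕ-* (suc u * suc u) k) (cong (ℚ._* fromℕ k) (fromℕ-* (suc u) (suc u))) ⟩
    fromℕ (suc u) ℚ.* fromℕ (suc u) ℚ.* fromℕ k
      ≡⟨ cong (λ t → t ℚ.* t ℚ.* fromℕ k) γ*d ⟨
    γ ℚ.* fromℕ d ℚ.* (γ ℚ.* fromℕ d) ℚ.* fromℕ k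
      ≡⟨ regroup γ (fromℕ d) (fromℕ k) ⟩
    fromℕ d ℚ.* fromℕ d ℚ.* (γ ℚ.* γ ℚ.* fromℕ k)
      ≡⟨ cong (ℚ._* (γ ℚ.* γ ℚ.* fromℕ k)) (fromℕ-* d d) ⟨
    fromℕ (d * d) ℚ.* (γ ℚ.* γ ℚ.* fromℕ k)
      ≤⟨ ℚ.*-monoˡ-≤-nonNeg (fromℕ (d * d)) {{ℚ.pos⇒nonNeg (fromℕ (d * d)) {{fromℕ-positive (d * d)}}}} γ√k≤m ⟩
    fromℕ (d * d) ℚ.* fromℕ (m * m)
      ≡⟨ fromℕ-* (d * d) (m * m) ⟨
    fromℕ (d * d * (m * m)) ∎))
    where
    open ℚ.≤-Reasoning
    γ*d : γ ℚ.* fromℕ d ≡ fromℕ (suc u)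
    γ*d = trans (cong (ℚ._* fromℕ d) (sym (ℚ.↥p/↧p≡p γ))) (/-* (suc u) d)
    regroup : ∀ g d k → g ℚ.* d ℚ.* (g ℚ.* d) ℚ.* k ≡ d ℚ.* d ℚ.* (g ℚ.* g ℚ.* k)
    regroup = +-*-Solver.solve 3 (λ g d k → g :* d :* (g :* d) :* k := d :* d :* (g :* g :* k)) refl
      where open +-*-Solver

∣s∣≡ : ∀ c (x : Config n) σ → support c x ≡ support (other c) x + σ → ∣s∣ x ≡ σ
∣s∣≡ c x σ a≡ = trans (cong ℤ.∣_∣ (ℤ.m-n≡m⊖n (support Alpha x) (support Beta x))) (oriented c a≡)
  where
  ⊖≡ : ∀ a b → a ≡ b + σ → ℤ.∣ a ℤ.⊖ b ∣ ≡ σ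
  ⊖≡ .(b + σ) b refl = trans (cong ℤ.∣_∣ (ℤ.⊖-≥ (m≤m+n b σ))) (m+n∸m≡n b σ)
  oriented : ∀ c → support c x ≡ support (other c) x + σ → ℤ.∣ support Alpha x ℤ.⊖ support Beta x ∣ ≡ σ
  oriented Alpha a≡ = ⊖≡ (support Alpha x) (support Beta x) a≡
  oriented Beta  b≡ = trans (ℤ.∣m⊖n∣≡∣n⊖m∣ (support Alpha x) (support Beta x)) (⊖≡ (support Beta x) (support Alpha x) b≡)

-- Convergence to the majority with high probability

level-bound : ∃[ V ] NonZero V × ∀ n L → 2 * level n L ≤ V * (L * n)
level-bound = 8 * (2 * 6440 + 1) , _ , λ n L → ≤-reflexive (go (2 * 6440 + 1) n L (trans
  (cong₂ _+_ (sym (*-assoc 2 6440 n)) (sym (*-identityˡ n))) (sym (*-distribʳ-+ n (2 * 6440) 1))))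
  where
  lemma : ∀ L w n → 2 * (4 * (L * (w * n))) ≡ 8 * w * (L * n)
  lemma = solve-∀
  go : ∀ w n L → 2 * (6440 * n) + n ≡ w * n → 2 * level n L ≡ 8 * w * (L * n)
  go w n L eq = trans (cong (λ t → 2 * (4 * (L * t))) eq) (lemma L w n)

majority-reached-whp : ∃[ C ] ∃[ K ] Convergence C K →
  (γ : ℚ) → 0ℚ ℚ.< γ →
  ∃[ C ] ∃[ c ] 0ℚ ℚ.< c × ∃[ N ]
    ((n : ℕ) .{{_ : NonZero n}} → N ≤ n →
     (x : Config n) → γ √ (n * log n) ≤ ∣s∣ x →
     (maj : Color) → Majority maj x →
     ℙ (reachesWithin? (monochromatic? maj) x (C * log n)) ≥1- n ^- c)
majority-reached-whp (C , K , converges) γ 0<γ = go level-bound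
  where
  d = ↧ₙ γ
  go : ∃[ V ] NonZero V × (∀ n L → 2 * level n L ≤ V * (L * n)) → _
  go (V , V≢0 , level≤) = C , 1/ⁿ v , 1/ⁿ-positive v , 2 ^ (K + 20 * Z) , whp
    where
    instance
      _ = V≢0
      _ = m*n≢0 d d
    -- A bias with d² σ² ≥ n log n affords an `L` of about log n / Z, hence a failure probability of
    -- about n^(-1/Z). The claimed exponent 1/v is half of 1/Z, which absorbs the constant factor
    -- and the rounding of `L`.
    Z = V * (d * d)
    instance
      _ = m*n≢0 V (d * d)
    v = 2 * Z
    instance
      v≢0 : NonZero v
      v≢0 = m*n≢0 2 Z
    whp : (n : ℕ) .{{_ : NonZero n}} → 2 ^ (K + 20 * Z) ≤ n →
      (x : Config n) → γ √ (n * log n) ≤ ∣s∣ x → (maj : Color) → Majority maj x →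
      ℙ (reachesWithin? (monochromatic? maj) x (C * log n)) ≥1- n ^- (1/ⁿ v)
    whp n N≤n x γ≤ maj b<a = complement-≥1-^- (length (List.filter R? (outcomes n (C * ℓ)))) m (#Ω n (C * ℓ)) n v
        {{m^n≢0 (n ^ n) (C * ℓ) {{m^n≢0 n n}}}}
        (trans (cong (_+ m) (length-filter R? (outcomes n (C * ℓ)))) (hits+misses (monochromatic? maj) (C * ℓ) x))
        (scaled-≤ m L (suc ℓ) v n (#Ω n (C * ℓ))
          (≤-trans (converges maj n x σ L (m+n≤o⇒m≤o K K+20Z≤ℓ) 20≤L L≤ℓ a≡ strong) (*-monoˡ-≤ (#Ω n (C * ℓ)) (m≤m+n 6 2)))
          (<⇒≤ (n<2^[1+log] n))
          exponents)
      where
      open ≤-Reasoning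
      ℓ = log n
      R? = reachesWithin? (monochromatic? maj) x (C * ℓ)
      m = misses (monochromatic? maj) (C * ℓ) x
      L = ℓ ℕ./ Z
      σ = support maj x ∸ support (other maj) x
      a≡ : support maj x ≡ support (other maj) x + σ
      a≡ = sym (m+[n∸m]≡n (<⇒≤ b<a))
      K+20Z≤ℓ : K + 20 * Z ≤ ℓ
      K+20Z≤ℓ = log≥ (K + 20 * Z) n N≤n
      20≤L : 20 ≤ L
      20≤L = subst (_≤ L) (m*n/n≡m 20 Z) (/-monoˡ-≤ Z (m+n≤o⇒n≤o K K+20Z≤ℓ))
      L≤ℓ : L ≤ ℓ
      L≤ℓ = m/n≤m ℓ Z
      LZ≤ℓ : L * Z ≤ ℓ
      LZ≤ℓ = m/n*n≤m ℓ Z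
      ℓ<Z+LZ : ℓ < Z + L * Z
      ℓ<Z+LZ = ≤-trans (s≤s (≤-reflexive (m≡m%n+[m/n]*n ℓ Z))) (+-monoˡ-≤ (L * Z) (m%n<n ℓ Z))
      exponents : 3 * v + suc ℓ ≤ L * v
      exponents = begin
        3 * (2 * Z) + suc ℓ          ≤⟨ +-monoʳ-≤ (3 * (2 * Z)) ℓ<Z+LZ ⟩
        3 * (2 * Z) + (Z + L * Z)    ≤⟨ ≤-cert-slack (13 * Z) (*-monoˡ-≤ Z 20≤L) (lemma L Z) ⟩
        L * (2 * Z)                  ∎
        where
        lemma : ∀ L Z → L * (2 * Z) + 20 * Z ≡ 3 * (2 * Z) + (Z + L * Z) + L * Z + 13 * Z
        lemma = solve-∀
      strong : 2 * level n L ≤ σ * σ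
      strong = ≤-trans (level≤ n L) (*-cancelʳ-≤ _ _ (d * d) (begin
        V * (L * n) * (d * d)   ≡⟨ lemma V L n (d * d) ⟩
        n * (L * (V * (d * d))) ≤⟨ *-monoʳ-≤ n LZ≤ℓ ⟩
        n * ℓ                   ≤⟨ √-≤⇒ γ (n * ℓ) σ 0<γ (subst (γ √ (n * ℓ) ≤_) (∣s∣≡ maj x σ a≡) γ≤) ⟩
        d * d * (σ * σ)         ≡⟨ *-comm (d * d) (σ * σ) ⟩
        σ * σ * (d * d)         ∎))
        where
        lemma : ∀ V L n e → V * (L * n) * e ≡ n * (L * (V * e))
        lemma = solve-∀

-- Configurations with given counts, and the process without Beta nodes

config : ∀ a b u → ∃[ x ] support {a + b + u} Alpha x ≡ a × support Beta x ≡ b × q x ≡ u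
config (suc a) b       u       = let x , ≡a , ≡b , ≡u = config a b u in colored Alpha ∷ x , cong suc ≡a , ≡b , ≡u
config zero    (suc b) u       = let x , ≡a , ≡b , ≡u = config zero b u in colored Beta ∷ x , ≡a , cong suc ≡b , ≡u
config zero    zero    (suc u) = let x , ≡a , ≡b , ≡u = config zero zero u in undecided ∷ x , ≡a , ≡b , cong suc ≡u
config zero    zero    zero    = [] , refl , refl , refl

no-Beta : ∀ {k} (x : Config k) → support Beta x ≡ 0 → ∀ i → lookup x i ≢ colored Beta
no-Beta (colored Alpha ∷ x) b≡0 (Fin.suc i) = no-Beta x b≡0 i
no-Beta (colored Beta ∷ x)  ()
no-Beta (undecided ∷ x)     b≡0 (Fin.suc i) = no-Beta x b≡0 i
no-Beta (colored Alpha ∷ x) b≡0 Fin.zero    ()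
no-Beta (undecided ∷ x)     b≡0 Fin.zero    ()

module _ (x : Config n) (b≡0 : support Beta x ≡ 0) where

  private
    observed : ∀ {k} → Vec (Fin n) k → Vec State k
    observed = Vec.map (lookup x)

  Beta-absent : ∀ {k} (y : Config k) f → support Beta y ≡ 0 → support Beta (zipWith update y (observed f)) ≡ 0
  Beta-absent []                  []      _ = refl
  Beta-absent (colored Beta ∷ y)  (i ∷ f) ()
  Beta-absent (colored Alpha ∷ y) (i ∷ f) e with lookup x i in eq
  ... | colored Alpha = Beta-absent y f e
  ... | colored Beta  = contradiction eq (no-Beta x b≡0 i)
  ... | undecided     = Beta-absent y f e
  Beta-absent (undecided ∷ y)     (i ∷ f) e with lookup x i in eq
  ... | colored Alpha = Beta-absent y f e
  ... | colored Beta  = contradiction eq (no-Beta x b≡0 i)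
  ... | undecided     = Beta-absent y f e

  Alpha-kept : ∀ {k} (y : Config k) f → support Alpha y ≤ support Alpha (zipWith update y (observed f))
  Alpha-kept []                  []      = z≤n
  Alpha-kept (colored Beta ∷ y)  (i ∷ f) with lookup x i
  ... | colored Alpha = Alpha-kept y f
  ... | colored Beta  = Alpha-kept y f
  ... | undecided     = Alpha-kept y f
  Alpha-kept (colored Alpha ∷ y) (i ∷ f) with lookup x i in eq
  ... | colored Alpha = s≤s (Alpha-kept y f)
  ... | colored Beta  = contradiction eq (no-Beta x b≡0 i)
  ... | undecided     = s≤s (Alpha-kept y f)
  Alpha-kept (undecided ∷ y)     (i ∷ f) with lookup x i
  ... | colored Alpha = m≤n⇒m≤1+n (Alpha-kept y f)
  ... | colored Beta  = Alpha-kept y f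
  ... | undecided     = Alpha-kept y f

-- The expected new count is a (a + 2u)/n, and a + 2u ≤ 2n.
Alpha-doubles : ∀ {n} .{{_ : NonZero n}} (x : Config n) →
  ∑ (choices n) (λ f → support Alpha (step x f)) ≤ n ^ n * (2 * support Alpha x)
Alpha-doubles {n} x = *-cancelˡ-≤ n (begin
  n * ∑ (choices n) (λ f → support Alpha (step x f))
    ≡⟨ cong (n *_) (∑-cong (choices n) (λ f → lemma₁ (support Alpha (step x f)) (support Beta (step x f)) (q (step x f)))) ⟩
  n * ∑ (choices n) (λ f → 1 * support Alpha (step x f) + 0 * support Beta (step x f) + 0 * q (step x f))
    ≡⟨ ∑-step-weigh Alpha 1 0 0 x ⟩
  n ^ n * mean 1 1 1 1 0 0 a b u
    ≤⟨ *-monoʳ-≤ (n ^ n) (subst (λ m → mean 1 1 1 1 0 0 a b u ≤ 2 * a * m) (support-total Alpha x)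
         (≤-cert-slack (a * a + 2 * a * b) (z≤n {0}) (lemma₂ a b u))) ⟩
  n ^ n * (2 * a * n)
    ≡⟨ lemma₃ (n ^ n) a n ⟩
  n * (n ^ n * (2 * a)) ∎)
  where
  open ≤-Reasoning
  a = support Alpha x
  b = support Beta x
  u = q x
  lemma₁ : ∀ a b u → a ≡ 1 * a + 0 * b + 0 * u
  lemma₁ = solve-∀
  lemma₂ : ∀ a b u → 2 * a * (a + b + u) + 0 ≡
    (1 * 1 * a + 1 * 0 * b + 1 * 1 * u) * a + (1 * 0 * a + 1 * 0 * b + 1 * 0 * u) * b +
    (1 * 1 * a + 1 * 0 * b + 1 * 0 * u) * u + 0 + (a * a + 2 * a * b)
  lemma₂ = solve-∀
  lemma₃ : ∀ N a n → N * (2 * a * n) ≡ n * (N * (2 * a))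
  lemma₃ = solve-∀

-- Alpha nodes persist when Beta is absent, so absorption can only mean a = n. This is Markov's
-- inequality for the number of Alpha nodes at the time of absorption, whose expectation has grown
-- at most by the factor `2 ^ T`.
hits-absorbing : ∀ {n} .{{_ : NonZero n}} T (x : Config n) → support Beta x ≡ 0 → 1 ≤ support Alpha x →
  hits absorbing? T x * n ≤ support Alpha x * 2 ^ T * #Ω n T
hits-absorbing {n} T x b≡0 1≤a with absorbing? x
... | yes (inj₁ u≡n) = contradiction (support-total Alpha x) (<⇒≢ (≤-trans (s≤s (≤-reflexive (sym u≡n)))
        (+-monoˡ-≤ (q x) (≤-trans 1≤a (m≤m+n _ _)))) ∘ sym)
... | yes (inj₂ (inj₂ b≡n)) = contradiction (trans (sym b≡n) b≡0) (≢-nonZero⁻¹ n)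
... | yes (inj₂ (inj₁ a≡n)) = begin
  hits absorbing? T x * n             ≤⟨ *-monoˡ-≤ n (hits≤#Ω absorbing? T x) ⟩
  #Ω n T * n                          ≡⟨ cong (#Ω n T *_) a≡n ⟨
  #Ω n T * support Alpha x            ≤⟨ *-monoʳ-≤ (#Ω n T) (m≤m*n (support Alpha x) (2 ^ T) {{m^n≢0 2 T}}) ⟩
  #Ω n T * (support Alpha x * 2 ^ T)  ≡⟨ *-comm (#Ω n T) _ ⟩
  support Alpha x * 2 ^ T * #Ω n T    ∎
  where open ≤-Reasoning
hits-absorbing {n} zero    x b≡0 1≤a | no ¬abs = ≤-trans (≤-reflexive (cong (_* n) (hits-0 absorbing? x ¬abs))) z≤n
hits-absorbing {n} (suc T) x b≡0 1≤a | no ¬abs = begin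
  hits absorbing? (suc T) x * n
    ≤⟨ *-monoˡ-≤ n (hits-suc absorbing? T x ¬abs) ⟩
  ∑ (choices n) (λ f → hits absorbing? T (step x f)) * n
    ≡⟨ ∑-*ʳ n (λ f → hits absorbing? T (step x f)) (choices n) ⟨
  ∑ (choices n) (λ f → hits absorbing? T (step x f) * n)
    ≤⟨ ∑-mono (choices n) (λ f → hits-absorbing T (step x f) (Beta-absent x b≡0 x f b≡0)
                                   (≤-trans 1≤a (Alpha-kept x b≡0 x f))) ⟩
  ∑ (choices n) (λ f → support Alpha (step x f) * 2 ^ T * #Ω n T)
    ≡⟨ trans (∑-*ʳ (#Ω n T) (λ f → support Alpha (step x f) * 2 ^ T) (choices n))
             (cong (_* #Ω n T) (∑-*ʳ (2 ^ T) (λ f → support Alpha (step x f)) (choices n))) ⟩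
  ∑ (choices n) (λ f → support Alpha (step x f)) * 2 ^ T * #Ω n T
    ≤⟨ *-monoˡ-≤ (#Ω n T) (*-monoˡ-≤ (2 ^ T) (Alpha-doubles x)) ⟩
  n ^ n * (2 * support Alpha x) * 2 ^ T * #Ω n T
    ≡⟨ lemma (n ^ n) (support Alpha x) (2 ^ T) (#Ω n T) ⟩
  support Alpha x * 2 ^ suc T * #Ω n (suc T) ∎
  where
  open ≤-Reasoning
  lemma : ∀ N a t Ω → N * (2 * a) * t * Ω ≡ a * (2 * t) * (N * Ω)
  lemma = solve-∀

-- A slow start

configOf : ∀ n a b u → a + b + u ≡ n → ∃[ x ] support {n} Alpha x ≡ a × support Beta x ≡ b × q x ≡ u
configOf .(a + b + u) a b u refl = config a b u

-- A bias of order √(n log n) without Beta nodes: each round at most doubles the expected number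
-- of Alpha nodes, so that after w/2 rounds, for w = ⌊log n / 4⌋, it is still small compared to n.
lower-bound-rounds : ∃[ δ ] 0ℚ ℚ.< δ × ∃[ κ ] 0ℚ ℚ.< κ × ∃[ c ] 0ℚ ℚ.< c × ∃[ N ]
  ((n : ℕ) .{{_ : NonZero n}} → N ≤ n →
   ∃[ x ] δ √ (n * log n) ≤ ∣s∣ {n} x ×
     ((T : ℕ) → fromℕ T ℚ.< κ ℚ.* fromℕ (log n) →
      ℙ (¬? ∘ reachesWithin? absorbing? x T) ≥1- n ^- c))
lower-bound-rounds = 1ℚ , ℚ.positive⁻¹ 1ℚ , κ , ℚ.positive⁻¹ κ , 1/ⁿ 16 , 1/ⁿ-positive 16 , 2 ^ 52 , start
  where
  κ : ℚ
  κ = pos 1 ℚ./ 8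
  start : (n : ℕ) .{{_ : NonZero n}} → 2 ^ 52 ≤ n →
    ∃[ x ] 1ℚ √ (n * log n) ≤ ∣s∣ {n} x ×
      ((T : ℕ) → fromℕ T ℚ.< κ ℚ.* fromℕ (log n) →
       ℙ (¬? ∘ reachesWithin? absorbing? x T) ≥1- n ^- (1/ⁿ 16))
  start n N≤n = x , biased , slow
    where
    open ≤-Reasoning
    ℓ w r j : ℕ
    ℓ = log n
    w = ℓ ℕ./ 4
    r = ℓ % 4
    -- The start has `2 ^ j` Alpha nodes, about n^(3/4): this exceeds √(n log n), and it stays below
    -- n by a factor `2 ^ w`, of which w/2 doublings consume only the square root.
    j = 3 * w + r
    ℓ≡w+j : ℓ ≡ w + j
    ℓ≡w+j = trans (m≡m%n+[m/n]*n ℓ 4) (lemma r w)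
      where
      lemma : ∀ r w → r + w * 4 ≡ w + (3 * w + r)
      lemma = solve-∀
    ℓ<4[1+w] : ℓ < 4 * suc w
    ℓ<4[1+w] = ≤-trans (s≤s (≤-reflexive (m≡m%n+[m/n]*n ℓ 4)))
      (≤-trans (+-monoˡ-≤ (w * 4) (m%n<n ℓ 4)) (≤-reflexive (*-comm (suc w) 4)))
    -- 13 is the least `w` with 3 · 16 + 4 (1 + w) + 8w ≤ 16w, the requirement of the exponent 1/16
    -- after at most w/2 rounds; it explains 52 = 4 · 13.
    13≤w : 13 ≤ w
    13≤w = /-monoˡ-≤ 4 (log≥ 52 n N≤n)
    2^j≤n : 2 ^ j ≤ n
    2^j≤n = ≤-trans (^-monoʳ-≤ 2 (≤-trans (m≤n+m j w) (≤-reflexive (sym ℓ≡w+j)))) (2^log≤n n)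
    initial : ∃[ x ] support {n} Alpha x ≡ 2 ^ j × support Beta x ≡ 0 × q x ≡ n ∸ 2 ^ j
    initial = configOf n (2 ^ j) 0 (n ∸ 2 ^ j) (trans (cong (_+ (n ∸ 2 ^ j)) (+-identityʳ (2 ^ j))) (m+[n∸m]≡n 2^j≤n))
    x = proj₁ initial
    a≡ : support Alpha x ≡ 2 ^ j
    a≡ = proj₁ (proj₂ initial)
    b≡0 : support Beta x ≡ 0
    b≡0 = proj₁ (proj₂ (proj₂ initial))
    nℓ≤ : n * ℓ ≤ 2 ^ j * 2 ^ j
    nℓ≤ = begin
      n * ℓ                       ≤⟨ *-mono-≤ (<⇒≤ (n<2^[1+log] n)) (≤-trans (<⇒≤ ℓ<4[1+w]) (*-monoʳ-≤ 4 (n<2^n w))) ⟩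
      2 ^ suc ℓ * (4 * 2 ^ w)     ≡⟨ cong (2 ^ suc ℓ *_) (^-distribˡ-+-* 2 2 w) ⟨
      2 ^ suc ℓ * 2 ^ (2 + w)     ≡⟨ ^-distribˡ-+-* 2 (suc ℓ) (2 + w) ⟨
      2 ^ (suc ℓ + (2 + w))       ≤⟨ ^-monoʳ-≤ 2 exponent ⟩
      2 ^ (j + j)                 ≡⟨ ^-distribˡ-+-* 2 j j ⟩
      2 ^ j * 2 ^ j               ∎
      where
      exponent : suc ℓ + (2 + w) ≤ j + j
      exponent = begin
        suc ℓ + (2 + w)        ≡⟨ cong (λ e → suc e + (2 + w)) ℓ≡w+j ⟩
        suc (w + j) + (2 + w)  ≤⟨ ≤-cert-slack (10 + r) 13≤w (lemma w r) ⟩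
        j + j                  ∎
        where
        lemma : ∀ w r → 3 * w + r + (3 * w + r) + 13 ≡ 1 + (w + (3 * w + r)) + (2 + w) + w + (10 + r)
        lemma = solve-∀
    biased : 1ℚ √ (n * ℓ) ≤ ∣s∣ x
    biased = ℚ.≤-trans (ℚ.≤-reflexive (trans (cong (ℚ._* fromℕ (n * ℓ)) (ℚ.*-identityˡ 1ℚ)) (ℚ.*-identityˡ (fromℕ (n * ℓ)))))
      (fromℕ-mono-≤ (subst (λ σ → n * ℓ ≤ σ * σ) (sym (∣s∣≡ Alpha x (2 ^ j) (trans a≡ (cong (_+ 2 ^ j) (sym b≡0))))) nℓ≤))
    slow : (T : ℕ) → fromℕ T ℚ.< κ ℚ.* fromℕ ℓ → ℙ (¬? ∘ reachesWithin? absorbing? x T) ≥1- n ^- (1/ⁿ 16)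
    slow T T<κℓ = complement-≥1-^- (length (List.filter (¬? ∘ R?) (outcomes n T))) h (#Ω n T) n 16 {{m^n≢0 (n ^ n) T {{m^n≢0 n n}}}}
      (trans (cong (_+ h) (length-filter (¬? ∘ R?) (outcomes n T))) (trans (+-comm (misses absorbing? T x) h) (hits+misses absorbing? T x)))
      (scaled-≤ h (w ∸ T) (suc ℓ) 16 n (#Ω n T) few (<⇒≤ (n<2^[1+log] n)) exponents)
      where
      R? = reachesWithin? absorbing? x T
      h = hits absorbing? T x
      8T<ℓ : 8 * T < ℓ
      8T<ℓ = fromℕ-cancel-< (subst₂ ℚ._<_ (sym (fromℕ-* 8 T))
        (trans (sym (ℚ.*-assoc (fromℕ 8) κ (fromℕ ℓ)))
          (trans (cong (ℚ._* fromℕ ℓ) (trans (ℚ.*-comm (fromℕ 8) κ) (/-* 1 8))) (ℚ.*-identityˡ (fromℕ ℓ))))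
        (ℚ.*-monoʳ-<-pos (fromℕ 8) {{fromℕ-positive 8}} T<κℓ))
      2T≤w : 2 * T ≤ w
      2T≤w = s≤s⁻¹ (*-cancelˡ-< 4 (2 * T) (suc w) (≤-trans (s≤s (≤-reflexive (sym (*-assoc 4 2 T)))) (≤-trans 8T<ℓ (<⇒≤ ℓ<4[1+w]))))
      T≤w : T ≤ w
      T≤w = ≤-trans (m≤m+n T _) 2T≤w
      few : h * 2 ^ (w ∸ T) ≤ 8 * #Ω n T
      few = ≤-trans (*-cancelʳ-≤ _ _ (2 ^ j * 2 ^ T) {{m*n≢0 _ _ {{m^n≢0 2 j}} {{m^n≢0 2 T}}}} (begin
        h * 2 ^ (w ∸ T) * (2 ^ j * 2 ^ T)
          ≡⟨ lemma h (2 ^ (w ∸ T)) (2 ^ j) (2 ^ T) ⟩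
        h * (2 ^ (w ∸ T) * 2 ^ T * 2 ^ j)
          ≡⟨ cong (λ e → h * (e * 2 ^ j)) (^-distribˡ-+-* 2 (w ∸ T) T) ⟨
        h * (2 ^ (w ∸ T + T) * 2 ^ j)
          ≡⟨ cong (h *_) (^-distribˡ-+-* 2 (w ∸ T + T) j) ⟨
        h * 2 ^ (w ∸ T + T + j)
          ≡⟨ cong (λ e → h * 2 ^ e) (trans (cong (_+ j) (m∸n+n≡m T≤w)) (sym ℓ≡w+j)) ⟩
        h * 2 ^ ℓ
          ≤⟨ *-monoʳ-≤ h (2^log≤n n) ⟩
        h * n
          ≤⟨ hits-absorbing T x b≡0 (≤-trans (m^n>0 2 j) (≤-reflexive (sym a≡))) ⟩
        support Alpha x * 2 ^ T * #Ω n T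
          ≡⟨ cong (λ a → a * 2 ^ T * #Ω n T) a≡ ⟩
        2 ^ j * 2 ^ T * #Ω n T
          ≡⟨ *-comm (2 ^ j * 2 ^ T) (#Ω n T) ⟩
        #Ω n T * (2 ^ j * 2 ^ T) ∎)) (m≤n*m (#Ω n T) 8)
        where
        lemma : ∀ h e a t → h * e * (a * t) ≡ h * (e * t * a)
        lemma = solve-∀
      exponents : 3 * 16 + suc ℓ ≤ (w ∸ T) * 16
      exponents = +-cancelʳ-≤ (T * 16) _ _ (begin
        3 * 16 + suc ℓ + T * 16                ≤⟨ +-monoˡ-≤ (T * 16) (+-monoʳ-≤ (3 * 16) ℓ<4[1+w]) ⟩
        3 * 16 + 4 * suc w + T * 16            ≤⟨ ≤-cert (+-mono-≤ (*-monoʳ-≤ 8 2T≤w) (*-monoʳ-≤ 4 13≤w)) (lemma w T) ⟩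
        w * 16                                 ≡⟨ cong (_* 16) (m∸n+n≡m T≤w) ⟨
        (w ∸ T + T) * 16                       ≡⟨ *-distribʳ-+ 16 (w ∸ T) T ⟩
        (w ∸ T) * 16 + T * 16                  ∎)
        where
        lemma : ∀ w T → w * 16 + (8 * (2 * T) + 4 * 13) ≡ 3 * 16 + 4 * (1 + w) + T * 16 + (8 * w + 4 * w)
        lemma = solve-∀

-- A minority win

isqrt : ∀ n → ∃[ m ] m * m ≤ n × n < suc m * suc m
isqrt zero    = 0 , z≤n , s≤s z≤n
isqrt (suc n) with isqrt n
... | m , m²≤n , n<[1+m]² with suc m * suc m ≤? suc n
...   | yes [1+m]²≤1+n = suc m , [1+m]²≤1+n , ≤-trans (s≤s n<[1+m]²) (*-mono-< (n<1+n (suc m)) (n<1+n (suc m)))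
...   | no  [1+m]²≰1+n = m , m≤n⇒m≤1+n m²≤n , ≰⇒> [1+m]²≰1+n

-- A substitute for (1 + κ/n)^n ≤ e^κ; any bound independent of `n` will do. The numbers 2 (n + κ),
-- taken `n` times, and `n`, taken 2κ times, have mean exactly 2n, and the arithmetic-geometric mean
-- inequality gives 4^κ.
[n+κ]^n≤4^κ*n^n : ∀ n κ → .{{NonZero n}} → (n + κ) ^ n ≤ 4 ^ κ * n ^ n
[n+κ]^n≤4^κ*n^n n κ = *-cancelʳ-≤ _ _ (2 ^ n * n ^ (2 * κ)) {{m*n≢0 _ _ {{m^n≢0 2 n}} {{m^n≢0 n (2 * κ)}}}} (begin
  (n + κ) ^ n * (2 ^ n * n ^ (2 * κ))
    ≡⟨ x∙yz≈yx∙z ((n + κ) ^ n) (2 ^ n) (n ^ (2 * κ)) ⟩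
  2 ^ n * (n + κ) ^ n * n ^ (2 * κ)
    ≡⟨ cong (_* n ^ (2 * κ)) (trans (product-replicate n (2 * (n + κ))) ([m*n]^o≡m^o*n^o 2 (n + κ) n)) ⟨
  List.foldr _*_ 1 (List.replicate n (2 * (n + κ))) * n ^ (2 * κ)
    ≡⟨ *-identityʳ _ ⟨
  List.foldr _*_ 1 (List.replicate n (2 * (n + κ))) * n ^ (2 * κ) * 1
    ≤⟨ am-gm-weighted (List.replicate n (2 * (n + κ))) (2 * κ) n 0 0 (2 * n)
         (subst₂ (λ s m → s + 2 * κ * n + 0 ≤ (m + 2 * κ + 0) * (2 * n))
           (sym (sum-replicate n (2 * (n + κ)))) (sym (length-replicate n)) (≤-reflexive (lemma₁ n κ))) ⟩
  (2 * n) ^ length (List.replicate n (2 * (n + κ))) * (2 * n) ^ (2 * κ) * 1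
    ≡⟨ cong (λ m → (2 * n) ^ m * (2 * n) ^ (2 * κ) * 1) (length-replicate n) ⟩
  (2 * n) ^ n * (2 * n) ^ (2 * κ) * 1
    ≡⟨ cong₂ (λ a b → a * b * 1) ([m*n]^o≡m^o*n^o 2 n n) ([m*n]^o≡m^o*n^o 2 n (2 * κ)) ⟩
  2 ^ n * n ^ n * (2 ^ (2 * κ) * n ^ (2 * κ)) * 1
    ≡⟨ cong (λ p → 2 ^ n * n ^ n * (p * n ^ (2 * κ)) * 1) (^-*-assoc 2 2 κ) ⟨
  2 ^ n * n ^ n * (4 ^ κ * n ^ (2 * κ)) * 1
    ≡⟨ lemma₂ (2 ^ n) (n ^ n) (4 ^ κ) (n ^ (2 * κ)) ⟩
  4 ^ κ * n ^ n * (2 ^ n * n ^ (2 * κ)) ∎)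
  where
  open ≤-Reasoning
  lemma₁ : ∀ n κ → n * (2 * (n + κ)) + 2 * κ * n + 0 ≡ (n + 2 * κ + 0) * (2 * n)
  lemma₁ = solve-∀
  lemma₂ : ∀ a b d e → a * b * (d * e) * 1 ≡ d * b * (a * e)
  lemma₂ = solve-∀

cauchy-schwarz-𝟙 : {A : Set} {P : Pred A 0ℓ} (P? : Decidable P) (g : A → ℕ) (xs : List A) →
  ∑ xs (λ x → g x * 𝟙 (P? x)) * ∑ xs (λ x → g x * 𝟙 (P? x)) ≤ ∑ xs (λ x → 𝟙 (P? x)) * ∑ xs (λ x → g x * g x)
cauchy-schwarz-𝟙 P? g []       = ≤-refl
cauchy-schwarz-𝟙 {P = P} P? g (x ∷ xs) = extend (P? x)
  where
  S = ∑ xs (λ x → g x * 𝟙 (P? x))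
  C = ∑ xs (λ x → 𝟙 (P? x))
  R = ∑ xs (λ x → g x * g x)
  -- The sum of 2yg ≤ y² + g² over the members of `P`: it bounds the mixed terms that a further
  -- member contributes to the square.
  cross : ∀ y ys → 2 * (y * ∑ ys (λ x → g x * 𝟙 (P? x))) ≤ ∑ ys (λ x → 𝟙 (P? x)) * (y * y) + ∑ ys (λ x → g x * g x)
  cross y []       = ≤-reflexive (cong (2 *_) (*-zeroʳ y))
  cross y (z ∷ ys) = go (P? z)
    where
    S′ = ∑ ys (λ x → g x * 𝟙 (P? x))
    C′ = ∑ ys (λ x → 𝟙 (P? x))
    R′ = ∑ ys (λ x → g x * g x)
    go : (d : Dec (P z)) → 2 * (y * (g z * 𝟙 d + S′)) ≤ (𝟙 d + C′) * (y * y) + (g z * g z + R′)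
    go (yes _) = ≤-cert (+-mono-≤ (2xy≤x²+y² y (g z)) (cross y ys)) (lemma y (g z) S′ C′ R′)
      where
      lemma : ∀ y g S C R → (1 + C) * (y * y) + (g * g + R) + (2 * (y * g) + 2 * (y * S)) ≡
        2 * (y * (g * 1 + S)) + (y * y + g * g + (C * (y * y) + R))
      lemma = solve-∀
    go (no _)  = ≤-cert-slack (g z * g z) (cross y ys) (lemma y (g z) S′ C′ R′)
      where
      lemma : ∀ y g S C R → (0 + C) * (y * y) + (g * g + R) + 2 * (y * S) ≡
        2 * (y * (g * 0 + S)) + (C * (y * y) + R) + g * g
      lemma = solve-∀
  extend : (d : Dec (P x)) → (g x * 𝟙 d + S) * (g x * 𝟙 d + S) ≤ (𝟙 d + C) * (g x * g x + R)
  extend (yes _) = ≤-cert (+-mono-≤ (cross (g x) xs) (cauchy-schwarz-𝟙 P? g xs)) (lemma (g x) S C R)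
    where
    lemma : ∀ g S C R → (1 + C) * (g * g + R) + (2 * (g * S) + S * S) ≡
      (g * 1 + S) * (g * 1 + S) + (C * (g * g) + R + C * R)
    lemma = solve-∀
  extend (no _)  = ≤-cert-slack (C * (g x * g x)) (cauchy-schwarz-𝟙 P? g xs) (lemma (g x) S C R)
    where
    lemma : ∀ g S C R → (0 + C) * (g * g + R) + S * S ≡ (g * 0 + S) * (g * 0 + S) + C * R + C * (g * g)
    lemma = solve-∀

∑-weight : (w : State → ℕ) (x : Config n) → ∑ (choices n) (weight w x) ≡ totalWeight w x ^ n
∑-weight {n} w x = begin
  ∑ (choices n) (weight w x)
    ≡⟨ ∑-cong (choices n) (λ f → sym (trans
         (cong (weight w x f *_) (trans (∏-const 1 (nodes (step x f))) (^-zeroˡ (length (nodes (step x f))))))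
         (*-identityʳ _))) ⟩
  ∑ (choices n) (λ f → weight w x f * ∏ (nodes (step x f)) (λ _ → 1))
    ≡⟨ ∑-step-∏ w (λ _ → 1) x ⟩
  ∏ (nodes x) (λ u → ∑ (nodes x) (λ v → w v * 1))
    ≡⟨ trans (∏-const (∑ (nodes x) (λ v → w v * 1)) (nodes x))
             (cong₂ _^_ (∑-cong (nodes x) (λ v → *-identityʳ (w v))) (length-toList x)) ⟩
  totalWeight w x ^ n ∎
  where open ≡-Reasoning

weight-square : (w : State → ℕ) (x : Config n) (f : Choices n) →
  weight w x f * weight w x f ≡ weight (λ v → w v * w v) x f
weight-square w x f = go (toList f)
  where
  lemma : ∀ a p → a * p * (a * p) ≡ a * a * (p * p)
  lemma = solve-∀
  go : ∀ is → ∏ is (w ∘ lookup x) * ∏ is (w ∘ lookup x) ≡ ∏ is (λ i → w (lookup x i) * w (lookup x i))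
  go []       = refl
  go (i ∷ is) = trans (lemma (w (lookup x i)) (∏ is (w ∘ lookup x))) (cong (w (lookup x i) * w (lookup x i) *_) (go is))

-- Change of measure: the probability under the tilted choices w is compared with the uniform
-- probability through the second moment of the likelihood ratio.
mass²≤#*second-moment : (w : State → ℕ) (x : Config n) {E : Pred (Choices n) 0ℓ} (E? : Decidable E) →
  mass w x E? * mass w x E? ≤ # E? * totalWeight (λ v → w v * w v) x ^ n
mass²≤#*second-moment {n} w x E? = ≤-trans (cauchy-schwarz-𝟙 E? (weight w x) (choices n))
  (*-monoʳ-≤ (# E?) (≤-reflexive (trans (∑-cong (choices n) (weight-square w x)) (∑-weight (λ v → w v * w v) x))))

mass-complement : (w : State → ℕ) (x : Config n) {E : Pred (Choices n) 0ℓ} (E? : Decidable E) →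
  mass w x E? + mass w x (λ f → ¬? (E? f)) ≡ totalWeight w x ^ n
mass-complement {n} w x E? = begin
  mass w x E? + mass w x (λ f → ¬? (E? f))
    ≡⟨ ∑-+ (λ f → weight w x f * 𝟙 (E? f)) (λ f → weight w x f * 𝟙 (¬? (E? f))) (choices n) ⟨
  ∑ (choices n) (λ f → weight w x f * 𝟙 (E? f) + weight w x f * 𝟙 (¬? (E? f)))
    ≡⟨ ∑-cong (choices n) (λ f → trans (sym (*-distribˡ-+ (weight w x f) (𝟙 (E? f)) _))
         (trans (cong (weight w x f *_) (𝟙-¬ (E? f))) (*-identityʳ _))) ⟩
  ∑ (choices n) (weight w x)
    ≡⟨ ∑-weight w x ⟩
  totalWeight w x ^ n ∎
  where open ≡-Reasoning

weigh-square : ∀ c α β υ v → weigh c α β υ v * weigh c α β υ v ≡ weigh c (α * α) (β * β) (υ * υ) v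
weigh-square Alpha α β υ (colored Alpha) = refl
weigh-square Alpha α β υ (colored Beta)  = refl
weigh-square Alpha α β υ undecided       = refl
weigh-square Beta  α β υ (colored Alpha) = refl
weigh-square Beta  α β υ (colored Beta)  = refl
weigh-square Beta  α β υ undecided       = refl

-- The tilted choices: weight m + r on the β Beta nodes, ρ = m - r on the a Alpha nodes and m on
-- the u undecided ones. W and S are the totals of the weight and of the statistic n - s after one
-- round, for the bias s towards Beta.
module Tilt (m r ρ β a u n D : ℕ) (m≡ : ρ + r ≡ m) (a≡ : a ≡ β + m) (n≡ : β + a + u ≡ n)
            (4≤m : 4 ≤ m) (m²≤n : m * m ≤ n) (n≤2m² : n ≤ 2 * (m * m)) (n≤4β : n ≤ 4 * β)
            (r≥ : 8 * (24 + D) ≤ r) (r≤m : r ≤ m) where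

  W W₂ S X : ℕ
  W = (m + r) * β + ρ * a + m * u
  W₂ = (m + r) * (m + r) * β + ρ * ρ * a + m * m * u
  S = mean (m + r) ρ m 0 2 1 β a u
  X = 2 * (a * β) + u * (a + β)

  private
    W≡ : W + r * m ≡ m * n
    W≡ = go m a n m≡ a≡ n≡
      where
      lemma : ∀ ρ r β u →
        (ρ + r + r) * β + ρ * (β + (ρ + r)) + (ρ + r) * u + r * (ρ + r) ≡ (ρ + r) * (β + (β + (ρ + r)) + u)
      lemma = solve-∀
      go : ∀ m a n → ρ + r ≡ m → a ≡ β + m → β + a + u ≡ n → (m + r) * β + ρ * a + m * u + r * m ≡ m * n
      go _ _ _ refl refl refl = lemma ρ r β u

    S≡ : S + r * X ≡ n * W + m * (W + u * m)
    S≡ = go m a n m≡ a≡ n≡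
      where
      lemma : ∀ ρ r β u →
        ((ρ + r + r) * 0 * β + (ρ + r + r) * 1 * (β + (ρ + r)) + (ρ + r + r) * 0 * u) * β +
        (ρ * 1 * β + ρ * 2 * (β + (ρ + r)) + ρ * 2 * u) * (β + (ρ + r)) +
        ((ρ + r) * 0 * β + (ρ + r) * 2 * (β + (ρ + r)) + (ρ + r) * 1 * u) * u +
        r * (2 * ((β + (ρ + r)) * β) + u * (β + (ρ + r) + β)) ≡
        (β + (β + (ρ + r)) + u) * ((ρ + r + r) * β + ρ * (β + (ρ + r)) + (ρ + r) * u) +
        (ρ + r) * ((ρ + r + r) * β + ρ * (β + (ρ + r)) + (ρ + r) * u + u * (ρ + r))
      lemma = solve-∀
      go : ∀ m a n → ρ + r ≡ m → a ≡ β + m → β + a + u ≡ n →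
        mean (m + r) ρ m 0 2 1 β a u + r * (2 * (a * β) + u * (a + β)) ≡
        n * ((m + r) * β + ρ * a + m * u) + m * ((m + r) * β + ρ * a + m * u + u * m)
      go _ _ _ refl refl refl = lemma ρ r β u

    W₂≡ : n * W₂ + r * r * (m * m) + n * (r * r) * u ≡ W * W + r * r * (n * n)
    W₂≡ = go m a n m≡ a≡ n≡
      where
      lemma : ∀ ρ r β u →
        (β + (β + (ρ + r)) + u) * ((ρ + r + r) * (ρ + r + r) * β + ρ * ρ * (β + (ρ + r)) + (ρ + r) * (ρ + r) * u) +
        r * r * ((ρ + r) * (ρ + r)) + (β + (β + (ρ + r)) + u) * (r * r) * u ≡
        ((ρ + r + r) * β + ρ * (β + (ρ + r)) + (ρ + r) * u) * ((ρ + r + r) * β + ρ * (β + (ρ + r)) + (ρ + r) * u) +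
        r * r * ((β + (β + (ρ + r)) + u) * (β + (β + (ρ + r)) + u))
      lemma = solve-∀
      go : ∀ m a n → ρ + r ≡ m → a ≡ β + m → β + a + u ≡ n →
        n * ((m + r) * (m + r) * β + ρ * ρ * a + m * m * u) + r * r * (m * m) + n * (r * r) * u ≡
        ((m + r) * β + ρ * a + m * u) * ((m + r) * β + ρ * a + m * u) + r * r * (n * n)
      go _ _ _ refl refl refl = lemma ρ r β u

    W≤mn : W ≤ m * n
    W≤mn = ≤-trans (m≤m+n W (r * m)) (≤-reflexive W≡)

    u≤n : u ≤ n
    u≤n = ≤-trans (m≤n+m u (β + a)) (≤-reflexive n≡)

    1≤m : 1 ≤ m
    1≤m = ≤-trans (s≤s z≤n) 4≤m

    S≤ : S ≤ 3 * (m * m * m * n)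
    S≤ = ≤-cert-slack (r * X + 2 * (m * m * n))
      (+-mono-≤ (≤-reflexive S≡) (+-mono-≤ (*-monoʳ-≤ (n + m) W≤mn) (+-mono-≤ (*-monoʳ-≤ (m * m) u≤n)
        (+-mono-≤ (*-monoʳ-≤ (m * n) n≤2m²) (*-monoʳ-≤ (m * m * n) 4≤m)))))
      (lemma m n W S u (r * X))
      where
      lemma : ∀ m n W S u Y →
        3 * (m * m * m * n) + (S + Y + ((n + m) * W + (m * m * u + (m * n * n + m * m * n * 4)))) ≡
        S + (n * W + m * (W + u * m) + ((n + m) * (m * n) + (m * m * n + (m * n * (2 * (m * m)) + m * m * n * m)))) +
        (Y + 2 * (m * m * n))
      lemma = solve-∀

    -- X ≥ 2β² ≥ n²/8 because n ≤ 4β. As W ≤ mn, the tilt thus lowers the mean of the statistic, by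
    -- r X / W, at least by (24 + D) m.
    drift : (24 + D) * (m * m * n) ≤ r * X
    drift = *-cancelˡ-≤ 8 (begin
      8 * ((24 + D) * (m * m * n))   ≡⟨ *-assoc 8 (24 + D) (m * m * n) ⟨
      8 * (24 + D) * (m * m * n)     ≤⟨ *-mono-≤ r≥ (*-monoˡ-≤ n m²≤n) ⟩
      r * (n * n)                    ≤⟨ *-monoʳ-≤ r (*-mono-≤ n≤4β n≤4β) ⟩
      r * (4 * β * (4 * β))          ≡⟨ lemma r β ⟩
      8 * (r * (2 * (β * β)))        ≤⟨ *-monoʳ-≤ 8 (*-monoʳ-≤ r
                                          (≤-trans (*-monoʳ-≤ 2 (*-monoˡ-≤ β β≤a)) (m≤m+n (2 * (a * β)) (u * (a + β))))) ⟩
      8 * (r * X)                    ∎)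
      where
      open ≤-Reasoning
      β≤a : β ≤ a
      β≤a = ≤-trans (m≤m+n β m) (≤-reflexive (sym a≡))
      lemma : ∀ r β → r * (4 * β * (4 * β)) ≡ 8 * (r * (2 * (β * β)))
      lemma = solve-∀

  -- The scale is `m`, of order √n, with B = 2 and L = 1: for a mean of order n both costs of the
  -- Chernoff bound are then of order m. Together with the initial bias, which a round at most
  -- doubles in the mean, they take 19 m⁴n of the 24 m⁴n provided by `drift`; the part with `D` is
  -- the lead.
  gap : ∀ k → k + D * m ≡ n → suc m * ((m + 2) * S + 1 * (m * m) * W) ≤ k * (m * m) * W
  gap k k≡ = ≤-cert-slack (5 * (m * m * m * m * n))
    (+-mono-≤ (*-monoʳ-≤ (m * m) (≤-reflexive S≡))
    (+-mono-≤ (*-monoʳ-≤ (m * m) drift)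
    (+-mono-≤ (*-monoʳ-≤ (5 * m) S≤)
    (+-mono-≤ (*-monoʳ-≤ (2 * S + m * m * W) 1≤m)
    (+-mono-≤ (*-monoʳ-≤ ((D + 3) * (m * m * m)) W≤mn)
    (+-mono-≤ (*-monoʳ-≤ (m * m * m * m) u≤n)
              (*-monoʳ-≤ (m * m * W) (≤-reflexive (sym k≡)))))))))
    (lemma m n W S (r * X) u k D)
    where
    lemma : ∀ m n W S Y u k D →
      k * (m * m) * W +
        (m * m * (S + Y) + (m * m * ((24 + D) * (m * m * n)) + (5 * m * S + ((2 * S + m * m * W) * 1 +
          ((D + 3) * (m * m * m) * W + (m * m * m * m * u + m * m * W * n)))))) ≡
      (1 + m) * ((m + 2) * S + 1 * (m * m) * W) +
        (m * m * (n * W + m * (W + u * m)) + (m * m * Y + (5 * m * (3 * (m * m * m * n)) + ((2 * S + m * m * W) * m +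
          ((D + 3) * (m * m * m) * (m * n) + (m * m * m * m * n + m * m * W * (k + D * m))))))) +
        5 * (m * m * m * m * n)
    lemma = solve-∀

  W≢0 : NonZero W
  W≢0 = >-nonZero (begin-strict
    0                          <⟨ *-mono-≤ (≤-trans 1≤m (m≤m+n m r)) 1≤β ⟩
    (m + r) * β                ≤⟨ ≤-trans (m≤m+n _ (ρ * a)) (m≤m+n _ (m * u)) ⟩
    W                          ∎)
    where
    open ≤-Reasoning
    1≤β : 1 ≤ β
    1≤β = *-cancelˡ-< 4 0 β (≤-trans (≤-trans (*-mono-≤ 1≤m 1≤m) m²≤n) n≤4β)

  -- Under uniform choices the likelihood ratio has second moment (n W₂ / W²)^n, and here its base
  -- is bounded by 1 + 8r²/n, so the power stays bounded as n grows. The excess n W₂ - W² is at most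
  -- r²n², like a variance, since the weights differ from `m` by at most `r`; and n³ ≤ 8W².
  second-moment : n * (n * W₂) ≤ W * W * (n + 8 * (r * r))
  second-moment = begin
    n * (n * W₂)                                   ≤⟨ *-monoʳ-≤ n (≤-trans
        (≤-trans (m≤m+n _ (r * r * (m * m))) (m≤m+n _ (n * (r * r) * u))) (≤-reflexive W₂≡)) ⟩
    n * (W * W + r * r * (n * n))                  ≡⟨ lemma₁ n W (r * r) ⟩
    W * W * n + r * r * (n * n * n)                ≤⟨ +-monoʳ-≤ (W * W * n) (*-monoʳ-≤ (r * r) n³≤) ⟩
    W * W * n + r * r * (8 * (W * W))              ≡⟨ lemma₂ n W (r * r) ⟩
    W * W * (n + 8 * (r * r))                      ∎
    where
    open ≤-Reasoning
    lemma₁ : ∀ n W R → n * (W * W + R * (n * n)) ≡ W * W * n + R * (n * n * n)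
    lemma₁ = solve-∀
    lemma₂ : ∀ n W R → W * W * n + R * (8 * (W * W)) ≡ W * W * (n + 8 * R)
    lemma₂ = solve-∀
    2r≤n : 2 * r ≤ n
    2r≤n = ≤-trans (*-mono-≤ (≤-trans (s≤s (s≤s z≤n)) 4≤m) r≤m) m²≤n
    mn≤2W : m * n ≤ 2 * W
    mn≤2W = ≤-cert (+-mono-≤ (≤-reflexive (sym W≡)) (+-mono-≤ (≤-reflexive (sym W≡)) (*-monoʳ-≤ m 2r≤n))) (lemma m n W r)
      where
      lemma : ∀ m n W r → 2 * W + (m * n + (m * n + m * (2 * r))) ≡ m * n + (W + r * m + (W + r * m + m * n))
      lemma = solve-∀
    n³≤ : n * n * n ≤ 8 * (W * W)
    n³≤ = begin
      n * n * n                  ≤⟨ *-monoʳ-≤ (n * n) n≤2m² ⟩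
      n * n * (2 * (m * m))      ≡⟨ lemma m n ⟩
      2 * (m * n * (m * n))      ≤⟨ *-monoʳ-≤ 2 (*-mono-≤ mn≤2W mn≤2W) ⟩
      2 * (2 * W * (2 * W))      ≡⟨ lemma′ W ⟩
      8 * (W * W)                ∎
      where
      lemma : ∀ m n → n * n * (2 * (m * m)) ≡ 2 * (m * n * (m * n))
      lemma = solve-∀
      lemma′ : ∀ W → 2 * (2 * W * (2 * W)) ≡ 8 * (W * W)
      lemma′ = solve-∀

-- At least half of the tilted mass lies on the event, so by Cauchy-Schwarz (W^n / 2)² is at most
-- its number of choices times W₂^n. The `suc` in the exponent is the factor 4 from this half, the
-- rest is the second moment.
upset : ∀ {n} (x : Config n) m r ρ D → .{{NonZero n}} → ρ + r ≡ m → support Alpha x ≡ support Beta x + m →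
  4 ≤ m → m * m ≤ n → n ≤ 2 * (m * m) → n ≤ 4 * support Beta x → 8 * (24 + D) ≤ r → r ≤ m →
  n ^ n ≤ 4 ^ suc (8 * (r * r)) * # (λ f → support Alpha (step x f) + D * m ≤? support Beta (step x f))
upset {n} x m r ρ D m≡ a≡ 4≤m m²≤n n≤2m² n≤4β r≥ r≤m = *-cancelˡ-≤ (W ^ n * W ^ n) {{m*n≢0 _ _ {{W^n≢0}} {{W^n≢0}}}} (begin
  W ^ n * W ^ n * n ^ n
    ≤⟨ *-monoˡ-≤ (n ^ n) (*-mono-≤ W^n≤ W^n≤) ⟩
  2 * μ * (2 * μ) * n ^ n
    ≡⟨ lemma₁ μ (n ^ n) ⟩
  4 * (μ * μ) * n ^ n
    ≤⟨ *-monoˡ-≤ (n ^ n) (*-monoʳ-≤ 4 (mass²≤#*second-moment w x E?)) ⟩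
  4 * (# E? * totalWeight (λ v → w v * w v) x ^ n) * n ^ n
    ≡⟨ cong (λ t → 4 * (# E? * t ^ n) * n ^ n) (trans (∑-cong (nodes x) (weigh-square Beta (m + r) ρ m)) (∑-weigh Beta _ _ _ x)) ⟩
  4 * (# E? * W₂ ^ n) * n ^ n
    ≡⟨ lemma₂ (# E?) (W₂ ^ n) (n ^ n) ⟩
  4 * # E? * (n ^ n * W₂ ^ n)
    ≤⟨ *-monoʳ-≤ (4 * # E?) moments ⟩
  4 * # E? * (W ^ n * W ^ n * 4 ^ κ)
    ≡⟨ lemma₃ (# E?) (W ^ n * W ^ n) (4 ^ κ) ⟩
  W ^ n * W ^ n * (4 ^ suc κ * # E?) ∎)
  where
  open ≤-Reasoning
  open Tilt m r ρ (support Beta x) (support Alpha x) (q x) n D m≡ a≡ (support-total Beta x) 4≤m m²≤n n≤2m² n≤4β r≥ r≤m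
  κ = 8 * (r * r)
  w : State → ℕ
  w = weigh Beta (m + r) ρ m
  E? : Decidable (λ f → support Alpha (step x f) + D * m ≤ support Beta (step x f))
  E? f = support Alpha (step x f) + D * m ≤? support Beta (step x f)
  μ = mass w x E?
  W^n≢0 : NonZero (W ^ n)
  W^n≢0 = m^n≢0 W n {{W≢0}}
  lemma₁ : ∀ μ N → 2 * μ * (2 * μ) * N ≡ 4 * (μ * μ) * N
  lemma₁ = solve-∀
  lemma₂ : ∀ e v N → 4 * (e * v) * N ≡ 4 * e * (N * v)
  lemma₂ = solve-∀
  lemma₃ : ∀ e v t → 4 * e * (v * t) ≡ v * (4 * t * e)
  lemma₃ = solve-∀
  Dm≤n : D * m ≤ n
  Dm≤n = ≤-trans (*-monoˡ-≤ m (≤-trans (≤-trans (m≤n+m D 24) (m≤n*m (24 + D) 8)) (≤-trans r≥ r≤m))) m²≤n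
  missed : ∀ a b u → b + a + u ≡ n → b < a + D * m → n ∸ D * m ≤ 0 * b + 2 * a + 1 * u
  missed a b u total b<a+Dm = m≤n+o⇒m∸n≤o n (D * m)
    (subst (_≤ D * m + (0 * b + 2 * a + 1 * u)) total (≤-cert (<⇒≤ b<a+Dm) (lemma a b u (D * m))))
    where
    lemma : ∀ a b u e → e + (0 * b + 2 * a + 1 * u) + b ≡ b + a + u + (a + e)
    lemma = solve-∀
  rare : mass w x (λ f → ¬? (E? f)) * 2 ≤ W ^ n
  rare = chernoff-weigh Beta (m + r) ρ m 0 2 1 x 2 m (n ∸ D * m) 1 {{>-nonZero (≤-trans (s≤s z≤n) 4≤m)}} {{W≢0}}
    z≤n ≤-refl (s≤s z≤n) 4≤m (λ f → ¬? (E? f))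
    (λ f ¬e → missed (support Alpha (step x f)) (support Beta (step x f)) (q (step x f)) (support-total Beta (step x f)) (≰⇒> ¬e))
    (gap (n ∸ D * m) (m∸n+n≡m Dm≤n))
  W^n≤ : W ^ n ≤ 2 * μ
  W^n≤ = ≤-cert rare (subst (λ t → 2 * μ + mass w x (λ f → ¬? (E? f)) * 2 ≡ t + t)
    (trans (mass-complement w x E?) (cong (_^ n) (∑-weigh Beta (m + r) ρ m x)))
    (lemma μ (mass w x (λ f → ¬? (E? f)))))
    where
    lemma : ∀ μ ν → 2 * μ + ν * 2 ≡ μ + ν + (μ + ν)
    lemma = solve-∀
  moments : n ^ n * W₂ ^ n ≤ W ^ n * W ^ n * 4 ^ κ
  moments = *-cancelʳ-≤ _ _ (n ^ n) {{m^n≢0 n n}} (begin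
    n ^ n * W₂ ^ n * n ^ n            ≡⟨ xy∙z≈z∙xy (n ^ n) (W₂ ^ n) (n ^ n) ⟩
    n ^ n * (n ^ n * W₂ ^ n)          ≡⟨ trans ([m*n]^o≡m^o*n^o n (n * W₂) n) (cong (n ^ n *_) ([m*n]^o≡m^o*n^o n W₂ n)) ⟨
    (n * (n * W₂)) ^ n                ≤⟨ ^-monoˡ-≤ n second-moment ⟩
    (W * W * (n + κ)) ^ n             ≡⟨ trans ([m*n]^o≡m^o*n^o (W * W) (n + κ) n) (cong (_* (n + κ) ^ n) ([m*n]^o≡m^o*n^o W W n)) ⟩
    W ^ n * W ^ n * (n + κ) ^ n       ≤⟨ *-monoʳ-≤ (W ^ n * W ^ n) ([n+κ]^n≤4^κ*n^n n κ) ⟩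
    W ^ n * W ^ n * (4 ^ κ * n ^ n)   ≡⟨ *-assoc (W ^ n * W ^ n) (4 ^ κ) (n ^ n) ⟨
    W ^ n * W ^ n * 4 ^ κ * n ^ n     ∎)

hits-after-event : ∀ {n} {P : Pred (Config n) 0ℓ} (P? : Decidable P) T x {E : Pred (Choices n) 0ℓ} (E? : Decidable E) →
  (∀ f → E f → 2 * misses P? T (step x f) ≤ #Ω n T) → # E? * #Ω n T ≤ 2 * hits P? (suc T) x
hits-after-event {n} P? T x E? likely = ≤-cert bound
  (subst (λ t → 2 * hits P? (suc T) x + (# E? * #Ω n T + 2 * misses P? (suc T) x) ≡ # E? * #Ω n T + 2 * t)
    (hits+misses P? (suc T) x) (lemma₁ (hits P? (suc T) x) (misses P? (suc T) x) (# E? * #Ω n T)))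
  where
  open ≤-Reasoning
  Ω = #Ω n T
  lemma₁ : ∀ h m e → 2 * h + (e + 2 * m) ≡ e + 2 * (h + m)
  lemma₁ = solve-∀
  pointwise : ∀ f → 𝟙 (E? f) * Ω + 2 * misses P? T (step x f) ≤ 2 * Ω
  pointwise f with E? f
  ... | yes e = ≤-trans (+-monoʳ-≤ (1 * Ω) (likely f e)) (≤-reflexive (lemma₂ Ω))
    where
    lemma₂ : ∀ Ω → 1 * Ω + Ω ≡ 2 * Ω
    lemma₂ = solve-∀
  ... | no _  = *-monoʳ-≤ 2 (misses≤#Ω P? T (step x f))
  bound : # E? * Ω + 2 * misses P? (suc T) x ≤ 2 * #Ω n (suc T)
  bound = begin
    # E? * Ω + 2 * misses P? (suc T) x
      ≤⟨ +-monoʳ-≤ (# E? * Ω) (*-monoʳ-≤ 2 (misses-suc P? T x)) ⟩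
    # E? * Ω + 2 * ∑ (choices n) (λ f → misses P? T (step x f))
      ≡⟨ cong₂ _+_ (∑-*ʳ Ω (λ f → 𝟙 (E? f)) (choices n)) (∑-* 2 (λ f → misses P? T (step x f)) (choices n)) ⟨
    ∑ (choices n) (λ f → 𝟙 (E? f) * Ω) + ∑ (choices n) (λ f → 2 * misses P? T (step x f))
      ≡⟨ ∑-+ (λ f → 𝟙 (E? f) * Ω) (λ f → 2 * misses P? T (step x f)) (choices n) ⟨
    ∑ (choices n) (λ f → 𝟙 (E? f) * Ω + 2 * misses P? T (step x f))
      ≤⟨ ∑-mono (choices n) pointwise ⟩
    ∑ (choices n) (λ _ → 2 * Ω)
      ≡⟨ ∑-choices n (2 * Ω) ⟩
    n ^ n * (2 * Ω)
      ≡⟨ x∙yz≈y∙xz (n ^ n) 2 Ω ⟩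
    2 * #Ω n (suc T) ∎

1/-≤-/ : ∀ F h D .{{_ : NonZero F}} .{{_ : NonZero D}} → D ≤ F * h → (pos 1 ℚ./ F) ℚ.≤ (pos h ℚ./ D)
1/-≤-/ F h D D≤Fh = ℚ.*-cancelʳ-≤-pos (fromℕ F) (ℚ.*-cancelʳ-≤-pos (fromℕ D) (begin
  (pos 1 ℚ./ F) ℚ.* fromℕ F ℚ.* fromℕ D    ≡⟨ trans (cong (ℚ._* fromℕ D) (/-* 1 F)) (ℚ.*-identityˡ (fromℕ D)) ⟩
  fromℕ D                                ≤⟨ fromℕ-mono-≤ D≤Fh ⟩
  fromℕ (F * h)                          ≡⟨ fromℕ-* F h ⟩
  fromℕ F ℚ.* fromℕ h                    ≡⟨ cong (fromℕ F ℚ.*_) (/-* h D) ⟨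
  fromℕ F ℚ.* ((pos h ℚ./ D) ℚ.* fromℕ D)  ≡⟨ swap (fromℕ F) (pos h ℚ./ D) (fromℕ D) ⟩
  (pos h ℚ./ D) ℚ.* fromℕ F ℚ.* fromℕ D    ∎))
  where
  open ℚ.≤-Reasoning
  instance
    _ = fromℕ-positive F
    _ = fromℕ-positive D
  swap : ∀ p q r → p ℚ.* (q ℚ.* r) ≡ q ℚ.* p ℚ.* r
  swap = +-*-Solver.solve 3 (λ p q r → p :* (q :* r) := q :* p :* r) refl
    where open +-*-Solver

-- Beta wins from a deficit of about √n: with constant probability the first round turns it into
-- a lead of D √n, which is then amplified.
module NearTie (C K : ℕ) (converges : Convergence C K)
                (V : ℕ) (V≢0 : NonZero V) (level≤ : ∀ n L → 2 * level n L ≤ V * (L * n))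
                (D r F : ℕ) (D≡ : 40 * V ≡ D) (r≥ : 8 * (24 + D) ≤ r)
                (F≢0 : NonZero F) (F≡ : 2 * 4 ^ suc (8 * (r * r)) ≡ F)
                (n : ℕ) .{{_ : NonZero n}} (N≤n : 2 ^ (K + 20) + r * r ≤ n) where

  open ≤-Reasoning

  m β u : ℕ
  m = proj₁ (isqrt n)

  m²≤n : m * m ≤ n
  m²≤n = proj₁ (proj₂ (isqrt n))

  r≤m : r ≤ m
  r≤m = ≮⇒≥ λ m<r → <-irrefl refl (≤-trans (proj₂ (proj₂ (isqrt n)))
    (≤-trans (*-mono-≤ m<r m<r) (m+n≤o⇒n≤o (2 ^ (K + 20)) N≤n)))

  4≤m : 4 ≤ m
  4≤m = ≤-trans (≤-trans (m≤m+n 4 (20 + D)) (≤-trans (m≤n*m (24 + D) 8) r≥)) r≤m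

  4m≤m² : m * 4 ≤ m * m
  4m≤m² = *-monoʳ-≤ m 4≤m

  n≤2m² : n ≤ 2 * (m * m)
  n≤2m² = ≤-trans (s≤s⁻¹ (proj₂ (proj₂ (isqrt n)))) (≤-cert-slack (2 * m) 4m≤m² (lemma m))
    where
    lemma : ∀ m → 2 * (m * m) + m * 4 ≡ m + m * (1 + m) + m * m + 2 * m
    lemma = solve-∀

  -- The bias is exactly m = ⌊√n⌋; the parity of n - m decides whether one node or none is
  -- undecided.
  β = (n ∸ m) ℕ./ 2
  u = (n ∸ m) % 2

  m≤n : m ≤ n
  m≤n = ≤-trans (m≤m*n m m {{>-nonZero (≤-trans (s≤s z≤n) 4≤m)}}) m²≤n

  total : β + m + β + u ≡ n
  total = trans (lemma β m u) (trans (cong (_+ m) (sym (m≡m%n+[m/n]*n (n ∸ m) 2))) (m∸n+n≡m m≤n))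
    where
    lemma : ∀ β m u → β + m + β + u ≡ u + β * 2 + m
    lemma = solve-∀

  n≤4β : n ≤ 4 * β
  n≤4β = subst (_≤ 4 * β) total (≤-cert
    (+-mono-≤ (≤-trans 4m≤m² (≤-trans m²≤n (≤-reflexive (sym total))))
              (*-monoʳ-≤ 2 (≤-trans (<⇒≤ (m%n<n (n ∸ m) 2)) (≤-trans (m≤m+n 2 2) 4≤m))))
    (lemma β m u))
    where
    lemma : ∀ β m u → 4 * β + (m * 4 + 2 * u) ≡ β + m + β + u + (β + m + β + u + 2 * m)
    lemma = solve-∀

  initial : ∃[ x ] support {n} Alpha x ≡ β + m × support Beta x ≡ β × q x ≡ u
  initial = configOf n (β + m) β u total

  x : Config n
  x = proj₁ initial

  b≡ : support Beta x ≡ β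
  b≡ = proj₁ (proj₂ (proj₂ initial))

  a≡ : support Alpha x ≡ support Beta x + m
  a≡ = trans (proj₁ (proj₂ initial)) (cong (_+ m) (sym b≡))

  minority : Minority Beta x
  minority = ≤-trans (m<m+n (support Beta x) (≤-trans (s≤s z≤n) 4≤m)) (≤-reflexive (sym a≡))

  ½√n≤∣s∣ : (pos 1 ℚ./ 2) √ n ≤ ∣s∣ x
  ½√n≤∣s∣ = subst ((pos 1 ℚ./ 2) √ n ≤_) (sym (∣s∣≡ Alpha x m a≡)) (ℚ.*-cancelʳ-≤-pos (fromℕ 4) (ℚR.begin
    (pos 1 ℚ./ 2) ℚ.* (pos 1 ℚ./ 2) ℚ.* fromℕ n ℚ.* fromℕ 4   ℚR.≡⟨ swap (pos 1 ℚ./ 4) (fromℕ n) (fromℕ 4) ⟩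
    (pos 1 ℚ./ 4) ℚ.* fromℕ 4 ℚ.* fromℕ n                   ℚR.≡⟨ trans (cong (ℚ._* fromℕ n) (/-* 1 4)) (ℚ.*-identityˡ (fromℕ n)) ⟩
    fromℕ n                                               ℚR.≤⟨ fromℕ-mono-≤ (≤-trans n≤2m²
      (≤-trans (*-monoˡ-≤ (m * m) (m≤m+n 2 2)) (≤-reflexive (*-comm 4 (m * m))))) ⟩
    fromℕ (m * m * 4)                                     ℚR.≡⟨ fromℕ-* (m * m) 4 ⟩
    fromℕ (m * m) ℚ.* fromℕ 4                             ℚR.∎))
    where
    module ℚR = ℚ.≤-Reasoning
    swap : ∀ p q r → p ℚ.* q ℚ.* r ≡ p ℚ.* r ℚ.* q
    swap = +-*-Solver.solve 3 (λ p q r → p :* q :* r := p :* r :* q) refl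
      where open +-*-Solver

  ∣s∣≤√n : ∣s∣ x ≤ 1ℚ √ n
  ∣s∣≤√n = subst (_≤ 1ℚ √ n) (sym (∣s∣≡ Alpha x m a≡)) (ℚ.≤-trans (fromℕ-mono-≤ m²≤n)
    (ℚ.≤-reflexive (sym (trans (cong (ℚ._* fromℕ n) (ℚ.*-identityˡ 1ℚ)) (ℚ.*-identityˡ (fromℕ n))))))

  K+20≤ℓ : K + 20 ≤ log n
  K+20≤ℓ = log≥ (K + 20) n (m+n≤o⇒m≤o (2 ^ (K + 20)) N≤n)

  R : ℕ
  R = C * log n

  P? : Decidable (Monochromatic {n} Beta)
  P? = monochromatic? Beta

  lead-wins : ∀ y → support Alpha y + D * m ≤ support Beta y → 2 * misses P? R y ≤ #Ω n R
  lead-wins y lead = *-cancelˡ-≤ 6 (begin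
    6 * (2 * misses P? R y)     ≡⟨ trans (sym (*-assoc 6 2 (misses P? R y))) (*-comm 12 (misses P? R y)) ⟩
    misses P? R y * 12          ≤⟨ *-monoʳ-≤ (misses P? R y) (≤ᵇ⇒≤ 12 (2 ^ 20) tt) ⟩
    misses P? R y * 2 ^ 20      ≤⟨ converges Beta n y σ 20 (m+n≤o⇒m≤o K K+20≤ℓ) ≤-refl (m+n≤o⇒n≤o K K+20≤ℓ) b≡a+σ strong ⟩
    6 * #Ω n R                  ∎)
    where
    σ = support Beta y ∸ support Alpha y
    b≡a+σ : support Beta y ≡ support Alpha y + σ
    b≡a+σ = sym (m+[n∸m]≡n (m+n≤o⇒m≤o (support Alpha y) lead))
    Dm≤σ : D * m ≤ σ
    Dm≤σ = +-cancelˡ-≤ (support Alpha y) _ _ (≤-trans lead (≤-reflexive b≡a+σ))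
    1≤D : 1 ≤ D
    1≤D = ≤-trans (>-nonZero⁻¹ V {{V≢0}}) (≤-trans (m≤n*m V 40) (≤-reflexive D≡))
    -- The origin of `D`: with n ≤ 2m² the requirement for L = 20 is at most 40 V m² = D m², and D ≤
    -- D².
    strong : 2 * level n 20 ≤ σ * σ
    strong = ≤-trans (level≤ n 20) (begin
      V * (20 * n)                ≤⟨ *-monoʳ-≤ V (*-monoʳ-≤ 20 n≤2m²) ⟩
      V * (20 * (2 * (m * m)))    ≡⟨ lemma V (m * m) ⟩
      1 * (40 * V) * (m * m)      ≡⟨ cong (λ e → 1 * e * (m * m)) D≡ ⟩
      1 * D * (m * m)             ≤⟨ *-monoˡ-≤ (m * m) (*-monoˡ-≤ D 1≤D) ⟩
      D * D * (m * m)             ≡⟨ lemma′ D m ⟩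
      D * m * (D * m)             ≤⟨ *-mono-≤ Dm≤σ Dm≤σ ⟩
      σ * σ                       ∎)
      where
      lemma : ∀ V M → V * (20 * (2 * M)) ≡ 1 * (40 * V) * M
      lemma = solve-∀
      lemma′ : ∀ D m → D * D * (m * m) ≡ D * m * (D * m)
      lemma′ = solve-∀

  likely : #Ω n (suc R) ≤ F * hits P? (suc R) x
  likely = begin
    n ^ n * #Ω n R                     ≤⟨ *-monoˡ-≤ (#Ω n R) (upset x m r (m ∸ r) D (m∸n+n≡m r≤m) a≡ 4≤m m²≤n n≤2m²
                                            (subst (λ b → n ≤ 4 * b) (sym b≡) n≤4β) r≥ r≤m) ⟩
    4 ^ κ * # E? * #Ω n R              ≡⟨ *-assoc (4 ^ κ) (# E?) (#Ω n R) ⟩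
    4 ^ κ * (# E? * #Ω n R)            ≤⟨ *-monoʳ-≤ (4 ^ κ) (hits-after-event P? R x E? (λ f → lead-wins (step x f))) ⟩
    4 ^ κ * (2 * hits P? (suc R) x)    ≡⟨ x∙yz≈yx∙z (4 ^ κ) 2 (hits P? (suc R) x) ⟩
    2 * 4 ^ κ * hits P? (suc R) x      ≡⟨ cong (_* hits P? (suc R) x) F≡ ⟩
    F * hits P? (suc R) x              ∎
    where
    κ = suc (8 * (r * r))
    E? : Decidable (λ f → support Alpha (step x f) + D * m ≤ support Beta (step x f))
    E? f = support Alpha (step x f) + D * m ≤? support Beta (step x f)

  eventually : EventuallyWithProb≥ P? x (ℚ._/_ (pos 1) F {{F≢0}})
  -- One horizon serves every η, since the probability within `suc R` rounds is already at least
  -- `ε`.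
  eventually η 0<η = suc R , ℚ.≤-trans
    (ℚ.≤-trans (ℚ.+-monoʳ-≤ ε (ℚ.neg-antimono-≤ (ℚ.<⇒≤ 0<η))) (ℚ.≤-reflexive (ℚ.+-identityʳ ε)))
    (1/-≤-/ F (length (List.filter R? (outcomes n (suc R)))) (#Ω n (suc R)) {{F≢0}} {{m^n≢0 (n ^ n) (suc R) {{m^n≢0 n n}}}}
      (subst (λ h → #Ω n (suc R) ≤ F * h) (sym (length-filter R? (outcomes n (suc R)))) likely))
    where
    ε = ℚ._/_ (pos 1) F {{F≢0}}
    R? = reachesWithin? P? x (suc R)

MinorityMayWin : Set
MinorityMayWin = ∃[ c₁ ] 0ℚ ℚ.< c₁ × ∃[ c₂ ] 0ℚ ℚ.< c₂ × ∃[ ε ] 0ℚ ℚ.< ε × ∃[ N ]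
  ((n : ℕ) .{{_ : NonZero n}} → N ≤ n →
   ∃[ x ] c₁ √ n ≤ ∣s∣ {n} x × ∣s∣ x ≤ c₂ √ n ×
     ∃[ min ] Minority min x × EventuallyWithProb≥ (monochromatic? min) x ε)

minority-may-win : ∃[ C ] ∃[ K ] Convergence C K → MinorityMayWin
minority-may-win (C , K , converges) = with-bound level-bound
  where
  with-constants : ∀ V → NonZero V → (∀ n L → 2 * level n L ≤ V * (L * n)) →
    ∀ D → 40 * V ≡ D → ∀ r → 8 * (24 + D) ≤ r → ∀ F → NonZero F → 2 * 4 ^ suc (8 * (r * r)) ≡ F → MinorityMayWin
  with-constants V V≢0 level≤ D D≡ r r≥ F F≢0 F≡ =
    c₁ , ℚ.positive⁻¹ c₁ , 1ℚ , ℚ.positive⁻¹ 1ℚ , ε , ℚ.positive⁻¹ ε {{ℚ.normalize-pos 1 F {{F≢0}}}} , 2 ^ (K + 20) + r * r ,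
    λ n N≤n → let open NearTie C K converges V V≢0 level≤ D r F D≡ r≥ F≢0 F≡ n N≤n in
      x , ½√n≤∣s∣ , ∣s∣≤√n , Beta , minority , eventually
    where
    c₁ ε : ℚ
    c₁ = pos 1 ℚ./ 2
    ε = ℚ._/_ (pos 1) F {{F≢0}}
  scaled-power : ∀ r → ∃[ F ] NonZero F × 2 * 4 ^ suc (8 * (r * r)) ≡ F
  scaled-power r = go (8 * (r * r))
    where
    go : ∀ κ → ∃[ F ] NonZero F × 2 * 4 ^ suc κ ≡ F
    go κ = 2 * 4 ^ suc κ , m*n≢0 2 (4 ^ suc κ) {{it}} {{m^n≢0 4 (suc κ)}} , refl
  with-r : ∀ V → NonZero V → (∀ n L → 2 * level n L ≤ V * (L * n)) →
    ∀ D → 40 * V ≡ D → ∀ r → 8 * (24 + D) ≤ r → MinorityMayWin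
  with-r V V≢0 level≤ D D≡ r r≥ = let F , F≢0 , F≡ = scaled-power r in with-constants V V≢0 level≤ D D≡ r r≥ F F≢0 F≡
  with-bound : ∃[ V ] NonZero V × (∀ n L → 2 * level n L ≤ V * (L * n)) → MinorityMayWin
  with-bound (V , V≢0 , level≤) = with-r V V≢0 level≤ (40 * V) refl (8 * (24 + 40 * V)) ≤-refl

theorem3p2 : ( (γ : ℚ) → 0ℚ ℚ.< γ →
    ∃[ C ] ∃[ c ] 0ℚ ℚ.< c × ∃[ N ]
    ((n : ℕ) .{{_ : NonZero n}} → N ℕ.≤ n →
    (x : Config n) → γ √ (n ℕ.* log n) ≤ ∣s∣ x →
    (maj : Color) → Majority maj x →
    ℙ (reachesWithin? (monochromatic? maj) x (C ℕ.* log n)) ≥1- n ^- c) )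
    ×
    ( ∃[ δ ] 0ℚ ℚ.< δ × ∃[ κ ] 0ℚ ℚ.< κ × ∃[ c ] 0ℚ ℚ.< c × ∃[ N ]
    ((n : ℕ) .{{_ : NonZero n}} → N ℕ.≤ n →
    ∃[ x ] δ √ (n ℕ.* log n) ≤ ∣s∣ {n} x ×
    ((T : ℕ) → fromℕ T ℚ.< κ ℚ.* fromℕ (log n) →
    ℙ (¬? ∘ reachesWithin? absorbing? x T) ≥1- n ^- c)) )
    ×
    ( ∃[ c₁ ] 0ℚ ℚ.< c₁ × ∃[ c₂ ] 0ℚ ℚ.< c₂ × ∃[ ε ] 0ℚ ℚ.< ε × ∃[ N ]
    ((n : ℕ) .{{_ : NonZero n}} → N ℕ.≤ n →
    ∃[ x ] c₁ √ n ≤ ∣s∣ {n} x × ∣s∣ x ≤ c₂ √ n ×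
    ∃[ min ] Minority min x × EventuallyWithProb≥ (monochromatic? min) x ε) )
theorem3p2 = majority-reached-whp convergence , lower-bound-rounds , minority-may-win convergence
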